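{- Let $\frac12<\sigma<1$, $r\ge2$, $\boldsymbol\theta\in\mathbb{R}^r$, and let $\boldsymbol\chi=(\chi_1,\dots,\chi_r)$ be an $r$-tuple of pairwise inequivalent Dirichlet characters. There is $\alpha_0(\sigma,r)$, depending only on $\sigma$ and $r$, such that for $\boldsymbol\alpha=(\alpha,1,\dots,1)\in\mathbb{R}^r$ with $\alpha\ge\alpha_0(\sigma,r)$, we have $\Xi_j(\sigma,\boldsymbol\chi,\boldsymbol\theta;\boldsymbol\alpha)>0$ for all $1\le j\le r$ and $$\xi(\sigma,\boldsymbol\chi,\boldsymbol\theta;\boldsymbol\alpha)>\sum_{j=1}^r\Xi_j(\sigma,\boldsymbol\chi,\boldsymbol\theta;\boldsymbol\alpha)^{\frac1{1-\sigma}}.$$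
   Context: Two Dirichlet characters are equivalent if they are induced by the same primitive character. Let $d$ be the least common multiple of the moduli of $\chi_1,\dots,\chi_r$ and $\phi$ the Euler totient function. For $\boldsymbol\alpha=(\alpha_1,\dots,\alpha_r)\in(\mathbb{R}_{>0})^r$, $$\xi(\sigma,\boldsymbol\chi,\boldsymbol\theta;\boldsymbol\alpha)=\frac1{\phi(d)}\sum_{u\in(\mathbb{Z}/d\mathbb{Z})^\times}\Bigl|\sum_{j=1}^r\alpha_je^{ -i\theta_j}\chi_j(u)\Bigr|^{1/\sigma},$$ $$\Xi_j(\sigma,\boldsymbol\chi,\boldsymbol\theta;\boldsymbol\alpha)=\frac1{\phi(d)}\sum^{*}_{u\in(\mathbb{Z}/d\mathbb{Z})^\times}\Bigl|\sum_{\ell=1}^r\alpha_\ell e^{ -i\theta_\ell}\chi_\ell(u)\Bigr|^{\frac1\sigma-2}\operatorname{Re}\Bigl(\overline{e^{ -i\theta_j}\chi_j(u)}\sum_{k=1}^r\alpha_ke^{ -i\theta_k}\chi_k(u)\Bigr),$$ where $\sum^*$ means the sum is over those $u$ with $\sum_{\ell=1}^r\alpha_\ell e^{ -i\theta_\ell}\chi_\ell(u)\ne0$. -}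

module Defs where

open import Level using (0ℓ) renaming (suc to lsuc)
open import Algebra.Bundles using (CommutativeRing; RawRing)
import Algebra.Definitions.RawMonoid as RawMonoidDefs
import Algebra.Definitions.RawSemiring as RawSemiringDefs
open import Axiom.ExcludedMiddle using (ExcludedMiddle)
open import Data.Fin.Base using (Fin; zero; suc; toℕ)
open import Data.List.Base using (List; filter; foldr; length; map; upTo)
open import Data.Nat.Base as ℕ using (ℕ; NonZero; _!)
open import Data.Nat.Coprimality using (Coprime; coprime?)
open import Data.Nat.Divisibility using (_∣_)
open import Data.Nat.LCM using (lcm)
open import Data.Product.Base using (Σ; ∃; _×_; _,_)
import Data.Vec.Functional as Vector
open import Function.Bundles using (_⇔_)
open import Relation.Binary.Core using (Rel)
open import Relation.Binary.PropositionalEquality.Core using (_≡_)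
open import Relation.Binary.Structures using (IsTotalOrder)
import Relation.Binary.Construct.NonStrictToStrict as NonStrictToStrict
open import Relation.Nullary.Decidable.Core using (yes; no)
open import Relation.Nullary.Negation.Core using (¬_)

-- Dedekind-complete ordered fields.  Classically there is exactly one up to
-- isomorphism, the field of real numbers.

record CompleteOrderedField : Set (lsuc 0ℓ) where
  field
    commutativeRing : CommutativeRing 0ℓ 0ℓ

  open CommutativeRing commutativeRing public

  infix 4 _≤_
  infix 9 _⁻¹

  field
    _≤_          : Rel Carrier 0ℓ
    isTotalOrder : IsTotalOrder _≈_ _≤_
    +-monoˡ-≤    : ∀ {x y} z → x ≤ y → x + z ≤ y + z
    *-nonNeg     : ∀ {x y} → 0# ≤ x → 0# ≤ y → 0# ≤ x * y

    0≉1          : ¬ (0# ≈ 1#)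
    -- The value of 0# ⁻¹ is left unspecified.
    _⁻¹          : Carrier → Carrier
    ⁻¹-cong      : ∀ {x y} → x ≈ y → x ⁻¹ ≈ y ⁻¹
    *-inverseʳ   : ∀ {x} → ¬ (x ≈ 0#) → x * x ⁻¹ ≈ 1#

  IsUpperBound : (Carrier → Set) → Carrier → Set
  IsUpperBound P b = ∀ {x} → P x → x ≤ b

  field
    supremum : (P : Carrier → Set) → ∃ P → ∃ (IsUpperBound P) →
               ∃ λ s → IsUpperBound P s × (∀ {b} → IsUpperBound P b → s ≤ b)

  open NonStrictToStrict _≈_ _≤_ public using (_<_)

-- Analysis over the real numbers is classical, hence the excluded middle.

module Analysis (em : ExcludedMiddle 0ℓ) (R : CompleteOrderedField) where

  open CompleteOrderedField R
    using (_≈_; _+_; _*_; -_; _-_; 0#; 1#; _≤_; _<_; _⁻¹; rawRing; +-rawMonoid)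
    renaming (Carrier to ℝ) public

  private
    module ℝ-Sum = RawMonoidDefs +-rawMonoid

  fromℕ : ℕ → ℝ
  fromℕ n = n ℝ-Sum.× 1#

  ∑ : ∀ {n} → (Fin n → ℝ) → ℝ
  ∑ = ℝ-Sum.sum

  ∑[_]_ : List ℕ → (ℕ → ℝ) → ℝ
  ∑[ us ] f = foldr _+_ 0# (map f us)

  -- A real number satisfying P, or 0# if there is none; below it is used for
  -- predicates with at most one solution up to _≈_.
  the : (ℝ → Set) → ℝ
  the P with em {∃ P}
  ... | yes (x , _) = x
  ... | no  _       = 0#

  _⟶_ : (ℕ → ℝ) → ℝ → Set
  s ⟶ l = ∀ ε → 0# < ε → Σ ℕ λ N → ∀ n → N ℕ.≤ n →
          (l - ε < s n) × (s n < l + ε)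

  lim : (ℕ → ℝ) → ℝ
  lim s = the (s ⟶_)

  √_ : ℝ → ℝ
  √ x = the λ y → (0# ≤ y) × (y * y ≈ x)

  infix  4 _≈ᶜ_
  infixl 6 _+ᶜ_
  infixl 7 _*ᶜ_ _•_
  infix  5 _+i_

  record ℂ : Set where
    constructor _+i_
    field
      Re : ℝ
      Im : ℝ

  open ℂ public

  _≈ᶜ_ : Rel ℂ 0ℓ
  z ≈ᶜ w = (Re z ≈ Re w) × (Im z ≈ Im w)

  0ᶜ 1ᶜ : ℂ
  0ᶜ = 0# +i 0#
  1ᶜ = 1# +i 0#

  _+ᶜ_ _*ᶜ_ : ℂ → ℂ → ℂ
  z +ᶜ w = (Re z + Re w) +i (Im z + Im w)
  z *ᶜ w = (Re z * Re w - Im z * Im w) +i (Re z * Im w + Im z * Re w)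

  -ᶜ_ conj : ℂ → ℂ
  -ᶜ z   = (- Re z) +i (- Im z)
  conj z = Re z +i (- Im z)

  _•_ : ℝ → ℂ → ℂ
  a • z = (a * Re z) +i (a * Im z)

  abs : ℂ → ℝ
  abs z = √ (Re z * Re z + Im z * Im z)

  ℂ-rawRing : RawRing 0ℓ 0ℓ
  ℂ-rawRing = record
    { _≈_ = _≈ᶜ_ ; _+_ = _+ᶜ_ ; _*_ = _*ᶜ_ ; -_ = -ᶜ_ ; 0# = 0ᶜ ; 1# = 1ᶜ }

  open RawSemiringDefs (RawRing.rawSemiring ℂ-rawRing) public
    using () renaming (_^_ to _^ᶜ_; sum to ∑ᶜ)

  expPartialSum : ℂ → ℕ → ℂ
  expPartialSum z n =
    ∑ᶜ {n} λ k → fromℕ (toℕ k !) ⁻¹ • z ^ᶜ toℕ k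

  cexp : ℂ → ℂ
  cexp z = lim (λ n → Re (expPartialSum z n)) +i lim (λ n → Im (expPartialSum z n))

  exp : ℝ → ℝ
  exp x = Re (cexp (x +i 0#))

  log : ℝ → ℝ
  log x = the λ y → exp y ≈ x

  -- Real powers of nonnegative reals, where 0 to the power s is 0.  The latter
  -- is only meant for s > 0; negative exponents occur with positive bases only.
  infixr 8 _^ʳ_
  _^ʳ_ : ℝ → ℝ → ℝ
  x ^ʳ s with em {0# < x}
  ... | yes _ = exp (s * log x)
  ... | no  _ = 0#

  -- A Dirichlet character as a periodic arithmetic function; residue classes
  -- are represented by natural numbers.
  record DirichletCharacter : Set where
    field
      modulus        : ℕ
      {{nonZero}}    : NonZero modulus
      χ              : ℕ → ℂ
      periodic       : ∀ n → χ (n ℕ.+ modulus) ≈ᶜ χ n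
      multiplicative : ∀ m n → χ (m ℕ.* n) ≈ᶜ χ m *ᶜ χ n
      unital         : χ 1 ≈ᶜ 1ᶜ
      vanishing      : ∀ n → χ n ≈ᶜ 0ᶜ ⇔ (¬ Coprime n modulus)

  open DirichletCharacter public using (modulus)

  infixl 10 _⟨_⟩
  _⟨_⟩ : DirichletCharacter → ℕ → ℂ
  _⟨_⟩ = DirichletCharacter.χ

  Induces : DirichletCharacter → DirichletCharacter → Set
  Induces ψ χ = (modulus ψ ∣ modulus χ) ×
                (∀ n → Coprime n (modulus χ) → χ ⟨ n ⟩ ≈ᶜ ψ ⟨ n ⟩)

  Primitive : DirichletCharacter → Set
  Primitive χ = ∀ ψ → Induces ψ χ → modulus ψ ≡ modulus χ

  Equivalent : DirichletCharacter → DirichletCharacter → Set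
  Equivalent χ₁ χ₂ = ∃ λ ψ → Primitive ψ × Induces ψ χ₁ × Induces ψ χ₂

  units : ℕ → List ℕ
  units d = filter (λ u → coprime? u d) (upTo d)

  φ : ℕ → ℕ
  φ d = length (units d)

  module _ {r : ℕ} (χ : Fin r → DirichletCharacter) where

    lcmModuli : ℕ
    lcmModuli = Vector.foldr lcm 1 (λ j → modulus (χ j))

    module _ (θ : Fin r → ℝ) where

      twist : Fin r → ℕ → ℂ
      twist j u = cexp (0# +i (- θ j)) *ᶜ χ j ⟨ u ⟩

      combination : (Fin r → ℝ) → ℕ → ℂ
      combination α u = ∑ᶜ λ j → α j • twist j u

      nonvanishingUnits : (Fin r → ℝ) → List ℕ
      nonvanishingUnits α =
        filter (λ u → em {¬ (combination α u ≈ᶜ 0ᶜ)}) (units lcmModuli)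

  module _ {r : ℕ} (σ : ℝ) (χ : Fin r → DirichletCharacter)
           (θ : Fin r → ℝ) (α : Fin r → ℝ) where

    ξ : ℝ
    ξ = fromℕ (φ (lcmModuli χ)) ⁻¹ *
        (∑[ units (lcmModuli χ) ] λ u → abs (combination χ θ α u) ^ʳ (σ ⁻¹))

    Ξ : Fin r → ℝ
    Ξ j = fromℕ (φ (lcmModuli χ)) ⁻¹ *
          (∑[ nonvanishingUnits χ θ α ] λ u →
            abs (combination χ θ α u) ^ʳ (σ ⁻¹ - (1# + 1#)) *
            Re (conj (twist χ θ j u) *ᶜ combination χ θ α u))

  headThenOnes : ∀ {r} → ℝ → Fin r → ℝ
  headThenOnes a zero    = a
  headThenOnes a (suc _) = 1#

{-# OPTIONS --safe #-}

-- Write ωⱼ = e^{−iθⱼ} χⱼ, Z = αω₁ + ω₂ + … + ωᵣ, c = 1/σ − 2 ∈ (−1, 0), q = 1/(1 − σ) > 1, and let E be the mean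
-- over the units modulo d.  As |Z|^{1/σ} = |Z|^c |Z|², we have ξ = αΞ₁ + Ξ₂ + … + Ξᵣ, so it suffices to show that
-- Ξ₁ > 0, Ξ₁^q ≤ αΞ₁ and 0 < Ξⱼ < 1 for j ≥ 2.
--
-- Put ηⱼ = ωⱼ/ω₁ and X = Re (η₂ + … + ηᵣ).  Since |Z| ≥ α + X > 0 and c < 0, weighted AM-GM yields
-- |Z|^c (α + X) ≤ α^c (α + (c + 1) X).  By orthogonality E X = 0, whence Ξ₁ ≤ α^{c+1}, and this is equivalent to
-- Ξ₁^q ≤ αΞ₁.  For j ≥ 2, the expansion |Z|^c = α^c (1 + cX/α + O(α⁻²)) and orthogonality give
-- Ξⱼ = α^c (1 + c E[X Re ηⱼ] + O(α⁻¹)).  Here E[X Re ηⱼ] ≤ 1, because ηⱼηₖ has nonzero mean for at most one k, so the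
-- bracket is positive for large α, while α^c tends to 0.
--
-- Orthogonality holds because characters that agree on the units modulo d are both induced by a character modulo the
-- gcd of their moduli.

module Submission where

open import Defs
open import Level using (0ℓ)
open import Algebra.Bundles using (CommutativeRing)
import Algebra.Definitions.RawMonoid as RawMonoidDefs
import Algebra.Properties.AbelianGroup as AbelianGroupProperties
import Algebra.Properties.Ring as RingProperties
import Algebra.Properties.Semiring.Exp as SemiringExp
import Algebra.Properties.Semiring.Mult as SemiringMult
import Algebra.Properties.Semiring.Mult.TCOptimised as OptimisedMult
import Algebra.Solver.Ring as RingSolver
open import Algebra.Solver.Ring.AlmostCommutativeRing using (AlmostCommutativeRing; fromCommutativeRing; _-Raw-AlmostCommutative⟶_)
open import Axiom.ExcludedMiddle using (ExcludedMiddle)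
open import Data.Empty using (⊥-elim)
open import Data.Fin.Base using (Fin; zero; suc; toℕ)
import Data.Fin.Properties as FinP
open import Data.Integer.Base as ℤ using (ℤ; +_; -[1+_])
import Data.Integer.Properties as ℤP
open import Data.List.Base using (List; []; _∷_; filter; foldr; length; map; upTo)
open import Data.List.Membership.Propositional using (_∈_)
open import Data.List.Membership.Propositional.Properties using (∈-filter⁺; ∈-filter⁻; ∈-upTo⁺; ∈-upTo⁻; ∈-map⁺; ∈-map⁻)
open import Data.List.Membership.Propositional.Properties.WithK using (unique∧set⇒bag)
open import Data.List.Properties using (map-∘; filter-all)
open import Data.List.Relation.Binary.BagAndSetEquality using (∼bag⇒↭)
open import Data.List.Relation.Binary.Permutation.Propositional as ↭ using (_↭_)
import Data.List.Relation.Unary.All as All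
import Data.List.Relation.Unary.All.Properties as AllP
open import Data.List.Relation.Unary.AllPairs.Core using ([]; _∷_)
open import Data.List.Relation.Unary.Any using (here; there)
open import Data.List.Relation.Unary.Unique.Propositional using (Unique)
open import Data.List.Relation.Unary.Unique.Propositional.Properties using (upTo⁺; filter⁺)
open import Data.Maybe.Base using (Maybe; just; nothing)
open import Data.Nat.Base as ℕ using (ℕ; zero; suc; NonZero; _!)
open import Data.Nat.Coprimality as Coprimality using (Coprime; coprime?; coprime-divisor; coprime-Bézout)
open import Data.Nat.Divisibility as ∣ using (_∣_; divides)
open import Data.Nat.DivMod using (_%_; _/_; m%n<n; m%n%n≡m%n; %-distribˡ-*; [m+kn]%n≡m%n; m≡m%n+[m/n]*n; m<n⇒m%n≡m; /-monoˡ-≤)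
open import Data.Nat.GCD using (gcd; gcd[m,n]∣m; gcd[m,n]∣n; gcd-GCD; gcd[m,n]≢0; module Bézout)
open import Data.Nat.Induction using (<-rec)
open import Data.Nat.LCM using (m∣lcm[m,n]; n∣lcm[m,n]; gcd*lcm)
import Data.Nat.Properties as ℕP
open import Data.Nat.Solver using (module +-*-Solver)
open import Data.Product.Base using (Σ; ∃; ∃₂; _×_; _,_; proj₁; proj₂)
open import Data.Sum.Base using (_⊎_; inj₁; inj₂)
open import Function.Base using (_∘_)
open import Function.Bundles using (mk⇔; Equivalence)
open import Relation.Binary.Bundles using (Poset)
open import Relation.Binary.PropositionalEquality as ≡ using (_≡_; _≢_; cong; subst; module ≡-Reasoning)
import Relation.Binary.Properties.Poset as PosetProperties
import Relation.Binary.Reasoning.PartialOrder as PosetReasoning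
import Relation.Binary.Reasoning.Setoid as SetoidReasoning
open import Relation.Binary.Structures using (IsTotalOrder)
open import Relation.Nullary.Decidable.Core using (Dec; yes; no)
open import Relation.Nullary.Negation.Core using (¬_)

-- Nothing is ever differentiated: the functional equation of `exp` and 1 + t ≤ exp t yield
-- tangents, convexity and the logarithm. So the expansion of |Z|^c is not a Taylor formula. Its
-- upper half comes from the AM-GM bound, its lower half from Bernoulli's inequality (T/α)^c ≥ 1 + c
-- (T/α - 1) with T = |Z|, and both are multiplied by powers of α until polynomial identities
-- suffice. The threshold may not depend on d, on the characters or on θ. Hence the error terms use
-- only |X|, |Y| ≤ r - 1 and |c| ≤ 1, and the five facts in `IsOrthonormal` are all that survives of
-- the characters. The bound 1 on E[X Re ηⱼ] is what keeps 1 + c E[X Re ηⱼ] ≥ 1 + c positive for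
-- every c in (-1, 0). The delicate part of that mean is ηⱼηₖ without a conjugate, which does not
-- average to zero if ηₖ is a constant multiple of the conjugate of ηⱼ.

-- A ring solver with integer coefficients for any commutative ring.

module IntegerCoefficients {c ℓ} (R : CommutativeRing c ℓ) where

  open CommutativeRing R
  open OptimisedMult semiring using (×-homo-+; ×1-homo-*) renaming (_×_ to _·_)
  open RingProperties ring using (-‿distribˡ-*; -0#≈0#)
  open AbelianGroupProperties +-abelianGroup using () renaming (⁻¹-involutive to -‿involutive; ⁻¹-∙-comm to -‿+-comm)
  open SetoidReasoning setoid

  -- The optimised multiple sends 1 to `1#` itself and not to `1# + 0#`, so a solved equation
  -- matches its goal definitionally.
  ⟦_⟧ℤ : ℤ → Carrier
  ⟦ + n ⟧ℤ      = n · 1#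
  ⟦ -[1+ n ] ⟧ℤ = - (suc n · 1#)

  private
    cancel-1# : ∀ a b → (1# + a) - (1# + b) ≈ a - b
    cancel-1# a b = begin
      (1# + a) - (1# + b)       ≈⟨ +-congˡ (-‿+-comm 1# b) ⟨
      (1# + a) + (- 1# - b)     ≈⟨ +-congʳ (+-comm 1# a) ⟩
      (a + 1#) + (- 1# - b)     ≈⟨ +-assoc a 1# _ ⟩
      a + (1# + (- 1# - b))     ≈⟨ +-congˡ (+-assoc 1# (- 1#) (- b)) ⟨
      a + ((1# - 1#) - b)       ≈⟨ +-congˡ (+-congʳ (-‿inverseʳ 1#)) ⟩
      a + (0# - b)              ≈⟨ +-congˡ (+-identityˡ (- b)) ⟩
      a - b                     ∎

    ⊖-homo : ∀ m n → ⟦ m ℤ.⊖ n ⟧ℤ ≈ m · 1# - n · 1#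
    ⊖-homo m       zero    = sym (trans (+-congˡ -0#≈0#) (+-identityʳ _))
    ⊖-homo zero    (suc n) = sym (+-identityˡ _)
    ⊖-homo (suc m) (suc n) = begin
      ⟦ suc m ℤ.⊖ suc n ⟧ℤ               ≡⟨ ≡.cong ⟦_⟧ℤ (ℤP.[1+m]⊖[1+n]≡m⊖n m n) ⟩
      ⟦ m ℤ.⊖ n ⟧ℤ                       ≈⟨ ⊖-homo m n ⟩
      m · 1# - n · 1#                    ≈⟨ cancel-1# _ _ ⟨
      (1# + m · 1#) - (1# + n · 1#)      ≈⟨ +-cong (×-homo-+ 1# 1 m) (-‿cong (×-homo-+ 1# 1 n)) ⟨
      suc m · 1# - suc n · 1#            ∎

    neg-homo : ∀ i → ⟦ ℤ.- i ⟧ℤ ≈ - ⟦ i ⟧ℤ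
    neg-homo (+ zero)  = sym -0#≈0#
    neg-homo (+ suc n) = refl
    neg-homo -[1+ n ]  = sym (-‿involutive _)

    +-homo : ∀ i j → ⟦ i ℤ.+ j ⟧ℤ ≈ ⟦ i ⟧ℤ + ⟦ j ⟧ℤ
    +-homo (+ m)    (+ n)    = ×-homo-+ 1# m n
    +-homo (+ m)    -[1+ n ] = ⊖-homo m (suc n)
    +-homo -[1+ m ] (+ n)    = trans (⊖-homo n (suc m)) (+-comm _ _)
    +-homo -[1+ m ] -[1+ n ] = begin
      - (suc (suc (m ℕ.+ n)) · 1#)       ≡⟨ ≡.cong (λ k → - (suc k · 1#)) (≡.sym (+-suc m n)) ⟩
      - ((suc m ℕ.+ suc n) · 1#)         ≈⟨ -‿cong (×-homo-+ 1# (suc m) (suc n)) ⟩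
      - (suc m · 1# + suc n · 1#)        ≈⟨ -‿+-comm _ _ ⟨
      - (suc m · 1#) - suc n · 1#        ∎
      where open import Data.Nat.Properties using (+-suc)

    *-homo⁺ : ∀ m j → ⟦ + m ℤ.* j ⟧ℤ ≈ ⟦ + m ⟧ℤ * ⟦ j ⟧ℤ
    *-homo⁺ m (+ n)    = trans (reflexive (≡.cong ⟦_⟧ℤ (≡.sym (ℤP.pos-* m n)))) (×1-homo-* m n)
    *-homo⁺ m -[1+ n ] = begin
      ⟦ + m ℤ.* -[1+ n ] ⟧ℤ              ≡⟨ ≡.cong ⟦_⟧ℤ (≡.sym (ℤP.neg-distribʳ-* (+ m) (+ suc n))) ⟩
      ⟦ ℤ.- (+ m ℤ.* + suc n) ⟧ℤ         ≈⟨ neg-homo (+ m ℤ.* + suc n) ⟩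
      - ⟦ + m ℤ.* + suc n ⟧ℤ             ≈⟨ -‿cong (*-homo⁺ m (+ suc n)) ⟩
      - (m · 1# * suc n · 1#)            ≈⟨ -‿distribʳ-* _ _ ⟩
      m · 1# * - (suc n · 1#)            ∎
      where open RingProperties ring using (-‿distribʳ-*)

    *-homo : ∀ i j → ⟦ i ℤ.* j ⟧ℤ ≈ ⟦ i ⟧ℤ * ⟦ j ⟧ℤ
    *-homo (+ m)    j = *-homo⁺ m j
    *-homo -[1+ m ] j = begin
      ⟦ -[1+ m ] ℤ.* j ⟧ℤ                ≡⟨ ≡.cong ⟦_⟧ℤ (≡.sym (ℤP.neg-distribˡ-* (+ suc m) j)) ⟩
      ⟦ ℤ.- (+ suc m ℤ.* j) ⟧ℤ           ≈⟨ neg-homo (+ suc m ℤ.* j) ⟩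
      - ⟦ + suc m ℤ.* j ⟧ℤ               ≈⟨ -‿cong (*-homo⁺ (suc m) j) ⟩
      - (suc m · 1# * ⟦ j ⟧ℤ)            ≈⟨ -‿distribˡ-* _ _ ⟩
      - (suc m · 1#) * ⟦ j ⟧ℤ            ∎

    almostCommutativeRing : AlmostCommutativeRing c ℓ
    almostCommutativeRing = fromCommutativeRing R

    homomorphism : ℤ.+-*-rawRing -Raw-AlmostCommutative⟶ almostCommutativeRing
    homomorphism = record
      { ⟦_⟧    = ⟦_⟧ℤ
      ; +-homo = +-homo
      ; *-homo = *-homo
      ; -‿homo = neg-homo
      ; 0-homo = refl
      ; 1-homo = refl
      }

    -- Coefficients are compared as integers because equality in the ring need not be decidable;
    -- this is what lets the solver discard terms that cancel.
    equal? : ∀ i j → Maybe (⟦ i ⟧ℤ ≈ ⟦ j ⟧ℤ)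
    equal? i j with i ℤP.≟ j
    ... | yes i≡j = just (reflexive (≡.cong ⟦_⟧ℤ i≡j))
    ... | no  _   = nothing

  open RingSolver ℤ.+-*-rawRing almostCommutativeRing homomorphism equal? public
    using (solve; con; _:+_; _:*_; _:-_; :-_; _:=_; Polynomial)

-- Order arithmetic in a complete ordered field.

module OrderedField (em : ExcludedMiddle 0ℓ) (R : CompleteOrderedField) where

  open Analysis em R public
  open CompleteOrderedField R public
    hiding (zero; Carrier; _≈_; _+_; _*_; -_; _-_; 0#; 1#; _≤_; _<_; _⁻¹; rawRing; +-rawMonoid)
  open IsTotalOrder isTotalOrder public
    using (isPartialOrder)
    renaming (total to ≤-total; antisym to ≤-antisym; refl to ≤-refl; reflexive to ≤-reflexive; trans to ≤-trans)
  open IntegerCoefficients commutativeRing public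

  ≤-poset : Poset 0ℓ 0ℓ 0ℓ
  ≤-poset = record { isPartialOrder = isPartialOrder }

  open PosetProperties ≤-poset public
    using (<-trans; <⇒≱; <-irrefl)
  open SemiringMult semiring using (×1-homo-*)
  open PosetReasoning ≤-poset

  :0 :1 : ∀ {n} → Polynomial n
  :0 = con (+ 0)
  :1 = con (+ 1)

  2# : ℝ
  2# = 1# + 1#

  ≤-<-trans : ∀ {x y z} → x ≤ y → y < z → x < z
  ≤-<-trans {x} {y} {z} x≤y y<z = begin-strict x ≤⟨ x≤y ⟩ y <⟨ y<z ⟩ z ∎

  <-≤-trans : ∀ {x y z} → x < y → y ≤ z → x < z
  <-≤-trans {x} {y} {z} x<y y≤z = begin-strict x <⟨ x<y ⟩ y ≤⟨ y≤z ⟩ z ∎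

  ≈-<-trans : ∀ {x y z} → x ≈ y → y < z → x < z
  ≈-<-trans x≈y y<z = ≤-<-trans (≤-reflexive x≈y) y<z

  <-≈-trans : ∀ {x y z} → x < y → y ≈ z → x < z
  <-≈-trans x<y y≈z = <-≤-trans x<y (≤-reflexive y≈z)

  ≤-≈-trans : ∀ {x y z} → x ≤ y → y ≈ z → x ≤ z
  ≤-≈-trans x≤y y≈z = ≤-trans x≤y (≤-reflexive y≈z)

  ≈-≤-trans : ∀ {x y z} → x ≈ y → y ≤ z → x ≤ z
  ≈-≤-trans x≈y y≤z = ≤-trans (≤-reflexive x≈y) y≤z

  ≤-or-> : ∀ x y → x ≤ y ⊎ y < x
  ≤-or-> x y with em {x ≤ y}
  ... | yes x≤y = inj₁ x≤y
  ... | no x≰y with ≤-total x y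
  ...   | inj₁ x≤y = ⊥-elim (x≰y x≤y)
  ...   | inj₂ y≤x = inj₂ (y≤x , λ y≈x → x≰y (≤-reflexive (sym y≈x)))

  ≮⇒≥ : ∀ {x y} → ¬ (x < y) → y ≤ x
  ≮⇒≥ {x} {y} x≮y with ≤-or-> y x
  ... | inj₁ y≤x = y≤x
  ... | inj₂ x<y = ⊥-elim (x≮y x<y)

  +-monoʳ-≤ : ∀ {x y} z → x ≤ y → z + x ≤ z + y
  +-monoʳ-≤ {x} {y} z x≤y = begin
    z + x ≈⟨ +-comm z x ⟩
    x + z ≤⟨ +-monoˡ-≤ z x≤y ⟩
    y + z ≈⟨ +-comm y z ⟩
    z + y ∎

  +-mono-≤ : ∀ {x y u v} → x ≤ y → u ≤ v → x + u ≤ y + v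
  +-mono-≤ {x} {y} {u} {v} x≤y u≤v = ≤-trans (+-monoˡ-≤ u x≤y) (+-monoʳ-≤ y u≤v)

  +-monoˡ-< : ∀ {x y} z → x < y → x + z < y + z
  +-monoˡ-< {x} {y} z (x≤y , x≉y) = +-monoˡ-≤ z x≤y , λ eq → x≉y (trans (cancel x) (trans (+-congʳ eq) (sym (cancel y))))
    where
    cancel : ∀ w → w ≈ (w + z) - z
    cancel w = solve 2 (λ w z → w := (w :+ z) :- z) refl w z

  +-monoʳ-< : ∀ {x y} z → x < y → z + x < z + y
  +-monoʳ-< {x} {y} z x<y = begin-strict
    z + x ≈⟨ +-comm z x ⟩
    x + z <⟨ +-monoˡ-< z x<y ⟩
    y + z ≈⟨ +-comm y z ⟩
    z + y ∎

  +-mono-<-≤ : ∀ {x y u v} → x < y → u ≤ v → x + u < y + v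
  +-mono-<-≤ {x} {y} {u} {v} x<y u≤v = <-≤-trans (+-monoˡ-< u x<y) (+-monoʳ-≤ y u≤v)

  +-mono-≤-< : ∀ {x y u v} → x ≤ y → u < v → x + u < y + v
  +-mono-≤-< {x} {y} {u} {v} x≤y u<v = ≤-<-trans (+-monoˡ-≤ u x≤y) (+-monoʳ-< y u<v)

  +-mono-< : ∀ {x y u v} → x < y → u < v → x + u < y + v
  +-mono-< x<y u<v = +-mono-<-≤ x<y (proj₁ u<v)

  +-nonNeg : ∀ {x y} → 0# ≤ x → 0# ≤ y → 0# ≤ x + y
  +-nonNeg 0≤x 0≤y = ≈-≤-trans (sym (+-identityˡ 0#)) (+-mono-≤ 0≤x 0≤y)

  +-pos : ∀ {x y} → 0# < x → 0# ≤ y → 0# < x + y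
  +-pos 0<x 0≤y = ≈-<-trans (sym (+-identityˡ 0#)) (+-mono-<-≤ 0<x 0≤y)

  ≤⇒0≤- : ∀ {x y} → x ≤ y → 0# ≤ y - x
  ≤⇒0≤- {x} {y} x≤y = ≈-≤-trans (sym (-‿inverseʳ x)) (+-monoˡ-≤ (- x) x≤y)

  <⇒0<- : ∀ {x y} → x < y → 0# < y - x
  <⇒0<- {x} {y} x<y = ≈-<-trans (sym (-‿inverseʳ x)) (+-monoˡ-< (- x) x<y)

  ≤-by : ∀ {x y} d → 0# ≤ d → y ≈ x + d → x ≤ y
  ≤-by {x} {y} d 0≤d y≈x+d = begin
    x      ≈⟨ +-identityʳ x ⟨
    x + 0# ≤⟨ +-monoʳ-≤ x 0≤d ⟩
    x + d  ≈⟨ y≈x+d ⟨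
    y      ∎

  <-by : ∀ {x y} d → 0# < d → y ≈ x + d → x < y
  <-by {x} {y} d 0<d y≈x+d = begin-strict
    x      ≈⟨ +-identityʳ x ⟨
    x + 0# <⟨ +-monoʳ-< x 0<d ⟩
    x + d  ≈⟨ y≈x+d ⟨
    y      ∎

  neg-mono-≤ : ∀ {x y} → x ≤ y → - y ≤ - x
  neg-mono-≤ {x} {y} x≤y =
    ≤-by (y - x) (≤⇒0≤- x≤y) (solve 2 (λ x y → :- x := :- y :+ (y :- x)) refl x y)

  neg-mono-< : ∀ {x y} → x < y → - y < - x
  neg-mono-< {x} {y} x<y =
    <-by (y - x) (<⇒0<- x<y) (solve 2 (λ x y → :- x := :- y :+ (y :- x)) refl x y)

  sq-nonNeg : ∀ x → 0# ≤ x * x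
  sq-nonNeg x with ≤-total 0# x
  ... | inj₁ 0≤x = *-nonNeg 0≤x 0≤x
  ... | inj₂ x≤0 = ≤-≈-trans (*-nonNeg 0≤-x 0≤-x) (solve 1 (λ x → (:0 :- x) :* (:0 :- x) := x :* x) refl x)
    where
    0≤-x : 0# ≤ 0# - x
    0≤-x = ≤⇒0≤- x≤0

  0<1 : 0# < 1#
  0<1 = ≤-≈-trans (sq-nonNeg 1#) (*-identityˡ 1#) , 0≉1

  0<2 : 0# < 2#
  0<2 = +-pos 0<1 (proj₁ 0<1)

  x*y≈0⇒y≈0 : ∀ {x y} → ¬ (x ≈ 0#) → x * y ≈ 0# → y ≈ 0#
  x*y≈0⇒y≈0 {x} {y} x≉0 xy≈0 = begin-equality
    y               ≈⟨ *-identityˡ y ⟨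
    1# * y          ≈⟨ *-congʳ (*-inverseʳ x≉0) ⟨
    x * x ⁻¹ * y    ≈⟨ solve 3 (λ x i y → x :* i :* y := i :* (x :* y)) refl x (x ⁻¹) y ⟩
    x ⁻¹ * (x * y)  ≈⟨ *-congˡ xy≈0 ⟩
    x ⁻¹ * 0#       ≈⟨ zeroʳ _ ⟩
    0#              ∎

  >⇒≉ : ∀ {x y} → y < x → ¬ (x ≈ y)
  >⇒≉ (_ , y≉x) x≈y = y≉x (sym x≈y)

  *-pos : ∀ {x y} → 0# < x → 0# < y → 0# < x * y
  *-pos 0<x 0<y = *-nonNeg (proj₁ 0<x) (proj₁ 0<y) , λ 0≈xy → >⇒≉ 0<y (x*y≈0⇒y≈0 (>⇒≉ 0<x) (sym 0≈xy))

  ⁻¹-pos : ∀ {x} → 0# < x → 0# < x ⁻¹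
  ⁻¹-pos {x} 0<x with ≤-or-> (x ⁻¹) 0#
  ... | inj₂ 0<i = 0<i
  ... | inj₁ i≤0 = ⊥-elim (<⇒≱ 0<1 (≤-by (x * (0# - x ⁻¹)) (*-nonNeg (proj₁ 0<x) (≤⇒0≤- i≤0)) (begin-equality
    0#                             ≈⟨ solve 2 (λ x i → :0 := x :* i :+ x :* (:0 :- i)) refl x (x ⁻¹) ⟩
    x * x ⁻¹ + x * (0# - x ⁻¹)     ≈⟨ +-congʳ (*-inverseʳ (>⇒≉ 0<x)) ⟩
    1# + x * (0# - x ⁻¹)           ∎)))

  ⁻¹-inverse : ∀ {x} → 0# < x → x * x ⁻¹ ≈ 1#
  ⁻¹-inverse 0<x = *-inverseʳ (>⇒≉ 0<x)

  *-monoˡ-≤ : ∀ {x y} z → 0# ≤ z → x ≤ y → z * x ≤ z * y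
  *-monoˡ-≤ {x} {y} z 0≤z x≤y =
    ≤-by (z * (y - x)) (*-nonNeg 0≤z (≤⇒0≤- x≤y)) (solve 3 (λ x y z → z :* y := z :* x :+ z :* (y :- x)) refl x y z)

  *-monoˡ-< : ∀ {x y} z → 0# < z → x < y → z * x < z * y
  *-monoˡ-< {x} {y} z 0<z x<y =
    <-by (z * (y - x)) (*-pos 0<z (<⇒0<- x<y)) (solve 3 (λ x y z → z :* y := z :* x :+ z :* (y :- x)) refl x y z)

  *-monoʳ-≤ : ∀ {x y} z → 0# ≤ z → x ≤ y → x * z ≤ y * z
  *-monoʳ-≤ {x} {y} z 0≤z x≤y = begin
    x * z ≈⟨ *-comm x z ⟩
    z * x ≤⟨ *-monoˡ-≤ z 0≤z x≤y ⟩
    z * y ≈⟨ *-comm z y ⟩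
    y * z ∎

  *-monoʳ-< : ∀ {x y} z → 0# < z → x < y → x * z < y * z
  *-monoʳ-< {x} {y} z 0<z x<y = begin-strict
    x * z ≈⟨ *-comm x z ⟩
    z * x <⟨ *-monoˡ-< z 0<z x<y ⟩
    z * y ≈⟨ *-comm z y ⟩
    y * z ∎

  *-mono-≤ : ∀ {x y u v} → 0# ≤ x → 0# ≤ u → x ≤ y → u ≤ v → x * u ≤ y * v
  *-mono-≤ {x} {y} {u} {v} 0≤x 0≤u x≤y u≤v = ≤-trans (*-monoʳ-≤ u 0≤u x≤y) (*-monoˡ-≤ y (≤-trans 0≤x x≤y) u≤v)

  *-cancelˡ-≤ : ∀ {x y} z → 0# < z → z * x ≤ z * y → x ≤ y
  *-cancelˡ-≤ z 0<z zx≤zy = ≮⇒≥ λ y<x → <⇒≱ (*-monoˡ-< z 0<z y<x) zx≤zy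

  *-cancelˡ-< : ∀ {x y} z → 0# ≤ z → z * x < z * y → x < y
  *-cancelˡ-< {x} {y} z 0≤z zx<zy with ≤-or-> y x
  ... | inj₁ y≤x = ⊥-elim (<⇒≱ zx<zy (*-monoˡ-≤ z 0≤z y≤x))
  ... | inj₂ x<y = x<y

  *-cancelˡ-≈ : ∀ {x y} z → ¬ (z ≈ 0#) → z * x ≈ z * y → x ≈ y
  *-cancelˡ-≈ {x} {y} z z≉0 zx≈zy = begin-equality
    x             ≈⟨ solve 2 (λ x y → x := y :+ (x :- y)) refl x y ⟩
    y + (x - y)   ≈⟨ +-congˡ (x*y≈0⇒y≈0 z≉0 (begin-equality
      z * (x - y)    ≈⟨ solve 3 (λ x y z → z :* (x :- y) := z :* x :- z :* y) refl x y z ⟩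
      z * x - z * y  ≈⟨ +-congʳ zx≈zy ⟩
      z * y - z * y  ≈⟨ -‿inverseʳ _ ⟩
      0#             ∎)) ⟩
    y + 0#        ≈⟨ +-identityʳ y ⟩
    y             ∎

  -- Moduli are estimated through their squares; this is the way back.
  sq-cancel-≤ : ∀ {x y} → 0# ≤ y → x * x ≤ y * y → x ≤ y
  sq-cancel-≤ {x} {y} 0≤y xx≤yy = ≮⇒≥ λ y<x →
    <⇒≱ (≤-<-trans (*-monoˡ-≤ y 0≤y (proj₁ y<x)) (*-monoʳ-< x (≤-<-trans 0≤y y<x) y<x)) xx≤yy

  half : ℝ → ℝ
  half x = 2# ⁻¹ * x

  half+half : ∀ x → half x + half x ≈ x
  half+half x = begin-equality
    2# ⁻¹ * x + 2# ⁻¹ * x ≈⟨ solve 2 (λ h x → h :* x :+ h :* x := (:1 :+ :1) :* h :* x) refl (2# ⁻¹) x ⟩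
    2# * 2# ⁻¹ * x        ≈⟨ *-congʳ (⁻¹-inverse 0<2) ⟩
    1# * x                ≈⟨ *-identityˡ x ⟩
    x                     ∎

  half-pos : ∀ {x} → 0# < x → 0# < half x
  half-pos = *-pos (⁻¹-pos 0<2)

  fromℕ-* : ∀ m n → fromℕ (m ℕ.* n) ≈ fromℕ m * fromℕ n
  fromℕ-* = ×1-homo-*

  fromℕ-nonNeg : ∀ n → 0# ≤ fromℕ n
  fromℕ-nonNeg zero    = ≤-refl
  fromℕ-nonNeg (suc n) = +-nonNeg (proj₁ 0<1) (fromℕ-nonNeg n)

  fromℕ-pos : ∀ n → 0# < fromℕ (suc n)
  fromℕ-pos n = +-pos 0<1 (fromℕ-nonNeg n)

  fromℕ-mono : ∀ {m n} → m ℕ.≤ n → fromℕ m ≤ fromℕ n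
  fromℕ-mono {n = n} ℕ.z≤n = fromℕ-nonNeg n
  fromℕ-mono (ℕ.s≤s m≤n)   = +-monoʳ-≤ 1# (fromℕ-mono m≤n)

  -- If the naturals were bounded, with supremum s, then n + 1 ≤ s for every n would make s - 1 a
  -- smaller upper bound.
  archimedean : ∀ x → ∃ λ n → x < fromℕ n
  archimedean x with em {∃ λ n → x < fromℕ n}
  ... | yes found = found
  ... | no none = ⊥-elim (<⇒≱ s-1<s (least λ {y} → pred-bound {y}))
    where
    IsNatural : ℝ → Set
    IsNatural y = ∃ λ n → y ≈ fromℕ n
    bounded : ∃ (CompleteOrderedField.IsUpperBound R IsNatural)
    bounded = x , λ { (n , y≈n) → ≈-≤-trans y≈n (≮⇒≥ λ x<n → none (n , x<n)) }
    sup = supremum IsNatural (0# , 0 , refl) bounded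
    s = proj₁ sup
    least : ∀ {b} → CompleteOrderedField.IsUpperBound R IsNatural b → s ≤ b
    least = proj₂ (proj₂ sup)
    s-1<s : s - 1# < s
    s-1<s = <-by 1# 0<1 (solve 1 (λ s → s := (s :- :1) :+ :1) refl s)
    pred-bound : ∀ {y} → IsNatural y → y ≤ s - 1#
    pred-bound {y} (n , y≈n) = begin
      y             ≈⟨ solve 1 (λ y → y := (:1 :+ y) :- :1) refl y ⟩
      1# + y - 1#   ≤⟨ +-monoˡ-≤ (- 1#) (proj₁ (proj₂ sup) (suc n , +-congˡ y≈n)) ⟩
      s - 1#        ∎

  the-satisfies : ∀ (P : ℝ → Set) → ∃ P → P (the P)
  the-satisfies P exists with em {∃ P}
  ... | yes (_ , Px) = Px
  ... | no ∄         = ⊥-elim (∄ exists)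

-- Limits of real sequences.

module Limits (em : ExcludedMiddle 0ℓ) (R : CompleteOrderedField) where

  open OrderedField em R
  open PosetReasoning ≤-poset

  ⟶-cong : ∀ {s t l m} → (∀ n → s n ≈ t n) → l ≈ m → s ⟶ l → t ⟶ m
  ⟶-cong {s} {t} {l} {m} s≈t l≈m s⟶l ε 0<ε with s⟶l ε 0<ε
  ... | N , close = N , λ n N≤n →
    (begin-strict m - ε ≈⟨ +-congʳ l≈m ⟨ l - ε <⟨ proj₁ (close n N≤n) ⟩ s n ≈⟨ s≈t n ⟩ t n ∎) ,
    (begin-strict t n ≈⟨ s≈t n ⟨ s n <⟨ proj₂ (close n N≤n) ⟩ l + ε ≈⟨ +-congʳ l≈m ⟩ m + ε ∎)

  ⟶-const : ∀ l → (λ _ → l) ⟶ l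
  ⟶-const l ε 0<ε = 0 , λ _ _ →
    <-by ε 0<ε (solve 2 (λ l ε → l := (l :- ε) :+ ε) refl l ε) , <-by ε 0<ε refl

  ⟶-reindex : ∀ {s l} (f : ℕ → ℕ) → (∀ n → n ℕ.≤ f n) → s ⟶ l → (λ n → s (f n)) ⟶ l
  ⟶-reindex f n≤fn s⟶l ε 0<ε with s⟶l ε 0<ε
  ... | N , close = N , λ n N≤n → close (f n) (ℕP.≤-trans N≤n (n≤fn n))

  ⟶-≤ : ∀ {s t l m} → (∀ n → s n ≤ t n) → s ⟶ l → t ⟶ m → l ≤ m
  ⟶-≤ {s} {t} {l} {m} s≤t s⟶l t⟶m = ≮⇒≥ λ m<l →
    let ε   = half (l - m)
        0<ε = half-pos (<⇒0<- m<l)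
        N₁  = s⟶l ε 0<ε
        N₂  = t⟶m ε 0<ε
        n   = proj₁ N₁ ℕ.⊔ proj₁ N₂
        contradictory = begin-strict
          l - ε             <⟨ proj₁ (proj₂ N₁ n (ℕP.m≤m⊔n _ _)) ⟩
          s n               ≤⟨ s≤t n ⟩
          t n               <⟨ proj₂ (proj₂ N₂ n (ℕP.m≤n⊔m _ _)) ⟩
          m + ε             ≈⟨ solve 3 (λ l m ε → m :+ ε := l :- ε :+ ((ε :+ ε) :- (l :- m))) refl l m ε ⟩
          l - ε + ((ε + ε) - (l - m)) ≈⟨ +-congˡ (+-congʳ (half+half (l - m))) ⟩
          l - ε + ((l - m) - (l - m)) ≈⟨ solve 3 (λ l m ε → l :- ε :+ ((l :- m) :- (l :- m)) := l :- ε) refl l m ε ⟩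
          l - ε             ∎
    in <-irrefl refl contradictory

  ⟶-unique : ∀ {s l m} → s ⟶ l → s ⟶ m → l ≈ m
  ⟶-unique s⟶l s⟶m = ≤-antisym (⟶-≤ (λ _ → ≤-refl) s⟶l s⟶m) (⟶-≤ (λ _ → ≤-refl) s⟶m s⟶l)

  lim-≈ : ∀ {s l} → s ⟶ l → lim s ≈ l
  lim-≈ {s} {l} s⟶l = ⟶-unique (the-satisfies (s ⟶_) (l , s⟶l)) s⟶l

  ⟶-+ : ∀ {s t l m} → s ⟶ l → t ⟶ m → (λ n → s n + t n) ⟶ (l + m)
  ⟶-+ {s} {t} {l} {m} s⟶l t⟶m ε 0<ε =
    let δ  = half ε
        N₁ = s⟶l δ (half-pos 0<ε)
        N₂ = t⟶m δ (half-pos 0<ε)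
    in proj₁ N₁ ℕ.⊔ proj₁ N₂ , λ n N≤n →
      let s-close = proj₂ N₁ n (ℕP.≤-trans (ℕP.m≤m⊔n _ _) N≤n)
          t-close = proj₂ N₂ n (ℕP.≤-trans (ℕP.m≤n⊔m _ _) N≤n)
      in (begin-strict
            l + m - ε             ≈⟨ +-congˡ (-‿cong (half+half ε)) ⟨
            l + m - (δ + δ)       ≈⟨ solve 3 (λ l m d → l :+ m :- (d :+ d) := l :- d :+ (m :- d)) refl l m δ ⟩
            l - δ + (m - δ)       <⟨ +-mono-< (proj₁ s-close) (proj₁ t-close) ⟩
            s n + t n             ∎) ,
         (begin-strict
            s n + t n             <⟨ +-mono-< (proj₂ s-close) (proj₂ t-close) ⟩
            l + δ + (m + δ)       ≈⟨ solve 3 (λ l m d → l :+ d :+ (m :+ d) := l :+ m :+ (d :+ d)) refl l m δ ⟩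
            l + m + (δ + δ)       ≈⟨ +-congˡ (half+half ε) ⟩
            l + m + ε             ∎)

  ⟶-neg : ∀ {s l} → s ⟶ l → (λ n → - s n) ⟶ (- l)
  ⟶-neg {s} {l} s⟶l ε 0<ε with s⟶l ε 0<ε
  ... | N , close = N , λ n N≤n →
    (begin-strict
      - l - ε    ≈⟨ solve 2 (λ l ε → :- l :- ε := :- (l :+ ε)) refl l ε ⟩
      - (l + ε)  <⟨ neg-mono-< (proj₂ (close n N≤n)) ⟩
      - s n      ∎) ,
    (begin-strict
      - s n      <⟨ neg-mono-< (proj₁ (close n N≤n)) ⟩
      - (l - ε)  ≈⟨ solve 2 (λ l ε → :- (l :- ε) := :- l :+ ε) refl l ε ⟩
      - l + ε    ∎)

  ⟶-- : ∀ {s t l m} → s ⟶ l → t ⟶ m → (λ n → s n - t n) ⟶ (l - m)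
  ⟶-- s⟶l t⟶m = ⟶-+ s⟶l (⟶-neg t⟶m)

  private
    -- Absolute values are avoided: 2 (ab - uv) = (a - u)(b + v) + (a + u)(b - v) and 2 (ab + uv) =
    -- (a - u)(b - v) + (a + u)(b + v) are sums of products of positive factors.
    product-< : ∀ {a b u v} → - a < u → u < a → - b < v → v < b → (- (a * b) < u * v) × (u * v < a * b)
    product-< {a} {b} {u} {v} -a<u u<a -b<v v<b =
      *-cancelˡ-< 2# (proj₁ 0<2) (<-by _
        (+-pos (*-pos 0<a-u 0<b-v) (proj₁ (*-pos 0<a+u 0<b+v)))
        (solve 4 (λ a b u v → (:1 :+ :1) :* (u :* v) := (:1 :+ :1) :* :- (a :* b) :+ ((a :- u) :* (b :- v) :+ (u :- :- a) :* (v :- :- b))) refl a b u v)) ,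
      *-cancelˡ-< 2# (proj₁ 0<2) (<-by _
        (+-pos (*-pos 0<a-u 0<b+v) (proj₁ (*-pos 0<a+u 0<b-v)))
        (solve 4 (λ a b u v → (:1 :+ :1) :* (a :* b) := (:1 :+ :1) :* (u :* v) :+ ((a :- u) :* (v :- :- b) :+ (u :- :- a) :* (b :- v))) refl a b u v))
      where
      0<a-u = <⇒0<- u<a
      0<a+u = <⇒0<- -a<u
      0<b-v = <⇒0<- v<b
      0<b+v = <⇒0<- -b<v

  Null : (ℕ → ℝ) → Set
  Null s = ∀ ε → 0# < ε → Σ ℕ λ N → ∀ n → N ℕ.≤ n → (- ε < s n) × (s n < ε)

  Null⇒⟶0 : ∀ {s} → Null s → s ⟶ 0#
  Null⇒⟶0 s-null ε 0<ε with s-null ε 0<ε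
  ... | N , close = N , λ n N≤n → ≈-<-trans (+-identityˡ _) (proj₁ (close n N≤n)) , <-≈-trans (proj₂ (close n N≤n)) (sym (+-identityˡ ε))

  ⟶0⇒Null : ∀ {s} → s ⟶ 0# → Null s
  ⟶0⇒Null s⟶0 ε 0<ε with s⟶0 ε 0<ε
  ... | N , close = N , λ n N≤n → ≈-<-trans (sym (+-identityˡ _)) (proj₁ (close n N≤n)) , <-≈-trans (proj₂ (close n N≤n)) (+-identityˡ ε)

  ⟶⇒-Null : ∀ {s l} → s ⟶ l → Null (λ n → s n - l)
  ⟶⇒-Null {s} {l} s⟶l = ⟶0⇒Null (⟶-cong (λ _ → refl) (-‿inverseʳ l) (⟶-- s⟶l (⟶-const l)))

  Null-* : ∀ {s t} → Null s → Null t → Null (λ n → s n * t n)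
  Null-* s-null t-null ε 0<ε =
    let N₁ = s-null ε 0<ε
        N₂ = t-null 1# 0<1
    in proj₁ N₁ ℕ.⊔ proj₁ N₂ , λ n N≤n →
      let s-close = proj₂ N₁ n (ℕP.≤-trans (ℕP.m≤m⊔n _ _) N≤n)
          t-close = proj₂ N₂ n (ℕP.≤-trans (ℕP.m≤n⊔m _ _) N≤n)
          st-close = product-< (proj₁ s-close) (proj₂ s-close) (proj₁ t-close) (proj₂ t-close)
      in ≈-<-trans (-‿cong (sym (*-identityʳ ε))) (proj₁ st-close) , <-≈-trans (proj₂ st-close) (*-identityʳ ε)

  Null-scale : ∀ {s} c → Null s → Null (λ n → s n * c)
  Null-scale {s} c s-null ε 0<ε with s-null (ε * k ⁻¹) (*-pos 0<ε (⁻¹-pos 0<k))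
    where
    -- A strict bound for both c and -c, since 2 (1 + c²) ∓ 2c = 1 + c² + (1 ∓ c)².
    k = 1# + c * c
    0<k : 0# < k
    0<k = +-pos 0<1 (sq-nonNeg c)
  ... | N , close = N , λ n N≤n →
      let sc-close = product-< (proj₁ (close n N≤n)) (proj₂ (close n N≤n)) -k<c c<k
      in ≈-<-trans (-‿cong (sym δk≈ε)) (proj₁ sc-close) , <-≈-trans (proj₂ sc-close) δk≈ε
    where
    k = 1# + c * c
    0<k : 0# < k
    0<k = +-pos 0<1 (sq-nonNeg c)
    δk≈ε : ε * k ⁻¹ * k ≈ ε
    δk≈ε = trans (*-assoc ε (k ⁻¹) k) (trans (*-congˡ (trans (*-comm (k ⁻¹) k) (⁻¹-inverse 0<k))) (*-identityʳ ε))
    c<k : c < k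
    c<k = *-cancelˡ-< 2# (proj₁ 0<2) (<-by _ (+-pos (+-pos 0<1 (sq-nonNeg c)) (sq-nonNeg (1# - c)))
      (solve 1 (λ c → (:1 :+ :1) :* (:1 :+ c :* c) := (:1 :+ :1) :* c :+ (:1 :+ c :* c :+ (:1 :- c) :* (:1 :- c))) refl c))
    -k<c : - k < c
    -k<c = *-cancelˡ-< 2# (proj₁ 0<2) (<-by _ (+-pos (+-pos 0<1 (sq-nonNeg c)) (sq-nonNeg (1# + c)))
      (solve 1 (λ c → (:1 :+ :1) :* c := (:1 :+ :1) :* :- (:1 :+ c :* c) :+ (:1 :+ c :* c :+ (:1 :+ c) :* (:1 :+ c))) refl c))

  -- The difference st - lm is (s - l)(t - m) + (t - m) l + (s - l) m, a sum of null sequences.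
  ⟶-* : ∀ {s t l m} → s ⟶ l → t ⟶ m → (λ n → s n * t n) ⟶ (l * m)
  ⟶-* {s} {t} {l} {m} s⟶l t⟶m = ⟶-cong
    (λ n → solve 4 (λ s t l m → (s :- l) :* (t :- m) :+ (t :- m) :* l :+ (s :- l) :* m :+ l :* m := s :* t) refl (s n) (t n) l m)
    (solve 2 (λ l m → :0 :+ :0 :+ :0 :+ l :* m := l :* m) refl l m)
    (⟶-+ (⟶-+ (⟶-+
      (Null⇒⟶0 (Null-* s-null t-null)) (Null⇒⟶0 (Null-scale l t-null))) (Null⇒⟶0 (Null-scale m s-null))) (⟶-const (l * m)))
    where
    s-null = ⟶⇒-Null s⟶l
    t-null = ⟶⇒-Null t⟶m

  Null-dominated : ∀ {s t} → (∀ n → (- t n ≤ s n) × (s n ≤ t n)) → Null t → Null s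
  Null-dominated {s} {t} bound t-null ε 0<ε with t-null ε 0<ε
  ... | N , close = N , λ n N≤n →
    <-≤-trans (neg-mono-< (proj₂ (close n N≤n))) (proj₁ (bound n)) , ≤-<-trans (proj₂ (bound n)) (proj₂ (close n N≤n))

  monotone : ∀ {s : ℕ → ℝ} → (∀ n → s n ≤ s (suc n)) → ∀ {m n} → m ℕ.≤ n → s m ≤ s n
  monotone {s} step {m} m≤n = go (ℕP.≤⇒≤′ m≤n)
    where
    go : ∀ {n} → m ℕ.≤′ n → s m ≤ s n
    go (ℕ.≤′-reflexive ≡.refl) = ≤-refl
    go (ℕ.≤′-step m≤n)  = ≤-trans (go m≤n) (step _)

  monotone-convergence : ∀ {s b} → (∀ n → s n ≤ s (suc n)) → (∀ n → s n ≤ b) → ∃ (s ⟶_)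
  monotone-convergence {s} {b} step bounded = l , converges
    where
    IsTerm : ℝ → Set
    IsTerm y = ∃ λ n → y ≈ s n
    sup = supremum IsTerm (s 0 , 0 , refl) (b , λ { (n , y≈sn) → ≈-≤-trans y≈sn (bounded n) })
    l = proj₁ sup
    s≤l : ∀ n → s n ≤ l
    s≤l n = proj₁ (proj₂ sup) (n , refl)
    converges : s ⟶ l
    converges ε 0<ε with em {∃ λ N → l - ε < s N}
    ... | yes (N , l-ε<sN) = N , λ n N≤n → <-≤-trans l-ε<sN (monotone step N≤n) , ≤-<-trans (s≤l n) (<-by ε 0<ε refl)
    ... | no ∄ = ⊥-elim (<⇒≱ l-ε<l (proj₂ (proj₂ sup) λ { (n , y≈sn) → ≈-≤-trans y≈sn (≮⇒≥ λ l-ε<sn → ∄ (n , l-ε<sn)) }))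
      where
      l-ε<l : l - ε < l
      l-ε<l = <-by ε 0<ε (solve 2 (λ l ε → l := (l :- ε) :+ ε) refl l ε)

-- Identities proved here once for an abstract ring; running the solver in ℂ itself is prohibitively slow.
module RingIdentities {c ℓ} (A : CommutativeRing c ℓ) where

  open CommutativeRing A
  open IntegerCoefficients A

  *-interchange₃ : ∀ a b x y → a * (b * x * y) ≈ (a * b) * (x * y)
  *-interchange₃ = solve 4 (λ a b x y → a :* (b :* x :* y) := (a :* b) :* (x :* y)) refl

  x-y+z≈x+z-y : ∀ x y z → x - y + z ≈ x + z - y
  x-y+z≈x+z-y = solve 3 (λ x y z → x :- y :+ z := x :+ z :- y) refl

  x-0≈x : ∀ x → x - 0# ≈ x
  x-0≈x = solve 1 (λ x → x :- con (+ 0) := x) refl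

  *-interchange : ∀ a x b y → (a * x) * (b * y) ≈ (a * b) * (x * y)
  *-interchange = solve 4 (λ a x b y → (a :* x) :* (b :* y) := (a :* b) :* (x :* y)) refl

  [x-1]y≈xy-y : ∀ x y → (x - 1#) * y ≈ x * y - y
  [x-1]y≈xy-y = solve 2 (λ x y → (x :- con (+ 1)) :* y := x :* y :- y) refl

  x≈x-1+1 : ∀ x → x ≈ x - 1# + 1#
  x≈x-1+1 = solve 1 (λ x → x := x :- con (+ 1) :+ con (+ 1)) refl

  *-transfer : ∀ a b x y → (a * b) * (x * y) ≈ (a * x) * (b * y)
  *-transfer = solve 4 (λ a b x y → (a :* b) :* (x :* y) := (a :* x) :* (b :* y)) refl

  x+y-x≈y : ∀ x y → x + y - x ≈ y
  x+y-x≈y = solve 2 (λ x y → x :+ y :- x := y) refl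

-- Cauchy products and the recurrence of exponential coefficients.

module Convolution {c ℓ} (A : CommutativeRing c ℓ) where

  open CommutativeRing A
  open SemiringMult semiring using () renaming (_×_ to _·_)
  open IntegerCoefficients A
  open SetoidReasoning setoid

  private
    Sequence : Set c
    Sequence = ℕ → Carrier

    ι : Sequence
    ι n = n · 1#

    variable
      f f′ g g′ h : Sequence

  psum : Sequence → Sequence
  psum f zero    = 0#
  psum f (suc n) = psum f n + f n

  -- The coefficient of index n in the Cauchy product. Shifting the first factor while n decreases
  -- avoids the subtraction n - i.
  conv : Sequence → Sequence → Sequence
  conv f g zero    = f 0 * g 0
  conv f g (suc n) = f 0 * g (suc n) + conv (f ∘ suc) g n

  psum-cong : (∀ i → f i ≈ g i) → ∀ n → psum f n ≈ psum g n
  psum-cong f≈g zero    = refl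
  psum-cong f≈g (suc n) = +-cong (psum-cong f≈g n) (f≈g n)

  psum-head : ∀ f n → psum f (suc n) ≈ f 0 + psum (f ∘ suc) n
  psum-head f zero    = trans (+-identityˡ _) (sym (+-identityʳ _))
  psum-head f (suc n) = trans (+-congʳ (psum-head f n)) (+-assoc _ _ _)

  sum-toℕ : ∀ f n → RawMonoidDefs.sum +-rawMonoid {n} (λ k → f (toℕ k)) ≈ psum f n
  sum-toℕ f zero    = refl
  sum-toℕ f (suc n) = trans (+-congˡ (sum-toℕ (f ∘ suc) n)) (sym (psum-head f n))

  conv-cong : (∀ i → f i ≈ f′ i) → (∀ j → g j ≈ g′ j) → ∀ n → conv f g n ≈ conv f′ g′ n
  conv-cong f≈f′ g≈g′ zero    = *-cong (f≈f′ 0) (g≈g′ 0)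
  conv-cong f≈f′ g≈g′ (suc n) = +-cong (*-cong (f≈f′ 0) (g≈g′ (suc n))) (conv-cong (f≈f′ ∘ suc) g≈g′ n)

  conv-last : ∀ f g n → conv f g (suc n) ≈ conv f (g ∘ suc) n + f (suc n) * g 0
  conv-last f g zero    = refl
  conv-last f g (suc n) = trans (+-congˡ (conv-last (f ∘ suc) g n)) (sym (+-assoc _ _ _))

  conv-distribʳ : ∀ f g h n → conv f (λ j → g j + h j) n ≈ conv f g n + conv f h n
  conv-distribʳ f g h zero    = distribˡ _ _ _
  conv-distribʳ f g h (suc n) = trans (+-congˡ (conv-distribʳ (f ∘ suc) g h n))
    (solve 5 (λ f g h a b → f :* (g :+ h) :+ (a :+ b) := (f :* g :+ a) :+ (f :* h :+ b)) refl _ _ _ _ _)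

  conv-distribˡ : ∀ f g h n → conv (λ i → f i + g i) h n ≈ conv f h n + conv g h n
  conv-distribˡ f g h zero    = distribʳ _ _ _
  conv-distribˡ f g h (suc n) = trans (+-congˡ (conv-distribˡ (f ∘ suc) (g ∘ suc) h n))
    (solve 5 (λ f g h a b → (f :+ g) :* h :+ (a :+ b) := (f :* h :+ a) :+ (g :* h :+ b)) refl _ _ _ _ _)

  conv-scaleˡ : ∀ z f g n → conv (λ i → z * f i) g n ≈ z * conv f g n
  conv-scaleˡ z f g zero    = *-assoc _ _ _
  conv-scaleˡ z f g (suc n) = trans (+-congˡ (conv-scaleˡ z (f ∘ suc) g n))
    (solve 4 (λ z f g a → (z :* f) :* g :+ z :* a := z :* (f :* g :+ a)) refl _ _ _ _)

  conv-scaleʳ : ∀ z f g n → conv f (λ j → z * g j) n ≈ z * conv f g n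
  conv-scaleʳ z f g zero    = solve 3 (λ z f g → f :* (z :* g) := z :* (f :* g)) refl _ _ _
  conv-scaleʳ z f g (suc n) = trans (+-congˡ (conv-scaleʳ z (f ∘ suc) g n))
    (solve 4 (λ z f g a → f :* (z :* g) :+ z :* a := z :* (f :* g :+ a)) refl _ _ _ _)

  conv-const : ∀ f x n → conv f (λ _ → x) n ≈ psum f (suc n) * x
  conv-const f x zero    = *-congʳ (sym (+-identityˡ _))
  conv-const f x (suc n) = begin
    conv f (λ _ → x) (suc n)                ≈⟨ conv-last f (λ _ → x) n ⟩
    conv f (λ _ → x) n + f (suc n) * x      ≈⟨ +-congʳ (conv-const f x n) ⟩
    psum f (suc n) * x + f (suc n) * x      ≈⟨ distribʳ _ _ _ ⟨
    psum f (suc (suc n)) * x                ∎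

  conv-psum : ∀ f g n → conv f (psum g) n ≈ psum (conv f g) n
  conv-psum f g zero    = zeroʳ _
  conv-psum f g (suc n) = begin
    conv f (psum g) (suc n)                            ≈⟨ conv-last f (psum g) n ⟩
    conv f (λ j → psum g j + g j) n + f (suc n) * 0#   ≈⟨ +-cong (conv-distribʳ f (psum g) g n) (zeroʳ _) ⟩
    conv f (psum g) n + conv f g n + 0#                ≈⟨ +-identityʳ _ ⟩
    conv f (psum g) n + conv f g n                     ≈⟨ +-congʳ (conv-psum f g n) ⟩
    psum (conv f g) (suc n)                            ∎

  -- The factor `psum g n` beside f i splits into its first n - i terms and a tail. The first parts
  -- assemble to the Cauchy product; there the last term f n meets an empty sum, so the extra term
  -- of f does no harm.
  product-of-partial-sums : ∀ f g n →
    psum f (suc n) * psum g n ≈ conv f (λ j → psum g n - psum g j) n + psum (conv f g) n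
  product-of-partial-sums f g n = begin
    psum f (suc n) * psum g n                            ≈⟨ conv-const f (psum g n) n ⟨
    conv f (λ _ → psum g n) n                            ≈⟨ conv-cong (λ _ → refl) split n ⟩
    conv f (λ j → psum g n - psum g j + psum g j) n      ≈⟨ conv-distribʳ f _ _ n ⟩
    conv f (λ j → psum g n - psum g j) n + conv f (psum g) n  ≈⟨ +-congˡ (conv-psum f g n) ⟩
    conv f (λ j → psum g n - psum g j) n + psum (conv f g) n  ∎
    where
    split : ∀ j → psum g n ≈ psum g n - psum g j + psum g j
    split j = solve 2 (λ a b → a := a :- b :+ b) refl _ _

  private
    -- The Leibniz rule for the Euler operator t d/dt on power series: the indices i and j in a term
    -- of the Cauchy product add up to n.
    conv-degree : ∀ f g n → ι n * conv f g n ≈ conv (λ i → ι i * f i) g n + conv f (λ j → ι j * g j) n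
    conv-degree f g zero = solve 2 (λ f g → con (+ 0) :* (f :* g) := (con (+ 0) :* f) :* g :+ f :* (con (+ 0) :* g)) refl (f 0) (g 0)
    conv-degree f g (suc n) = begin
      (1# + ι n) * (f 0 * g (suc n) + C)
        ≈⟨ solve 4 (λ i f g C → (con (+ 1) :+ i) :* (f :* g :+ C) := (con (+ 1) :+ i) :* f :* g :+ C :+ i :* C) refl (ι n) (f 0) (g (suc n)) C ⟩
      (1# + ι n) * f 0 * g (suc n) + C + ι n * C
        ≈⟨ +-congˡ (conv-degree (f ∘ suc) g n) ⟩
      (1# + ι n) * f 0 * g (suc n) + C + (D + E)
        ≈⟨ solve 6 (λ i f g C D E → (con (+ 1) :+ i) :* f :* g :+ C :+ (D :+ E) := (con (+ 0) :* f :* g :+ (C :+ D)) :+ (f :* ((con (+ 1) :+ i) :* g) :+ E)) refl (ι n) (f 0) (g (suc n)) C D E ⟩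
      (0# * f 0 * g (suc n) + (C + D)) + (f 0 * ((1# + ι n) * g (suc n)) + E)
        ≈⟨ +-congʳ (+-congˡ (conv-distribˡ (f ∘ suc) (λ i → ι i * f (suc i)) g n)) ⟨
      (0# * f 0 * g (suc n) + conv (λ i → f (suc i) + ι i * f (suc i)) g n) + (f 0 * ((1# + ι n) * g (suc n)) + E)
        ≈⟨ +-congʳ (+-congˡ (conv-cong (λ i → solve 2 (λ i f → f :+ i :* f := (con (+ 1) :+ i) :* f) refl (ι i) (f (suc i))) (λ _ → refl) n)) ⟩
      (0# * f 0 * g (suc n) + conv (λ i → (1# + ι i) * f (suc i)) g n) + (f 0 * ((1# + ι n) * g (suc n)) + E)
        ∎
      where
      C = conv (f ∘ suc) g n
      D = conv (λ i → ι i * f (suc i)) g n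
      E = conv (f ∘ suc) (λ j → ι j * g j) n

  -- The coefficients of the solution of y′ = z y, y(0) = 1, that is zⁿ/n!, described without
  -- division so that the notion makes sense in any commutative ring.
  IsExponential : Carrier → Sequence → Set ℓ
  IsExponential z f = (f 0 ≈ 1#) × (∀ n → ι (suc n) * f (suc n) ≈ z * f n)

  -- The product of solutions of y′ = z y and y′ = w y solves y′ = (z + w) y by the Leibniz rule.
  -- With uniqueness this replaces the binomial theorem.
  conv-exponential : ∀ {z w} → IsExponential z f → IsExponential w g → IsExponential (z + w) (conv f g)
  conv-exponential {f = f} {g = g} {z = z} {w = w} (f0 , f-step) (g0 , g-step) = trans (*-cong f0 g0) (*-identityʳ 1#) , step
    where
    step : ∀ n → ι (suc n) * conv f g (suc n) ≈ (z + w) * conv f g n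
    step n = begin
      ι (suc n) * conv f g (suc n)
        ≈⟨ conv-degree f g (suc n) ⟩
      (0# * f 0 * g (suc n) + conv (λ i → ι (suc i) * f (suc i)) g n) + conv f (λ j → ι j * g j) (suc n)
        ≈⟨ +-cong (+-congˡ (conv-cong f-step (λ _ → refl) n)) (conv-last f (λ j → ι j * g j) n) ⟩
      (0# * f 0 * g (suc n) + conv (λ i → z * f i) g n) + (conv f (λ j → ι (suc j) * g (suc j)) n + f (suc n) * (0# * g 0))
        ≈⟨ +-cong (+-congˡ (conv-scaleˡ z f g n)) (+-congʳ (trans (conv-cong (λ _ → refl) g-step n) (conv-scaleʳ w f g n))) ⟩
      (0# * f 0 * g (suc n) + z * conv f g n) + (w * conv f g n + f (suc n) * (0# * g 0))
        ≈⟨ solve 7 (λ f0 gn z w C fn g0 → (con (+ 0) :* f0 :* gn :+ z :* C) :+ (w :* C :+ fn :* (con (+ 0) :* g0)) := (z :+ w) :* C) refl (f 0) (g (suc n)) z w (conv f g n) (f (suc n)) (g 0) ⟩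
      (z + w) * conv f g n ∎

  exponential-unique : (∀ n {x y} → ι (suc n) * x ≈ ι (suc n) * y → x ≈ y) →
    ∀ {z} → IsExponential z f → IsExponential z g → ∀ n → f n ≈ g n
  exponential-unique cancel (f0 , f-step) (g0 , g-step) zero    = trans f0 (sym g0)
  exponential-unique cancel (f0 , f-step) (g0 , g-step) (suc n) = cancel n
    (trans (f-step n) (trans (*-congˡ (exponential-unique cancel (f0 , f-step) (g0 , g-step) n)) (sym (g-step n))))

-- The complex numbers as a commutative ring, and bounds for the modulus.

module ComplexNumbers (em : ExcludedMiddle 0ℓ) (R : CompleteOrderedField) where

  open OrderedField em R
  open Limits em R
  open PosetReasoning ≤-poset

  ℂ-commutativeRing : CommutativeRing 0ℓ 0ℓ
  ℂ-commutativeRing = record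
    { _≈_ = _≈ᶜ_ ; _+_ = _+ᶜ_ ; _*_ = _*ᶜ_ ; -_ = -ᶜ_ ; 0# = 0ᶜ ; 1# = 1ᶜ
    ; isCommutativeRing = record
      { isRing = record
        { +-isAbelianGroup = record
          { isGroup = record
            { isMonoid = record
              { isSemigroup = record
                { isMagma = record
                  { isEquivalence = record
                    { refl  = refl , refl
                    ; sym   = λ (re , im) → sym re , sym im
                    ; trans = λ (re , im) (re′ , im′) → trans re re′ , trans im im′
                    }
                  ; ∙-cong = λ (re , im) (re′ , im′) → +-cong re re′ , +-cong im im′
                  }
                ; assoc = λ _ _ _ → +-assoc _ _ _ , +-assoc _ _ _
                }
              ; identity = (λ _ → +-identityˡ _ , +-identityˡ _) , (λ _ → +-identityʳ _ , +-identityʳ _)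
              }
            ; inverse = (λ _ → -‿inverseˡ _ , -‿inverseˡ _) , (λ _ → -‿inverseʳ _ , -‿inverseʳ _)
            ; ⁻¹-cong = λ (re , im) → -‿cong re , -‿cong im
            }
          ; comm = λ _ _ → +-comm _ _ , +-comm _ _
          }
        ; *-cong = λ (re , im) (re′ , im′) →
            +-cong (*-cong re re′) (-‿cong (*-cong im im′)) , +-cong (*-cong re im′) (*-cong im re′)
        ; *-assoc = λ (a +i b) (c +i d) (e +i f) →
            solve 6 (λ a b c d e f → (a :* c :- b :* d) :* e :- (a :* d :+ b :* c) :* f := a :* (c :* e :- d :* f) :- b :* (c :* f :+ d :* e)) refl a b c d e f ,
            solve 6 (λ a b c d e f → (a :* c :- b :* d) :* f :+ (a :* d :+ b :* c) :* e := a :* (c :* f :+ d :* e) :+ b :* (c :* e :- d :* f)) refl a b c d e f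
        ; *-identity =
            (λ (a +i b) →
              solve 2 (λ a b → :1 :* a :- :0 :* b := a) refl a b , solve 2 (λ a b → :1 :* b :+ :0 :* a := b) refl a b) ,
            (λ (a +i b) →
              solve 2 (λ a b → a :* :1 :- b :* :0 := a) refl a b , solve 2 (λ a b → a :* :0 :+ b :* :1 := b) refl a b)
        ; distrib =
            (λ (a +i b) (c +i d) (e +i f) →
              solve 6 (λ a b c d e f → a :* (c :+ e) :- b :* (d :+ f) := (a :* c :- b :* d) :+ (a :* e :- b :* f)) refl a b c d e f ,
              solve 6 (λ a b c d e f → a :* (d :+ f) :+ b :* (c :+ e) := (a :* d :+ b :* c) :+ (a :* f :+ b :* e)) refl a b c d e f) ,
            (λ (a +i b) (c +i d) (e +i f) →
              solve 6 (λ a b c d e f → (c :+ e) :* a :- (d :+ f) :* b := (c :* a :- d :* b) :+ (e :* a :- f :* b)) refl a b c d e f ,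
              solve 6 (λ a b c d e f → (c :+ e) :* b :+ (d :+ f) :* a := (c :* b :+ d :* a) :+ (e :* b :+ f :* a)) refl a b c d e f)
        }
      ; *-comm = λ (a +i b) (c +i d) →
          solve 4 (λ a b c d → a :* c :- b :* d := c :* a :- d :* b) refl a b c d ,
          solve 4 (λ a b c d → a :* d :+ b :* c := c :* b :+ d :* a) refl a b c d
      }
    }

  module ℂR = CommutativeRing ℂ-commutativeRing
  module ℂI = RingIdentities ℂ-commutativeRing

  normSq : ℂ → ℝ
  normSq z = Re z * Re z + Im z * Im z

  normSq-nonNeg : ∀ z → 0# ≤ normSq z
  normSq-nonNeg z = +-nonNeg (sq-nonNeg (Re z)) (sq-nonNeg (Im z))

  normSq-cong : ∀ {z w} → z ≈ᶜ w → normSq z ≈ normSq w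
  normSq-cong (re , im) = +-cong (*-cong re re) (*-cong im im)

  normSq-* : ∀ z w → normSq (z *ᶜ w) ≈ normSq z * normSq w
  normSq-* (a +i b) (c +i d) = solve 4 (λ a b c d →
    (a :* c :- b :* d) :* (a :* c :- b :* d) :+ (a :* d :+ b :* c) :* (a :* d :+ b :* c) :=
    (a :* a :+ b :* b) :* (c :* c :+ d :* d)) refl a b c d

  conj-cong : ∀ {z w} → z ≈ᶜ w → conj z ≈ᶜ conj w
  conj-cong (re , im) = re , -‿cong im

  conj-+ : ∀ z w → conj (z +ᶜ w) ≈ᶜ conj z +ᶜ conj w
  conj-+ z w = refl , solve 2 (λ b d → :- (b :+ d) := :- b :+ :- d) refl (Im z) (Im w)

  conj-* : ∀ z w → conj (z *ᶜ w) ≈ᶜ conj z *ᶜ conj w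
  conj-* (a +i b) (c +i d) =
    solve 4 (λ a b c d → a :* c :- b :* d := a :* c :- (:- b) :* (:- d)) refl a b c d ,
    solve 4 (λ a b c d → :- (a :* d :+ b :* c) := a :* (:- d) :+ (:- b) :* c) refl a b c d

  z*conj-z : ∀ z → z *ᶜ conj z ≈ᶜ (normSq z +i 0#)
  z*conj-z (a +i b) =
    solve 2 (λ a b → a :* a :- b :* (:- b) := a :* a :+ b :* b) refl a b ,
    solve 2 (λ a b → a :* (:- b) :+ b :* a := :0) refl a b

  ofReal-* : ∀ a z → (a +i 0#) *ᶜ z ≈ᶜ a • z
  ofReal-* a (c +i d) =
    solve 3 (λ a c d → a :* c :- :0 :* d := a :* c) refl a c d ,
    solve 3 (λ a c d → a :* d :+ :0 :* c := a :* d) refl a c d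

  ofReal-cong : ∀ {a b} → a ≈ b → (a +i 0#) ≈ᶜ (b +i 0#)
  ofReal-cong a≈b = a≈b , refl

  _⟶ᶜ_ : (ℕ → ℂ) → ℂ → Set
  s ⟶ᶜ l = ((λ n → Re (s n)) ⟶ Re l) × ((λ n → Im (s n)) ⟶ Im l)

  ⟶ᶜ-cong : ∀ {s t l m} → (∀ n → s n ≈ᶜ t n) → l ≈ᶜ m → s ⟶ᶜ l → t ⟶ᶜ m
  ⟶ᶜ-cong s≈t (re , im) (s⟶l , s⟶l′) =
    ⟶-cong (λ n → proj₁ (s≈t n)) re s⟶l , ⟶-cong (λ n → proj₂ (s≈t n)) im s⟶l′

  ⟶ᶜ-unique : ∀ {s l m} → s ⟶ᶜ l → s ⟶ᶜ m → l ≈ᶜ m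
  ⟶ᶜ-unique (re , im) (re′ , im′) = ⟶-unique re re′ , ⟶-unique im im′

  ⟶ᶜ-* : ∀ {s t l m} → s ⟶ᶜ l → t ⟶ᶜ m → (λ n → s n *ᶜ t n) ⟶ᶜ (l *ᶜ m)
  ⟶ᶜ-* (re , im) (re′ , im′) =
    ⟶-- (⟶-* re re′) (⟶-* im im′) , ⟶-+ (⟶-* re im′) (⟶-* im re′)

  ⟶ᶜ-+ : ∀ {s t l m} → s ⟶ᶜ l → t ⟶ᶜ m → (λ n → s n +ᶜ t n) ⟶ᶜ (l +ᶜ m)
  ⟶ᶜ-+ (re , im) (re′ , im′) = ⟶-+ re re′ , ⟶-+ im im′

  ⟶ᶜ-reindex : ∀ {s l} (f : ℕ → ℕ) → (∀ n → n ℕ.≤ f n) → s ⟶ᶜ l → (λ n → s (f n)) ⟶ᶜ l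
  ⟶ᶜ-reindex f n≤fn (re , im) = ⟶-reindex f n≤fn re , ⟶-reindex f n≤fn im

  infix 4 ∣_∣≤_
  -- Stated with squares because square roots are only available after the exponential has been
  -- constructed.
  ∣_∣≤_ : ℂ → ℝ → Set
  ∣ z ∣≤ t = (0# ≤ t) × (normSq z ≤ t * t)

  ∣∣≤-cong : ∀ {z w t s} → z ≈ᶜ w → t ≈ s → ∣ z ∣≤ t → ∣ w ∣≤ s
  ∣∣≤-cong z≈w t≈s (0≤t , z≤t) =
    ≤-≈-trans 0≤t t≈s , ≈-≤-trans (normSq-cong (ℂR.sym z≈w)) (≤-≈-trans z≤t (*-cong t≈s t≈s))

  ∣∣≤-* : ∀ {z w t s} → ∣ z ∣≤ t → ∣ w ∣≤ s → ∣ z *ᶜ w ∣≤ t * s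
  ∣∣≤-* {z} {w} {t} {s} (0≤t , z≤t) (0≤s , w≤s) = *-nonNeg 0≤t 0≤s , (begin
    normSq (z *ᶜ w)       ≈⟨ normSq-* z w ⟩
    normSq z * normSq w   ≤⟨ *-mono-≤ (normSq-nonNeg z) (normSq-nonNeg w) z≤t w≤s ⟩
    t * t * (s * s)       ≈⟨ solve 2 (λ t s → t :* t :* (s :* s) := t :* s :* (t :* s)) refl t s ⟩
    t * s * (t * s)       ∎)

  ∣∣≤-0 : ∣ 0ᶜ ∣≤ 0#
  ∣∣≤-0 = ≤-refl , ≤-reflexive (solve 0 (:0 :* :0 :+ :0 :* :0 := :0 :* :0) refl)

  ∣∣≤-+ : ∀ {z w t s} → ∣ z ∣≤ t → ∣ w ∣≤ s → ∣ z +ᶜ w ∣≤ t + s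
  ∣∣≤-+ {a +i b} {c +i d} {t} {s} (0≤t , z≤t) (0≤s , w≤s) = +-nonNeg 0≤t 0≤s , (begin
    (a + c) * (a + c) + (b + d) * (b + d)
      ≈⟨ solve 4 (λ a b c d → (a :+ c) :* (a :+ c) :+ (b :+ d) :* (b :+ d) := (a :* a :+ b :* b) :+ (c :* c :+ d :* d) :+ (:1 :+ :1) :* (a :* c :+ b :* d)) refl a b c d ⟩
    (a * a + b * b) + (c * c + d * d) + 2# * (a * c + b * d)
      ≤⟨ +-mono-≤ (+-mono-≤ z≤t w≤s) (*-monoˡ-≤ 2# (proj₁ 0<2) inner≤ts) ⟩
    t * t + s * s + 2# * (t * s)
      ≈⟨ solve 2 (λ t s → t :* t :+ s :* s :+ (:1 :+ :1) :* (t :* s) := (t :+ s) :* (t :+ s)) refl t s ⟩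
    (t + s) * (t + s) ∎)
    where
    -- Cauchy-Schwarz, from Lagrange's identity (ac + bd)² + (ad - bc)² = (a² + b²)(c² + d²).
    inner≤ts : a * c + b * d ≤ t * s
    inner≤ts = sq-cancel-≤ (*-nonNeg 0≤t 0≤s) (begin
      (a * c + b * d) * (a * c + b * d)
        ≤⟨ ≤-by ((a * d - b * c) * (a * d - b * c)) (sq-nonNeg _) (solve 4 (λ a b c d → (a :* a :+ b :* b) :* (c :* c :+ d :* d) := (a :* c :+ b :* d) :* (a :* c :+ b :* d) :+ (a :* d :- b :* c) :* (a :* d :- b :* c)) refl a b c d) ⟩
      (a * a + b * b) * (c * c + d * d)
        ≤⟨ *-mono-≤ (normSq-nonNeg (a +i b)) (normSq-nonNeg (c +i d)) z≤t w≤s ⟩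
      t * t * (s * s)
        ≈⟨ solve 2 (λ t s → t :* t :* (s :* s) := t :* s :* (t :* s)) refl t s ⟩
      t * s * (t * s) ∎)

  ∣∣≤-exists : ∀ z → ∃ λ t → ∣ z ∣≤ t
  ∣∣≤-exists z = 1# + m , +-nonNeg (proj₁ 0<1) 0≤m ,
    ≤-by (1# + m + m * m) (+-nonNeg (+-nonNeg (proj₁ 0<1) 0≤m) (sq-nonNeg m))
      (solve 1 (λ m → (:1 :+ m) :* (:1 :+ m) := m :+ (:1 :+ m :+ m :* m)) refl m)
    where
    m = normSq z
    0≤m = normSq-nonNeg z

  private
    sq≤⇒within : ∀ {a t} → 0# ≤ t → a * a ≤ t * t → (- t ≤ a) × (a ≤ t)
    sq≤⇒within {a} {t} 0≤t aa≤tt =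
      ≤-≈-trans (neg-mono-≤ (sq-cancel-≤ 0≤t (≈-≤-trans (solve 1 (λ a → (:- a) :* (:- a) := a :* a) refl a) aa≤tt)))
        (solve 1 (λ a → :- (:- a) := a) refl a) ,
      sq-cancel-≤ 0≤t aa≤tt

  ∣∣≤⇒Re : ∀ {z t} → ∣ z ∣≤ t → (- t ≤ Re z) × (Re z ≤ t)
  ∣∣≤⇒Re {z} (0≤t , z≤t) = sq≤⇒within 0≤t (≤-trans (≤-by (Im z * Im z) (sq-nonNeg (Im z)) refl) z≤t)

  ∣∣≤⇒Im : ∀ {z t} → ∣ z ∣≤ t → (- t ≤ Im z) × (Im z ≤ t)
  ∣∣≤⇒Im {z} (0≤t , z≤t) = sq≤⇒within 0≤t (≤-trans (≤-by (Re z * Re z) (sq-nonNeg (Re z)) (+-comm _ _)) z≤t)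

-- Convergence and functional equation of the exponential series.

module ExponentialSeries (em : ExcludedMiddle 0ℓ) (R : CompleteOrderedField) where

  open OrderedField em R
  open Limits em R
  open ComplexNumbers em R
  open PosetReasoning ≤-poset

  module ℝC = Convolution commutativeRing
  module ℂC = Convolution ℂ-commutativeRing
  open ℝC using (psum)
  open ℂC using () renaming (psum to psumᶜ)
  open SemiringMult ℂR.semiring using () renaming (_×_ to _·ᶜ_)
  open SemiringExp ℂR.semiring using () renaming (^-congˡ to ^ᶜ-congˡ)

  fromℕᶜ : ∀ n → n ·ᶜ 1ᶜ ≈ᶜ (fromℕ n +i 0#)
  fromℕᶜ zero    = ℂR.refl
  fromℕᶜ (suc n) = +-congˡ (proj₁ (fromℕᶜ n)) , trans (+-congˡ (proj₂ (fromℕᶜ n))) (+-identityʳ 0#)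

  fromℕᶜ-* : ∀ n z → (n ·ᶜ 1ᶜ) *ᶜ z ≈ᶜ fromℕ n • z
  fromℕᶜ-* n z = ℂR.trans (ℂR.*-congʳ (fromℕᶜ n)) (ofReal-* (fromℕ n) z)

  fromℕᶜ-cancel : ∀ n {z w} → (suc n ·ᶜ 1ᶜ) *ᶜ z ≈ᶜ (suc n ·ᶜ 1ᶜ) *ᶜ w → z ≈ᶜ w
  fromℕᶜ-cancel n {z} {w} eq = *-cancelˡ-≈ _ n≉0 (proj₁ eq′) , *-cancelˡ-≈ _ n≉0 (proj₂ eq′)
    where
    n≉0 = >⇒≉ (fromℕ-pos n)
    eq′ : fromℕ (suc n) • z ≈ᶜ fromℕ (suc n) • w
    eq′ = ℂR.trans (ℂR.sym (fromℕᶜ-* (suc n) z)) (ℂR.trans eq (fromℕᶜ-* (suc n) w))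

  fromℕ-cancel : ∀ n {x y} → fromℕ (suc n) * x ≈ fromℕ (suc n) * y → x ≈ y
  fromℕ-cancel n = *-cancelˡ-≈ _ (>⇒≉ (fromℕ-pos n))

  fromℕ!-pos : ∀ n → 0# < fromℕ (n !)
  fromℕ!-pos n with n ! in eq
  ... | suc m = fromℕ-pos m
  ... | zero  = ⊥-elim (ℕ.≢-nonZero⁻¹ (n !) {{ℕP._!≢0 n}} eq)

  invFactorial-step : ∀ n → fromℕ (suc n) * fromℕ (suc n !) ⁻¹ ≈ fromℕ (n !) ⁻¹
  invFactorial-step n = *-cancelˡ-≈ (fromℕ (n !)) (>⇒≉ (fromℕ!-pos n)) (begin-equality
    F * (N * G ⁻¹)  ≈⟨ solve 3 (λ F N i → F :* (N :* i) := N :* F :* i) refl F N (G ⁻¹) ⟩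
    N * F * G ⁻¹    ≈⟨ *-congʳ (fromℕ-* (suc n) (n !)) ⟨
    G * G ⁻¹        ≈⟨ ⁻¹-inverse (fromℕ!-pos (suc n)) ⟩
    1#              ≈⟨ ⁻¹-inverse (fromℕ!-pos n) ⟨
    F * F ⁻¹        ∎)
    where
    N = fromℕ (suc n)
    F = fromℕ (n !)
    G = fromℕ (suc n !)

  expTerm : ℂ → ℕ → ℂ
  expTerm z k = fromℕ (k !) ⁻¹ • z ^ᶜ k

  expTerm-exponential : ∀ z → ℂC.IsExponential z (expTerm z)
  expTerm-exponential z =
    (trans (*-identityʳ _) 1⁻¹≈1 , zeroʳ _) ,
    λ n → ℂR.trans (fromℕᶜ-* (suc n) (expTerm z (suc n))) (ℂR.trans
      (solve 2 (λ i a → i :* a := i :* a) refl _ _ , refl)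
      (step n (z ^ᶜ n)))
    where
    1⁻¹≈1 : fromℕ 1 ⁻¹ ≈ 1#
    1⁻¹≈1 = begin-equality
      fromℕ 1 ⁻¹           ≈⟨ *-identityˡ _ ⟨
      1# * fromℕ 1 ⁻¹      ≈⟨ *-congʳ (+-identityʳ 1#) ⟨
      fromℕ 1 * fromℕ 1 ⁻¹ ≈⟨ ⁻¹-inverse (fromℕ-pos 0) ⟩
      1#                   ∎
    step : ∀ n w → fromℕ (suc n) • (fromℕ (suc n !) ⁻¹ • (z *ᶜ w)) ≈ᶜ z *ᶜ (fromℕ (n !) ⁻¹ • w)
    step n (c +i d) =
      trans (solve 6 (λ N i a b c d → N :* (i :* (a :* c :- b :* d)) := a :* (N :* i :* c) :- b :* (N :* i :* d)) refl N i a b c d)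
        (+-cong (*-congˡ (*-congʳ i-step)) (-‿cong (*-congˡ (*-congʳ i-step)))) ,
      trans (solve 6 (λ N i a b c d → N :* (i :* (a :* d :+ b :* c)) := a :* (N :* i :* d) :+ b :* (N :* i :* c)) refl N i a b c d)
        (+-cong (*-congˡ (*-congʳ i-step)) (*-congˡ (*-congʳ i-step)))
      where
      a = Re z
      b = Im z
      N = fromℕ (suc n)
      i = fromℕ (suc n !) ⁻¹
      i-step = invFactorial-step n

  expTerm-unique : ∀ {z f} → ℂC.IsExponential z f → ∀ n → expTerm z n ≈ᶜ f n
  expTerm-unique {z} = ℂC.exponential-unique fromℕᶜ-cancel (expTerm-exponential z)

  -- The majorant tⁿ/n!, built directly from the recurrence rather than from powers and factorials.
  realTerm : ℝ → ℕ → ℝ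
  realTerm t zero    = 1#
  realTerm t (suc n) = fromℕ (suc n) ⁻¹ * t * realTerm t n

  realTerm-exponential : ∀ t → ℝC.IsExponential t (realTerm t)
  realTerm-exponential t = refl , λ n → begin-equality
    fromℕ (suc n) * (fromℕ (suc n) ⁻¹ * t * realTerm t n)
      ≈⟨ solve 4 (λ N i t e → N :* (i :* t :* e) := N :* i :* (t :* e)) refl _ _ t (realTerm t n) ⟩
    fromℕ (suc n) * fromℕ (suc n) ⁻¹ * (t * realTerm t n)
      ≈⟨ *-congʳ (⁻¹-inverse (fromℕ-pos n)) ⟩
    1# * (t * realTerm t n)
      ≈⟨ *-identityˡ _ ⟩
    t * realTerm t n ∎

  realTerm-nonNeg : ∀ {t} → 0# ≤ t → ∀ n → 0# ≤ realTerm t n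
  realTerm-nonNeg 0≤t zero    = proj₁ 0<1
  realTerm-nonNeg 0≤t (suc n) =
    *-nonNeg (*-nonNeg (proj₁ (⁻¹-pos (fromℕ-pos n))) 0≤t) (realTerm-nonNeg 0≤t n)

  expTerm-ofReal : ∀ t n → expTerm (t +i 0#) n ≈ᶜ (realTerm t n +i 0#)
  expTerm-ofReal t = expTerm-unique ((refl , refl) , λ n → ℂR.trans (fromℕᶜ-* (suc n) (realTerm t (suc n) +i 0#)) (
    trans (proj₂ (realTerm-exponential t) n) (solve 2 (λ t e → t :* e := t :* e :- :0 :* :0) refl t (realTerm t n)) ,
    solve 3 (λ N t e → N :* :0 := t :* :0 :+ :0 :* e) refl (fromℕ (suc n)) t (realTerm t n)))

  expTerm-dominated : ∀ {z t} → ∣ z ∣≤ t → ∀ n → ∣ expTerm z n ∣≤ realTerm t n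
  expTerm-dominated {z} z≤t zero =
    ∣∣≤-cong (ℂR.sym (proj₁ (expTerm-exponential z))) refl
      (proj₁ 0<1 , ≤-reflexive (solve 0 (:1 :* :1 :+ :0 :* :0 := :1 :* :1) refl))
  expTerm-dominated {z} {t} z≤t (suc n) =
    ∣∣≤-cong (ℂR.sym recurrence) refl (∣∣≤-* (∣∣≤-* i≤i z≤t) (expTerm-dominated z≤t n))
    where
    i = fromℕ (suc n) ⁻¹
    i≤i : ∣ i +i 0# ∣≤ i
    i≤i = proj₁ (⁻¹-pos (fromℕ-pos n)) , ≤-reflexive (solve 1 (λ i → i :* i :+ :0 :* :0 := i :* i) refl i)
    recurrence : expTerm z (suc n) ≈ᶜ (i +i 0#) *ᶜ z *ᶜ expTerm z n
    recurrence = fromℕᶜ-cancel n (ℂR.trans (proj₂ (expTerm-exponential z) n) (ℂR.sym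
      (ℂR.trans (ℂR.*-congʳ (fromℕᶜ (suc n)))
      (ℂR.trans (ℂI.*-interchange₃ (fromℕ (suc n) +i 0#) (i +i 0#) z (expTerm z n))
      (ℂR.trans (ℂR.*-congʳ (ℂR.trans (ofReal-* (fromℕ (suc n)) (i +i 0#)) (⁻¹-inverse (fromℕ-pos n) , zeroʳ _)))
        (ℂR.*-identityˡ _))))))

  psum-mono : ∀ {f} → (∀ n → 0# ≤ f n) → ∀ {m n} → m ℕ.≤ n → psum f m ≤ psum f n
  psum-mono {f} 0≤f = monotone (λ n → ≤-by (f n) (0≤f n) refl)

  tail-dominated : ∀ {f F} → (∀ n → ∣ f n ∣≤ F n) → ∀ {m n} → m ℕ.≤ n →
    ∣ psumᶜ f n +ᶜ -ᶜ psumᶜ f m ∣≤ psum F n - psum F m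
  tail-dominated {f} {F} f≤F {m} m≤n = go (ℕP.≤⇒≤′ m≤n)
    where
    go : ∀ {n} → m ℕ.≤′ n → ∣ psumᶜ f n +ᶜ -ᶜ psumᶜ f m ∣≤ psum F n - psum F m
    go (ℕ.≤′-reflexive ≡.refl) = ∣∣≤-cong (ℂR.sym (ℂR.-‿inverseʳ (psumᶜ f m))) (sym (-‿inverseʳ (psum F m))) ∣∣≤-0
    go {suc n} (ℕ.≤′-step m≤n) = ∣∣≤-cong
      (ℂI.x-y+z≈x+z-y (psumᶜ f n) (psumᶜ f m) (f n))
      (solve 3 (λ a b c → a :- b :+ c := a :+ c :- b) refl (psum F n) (psum F m) (F n))
      (∣∣≤-+ (go m≤n) (f≤F n))

  conv-dominated : ∀ {f g F G} → (∀ n → ∣ f n ∣≤ F n) → ∀ n → (∀ {m} → m ℕ.≤ n → ∣ g m ∣≤ G m) →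
    ∣ ℂC.conv f g n ∣≤ ℝC.conv F G n
  conv-dominated f≤F zero    g≤G = ∣∣≤-* (f≤F 0) (g≤G ℕP.≤-refl)
  conv-dominated f≤F (suc n) g≤G =
    ∣∣≤-+ (∣∣≤-* (f≤F 0) (g≤G ℕP.≤-refl)) (conv-dominated (λ i → f≤F (suc i)) n (λ m≤n → g≤G (ℕP.m≤n⇒m≤1+n m≤n)))

  -- For i < m the index m + n - i is at least n, so monotonicity of G bounds each f i * G n by a
  -- term of the convolution; the other terms are nonnegative. With G a sequence of partial sums, a
  -- product of partial sums lies below a later partial sum of the Cauchy product.
  product≤conv : ∀ {f G} → (∀ n → 0# ≤ f n) → (∀ n → 0# ≤ G n) → (∀ {m n} → m ℕ.≤ n → G m ≤ G n) →
    ∀ m n → psum f m * G n ≤ ℝC.conv f G (m ℕ.+ n)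
  product≤conv {f} {G} 0≤f 0≤G G-mono zero n = ≈-≤-trans (zeroˡ _) (conv-nonNeg f 0≤f n)
    where
    conv-nonNeg : ∀ f → (∀ n → 0# ≤ f n) → ∀ n → 0# ≤ ℝC.conv f G n
    conv-nonNeg f 0≤f zero    = *-nonNeg (0≤f 0) (0≤G 0)
    conv-nonNeg f 0≤f (suc n) = +-nonNeg (*-nonNeg (0≤f 0) (0≤G (suc n))) (conv-nonNeg (f ∘ suc) (λ i → 0≤f (suc i)) n)
  product≤conv {f} {G} 0≤f 0≤G G-mono (suc m) n = begin
    psum f (suc m) * G n                     ≈⟨ *-congʳ (ℝC.psum-head f m) ⟩
    (f 0 + psum (f ∘ suc) m) * G n           ≈⟨ distribʳ _ _ _ ⟩
    f 0 * G n + psum (f ∘ suc) m * G n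
      ≤⟨ +-mono-≤ (*-monoˡ-≤ (f 0) (0≤f 0) (G-mono (ℕP.m≤n+m n (suc m)))) (product≤conv (λ i → 0≤f (suc i)) 0≤G G-mono m n) ⟩
    f 0 * G (suc m ℕ.+ n) + ℝC.conv (f ∘ suc) G (m ℕ.+ n) ∎

  -- Once n exceeds 2t, each term is at most half its predecessor, so `B n`, which adds twice the
  -- next term to the partial sum, no longer increases.
  realSeries-bounded : ∀ {t} → 0# ≤ t → ∃ λ b → ∀ n → psum (realTerm t) n ≤ b
  realSeries-bounded {t} 0≤t = B M , λ n → begin
    S n              ≤⟨ psum-mono (realTerm-nonNeg 0≤t) (ℕP.m≤m+n n M) ⟩
    S (n ℕ.+ M)      ≤⟨ ≤-by (2# * e (n ℕ.+ M)) (*-nonNeg (proj₁ 0<2) (realTerm-nonNeg 0≤t (n ℕ.+ M))) refl ⟩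
    B (n ℕ.+ M)      ≤⟨ B-decreasing n ⟩
    B M              ∎
    where
    e = realTerm t
    S = psum e
    M = proj₁ (archimedean (2# * t))
    B : ℕ → ℝ
    B n = S n + 2# * e n
    halving : ∀ n → M ℕ.≤ n → 2# * e (suc n) ≤ e n
    halving n M≤n = *-cancelˡ-≤ (fromℕ (suc n)) (fromℕ-pos n) (begin
      fromℕ (suc n) * (2# * e (suc n)) ≈⟨ solve 2 (λ N e → N :* ((:1 :+ :1) :* e) := (:1 :+ :1) :* (N :* e)) refl _ _ ⟩
      2# * (fromℕ (suc n) * e (suc n)) ≈⟨ *-congˡ (proj₂ (realTerm-exponential t) n) ⟩
      2# * (t * e n)                   ≈⟨ *-assoc _ _ _ ⟨
      2# * t * e n                     ≤⟨ *-monoʳ-≤ (e n) (realTerm-nonNeg 0≤t n) (≤-trans (proj₁ (proj₂ (archimedean (2# * t)))) (fromℕ-mono (ℕP.m≤n⇒m≤1+n M≤n))) ⟩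
      fromℕ (suc n) * e n              ∎)
    B-decreasing : ∀ n → B (n ℕ.+ M) ≤ B M
    B-decreasing zero    = ≤-refl
    B-decreasing (suc n) = begin
      S k + e k + 2# * e (suc k) ≤⟨ +-monoʳ-≤ _ (halving k (ℕP.m≤n+m M n)) ⟩
      S k + e k + e k            ≈⟨ solve 2 (λ S e → S :+ e :+ e := S :+ (:1 :+ :1) :* e) refl (S k) (e k) ⟩
      B k                        ≤⟨ B-decreasing n ⟩
      B M                        ∎
      where k = n ℕ.+ M

  realSeries-converges : ∀ {t} → 0# ≤ t → ∃ (psum (realTerm t) ⟶_)
  realSeries-converges {t} 0≤t = monotone-convergence
    (λ n → ≤-by (realTerm t n) (realTerm-nonNeg 0≤t n) refl) (proj₂ (realSeries-bounded 0≤t))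

  private
    -- Absolute convergence without Cauchy sequences: adding the majorant makes all terms
    -- nonnegative, so the sum of both series converges by monotonicity, and the majorant is
    -- subtracted again.
    dominated-converges : ∀ {t} → 0# ≤ t → {f : ℕ → ℝ} →
      (∀ n → - realTerm t n ≤ f n) → (∀ n → f n ≤ realTerm t n) → ∃ (psum f ⟶_)
    dominated-converges {t} 0≤t {f} -e≤f f≤e = _ , ⟶-cong
      (λ n → solve 2 (λ a b → a :+ b :- b := a) refl (psum f n) (psum (realTerm t) n)) refl
      (⟶-- (proj₂ sum-converges) (proj₂ (realSeries-converges 0≤t)))
      where
      e = realTerm t
      b = proj₁ (realSeries-bounded 0≤t)
      psum≤ : ∀ n → psum f n ≤ psum e n
      psum≤ zero    = ≤-refl
      psum≤ (suc n) = +-mono-≤ (psum≤ n) (f≤e n)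
      sum-converges : ∃ ((λ n → psum f n + psum e n) ⟶_)
      sum-converges = monotone-convergence {b = b + b}
        (λ n → ≤-by (f n - - e n) (≤⇒0≤- (-e≤f n))
          (solve 4 (λ a b f e → (a :+ f) :+ (b :+ e) := (a :+ b) :+ (f :- :- e)) refl (psum f n) (psum e n) (f n) (e n)))
        (λ n → +-mono-≤ (≤-trans (psum≤ n) (proj₂ (realSeries-bounded 0≤t) n)) (proj₂ (realSeries-bounded 0≤t) n))

    Re-psum : ∀ f n → Re (psumᶜ f n) ≈ psum (λ k → Re (f k)) n
    Re-psum f zero    = refl
    Re-psum f (suc n) = +-congʳ (Re-psum f n)

    Im-psum : ∀ f n → Im (psumᶜ f n) ≈ psum (λ k → Im (f k)) n
    Im-psum f zero    = refl
    Im-psum f (suc n) = +-congʳ (Im-psum f n)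

  expPartialSum-psum : ∀ z n → expPartialSum z n ≈ᶜ psumᶜ (expTerm z) n
  expPartialSum-psum z n = ℂC.sum-toℕ (expTerm z) n

  private
    ⟶-lim : ∀ {s} t → (∀ n → t n ≈ s n) → ∃ (s ⟶_) → s ⟶ lim t
    ⟶-lim t t≈s (l , s⟶l) = ⟶-cong (λ _ → refl) (sym (lim-≈ (⟶-cong (λ n → sym (t≈s n)) refl s⟶l))) s⟶l

    dominated-by-realSeries : ∀ {t} → 0# ≤ t → (s f : ℕ → ℝ) → (∀ n → s n ≈ psum f n) →
      (∀ n → (- realTerm t n ≤ f n) × (f n ≤ realTerm t n)) → ∃ (s ⟶_)
    dominated-by-realSeries 0≤t s f s≈psum bound = proj₁ f-converges , ⟶-cong (λ n → sym (s≈psum n)) refl (proj₂ f-converges)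
      where
      f-converges = dominated-converges 0≤t {f} (λ n → proj₁ (bound n)) (λ n → proj₂ (bound n))

  expSeries-converges : ∀ z → psumᶜ (expTerm z) ⟶ᶜ cexp z
  expSeries-converges z =
    ⟶-lim (λ n → Re (expPartialSum z n)) (λ n → proj₁ (expPartialSum-psum z n))
      (dominated-by-realSeries (proj₁ z≤t) (λ n → Re (psumᶜ (expTerm z) n)) (λ n → Re (expTerm z n))
        (Re-psum (expTerm z)) (λ n → ∣∣≤⇒Re (e≤ n))) ,
    ⟶-lim (λ n → Im (expPartialSum z n)) (λ n → proj₂ (expPartialSum-psum z n))
      (dominated-by-realSeries (proj₁ z≤t) (λ n → Im (psumᶜ (expTerm z) n)) (λ n → Im (expTerm z n))
        (Im-psum (expTerm z)) (λ n → ∣∣≤⇒Im (e≤ n)))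
    where
    z≤t = proj₂ (∣∣≤-exists z)
    e≤ = expTerm-dominated z≤t

  cexp-cong : ∀ {z w} → z ≈ᶜ w → cexp z ≈ᶜ cexp w
  cexp-cong {z} {w} z≈w = ⟶ᶜ-unique (expSeries-converges z)
    (⟶ᶜ-cong (λ n → ℂC.psum-cong (λ k → *-congˡ (proj₁ (^ᶜ-congˡ k (ℂR.sym z≈w))) , *-congˡ (proj₂ (^ᶜ-congˡ k (ℂR.sym z≈w)))) n) ℂR.refl (expSeries-converges w))

  -- The defect `D n` between the product of partial sums and the partial sum of the Cauchy product
  -- is dominated by the same defect `Dʳ n` for the real majorants. Nonnegative terms confine the
  -- latter between 0 and S (2n + 1) - S n, where S are the partial sums of the convergent series of
  -- exp (a + b).
  cexp-+ : ∀ z w → cexp (z +ᶜ w) ≈ᶜ cexp z *ᶜ cexp w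
  cexp-+ z w = ⟶ᶜ-unique (expSeries-converges (z +ᶜ w)) (⟶ᶜ-cong difference
    (ℂI.x-0≈x (cexp z *ᶜ cexp w))
    (⟶ᶜ-+ (⟶ᶜ-* (⟶ᶜ-reindex suc ℕP.n≤1+n (expSeries-converges z)) (expSeries-converges w))
      (⟶-neg (Null⇒⟶0 (Null-dominated (λ n → ∣∣≤⇒Re (D-dominated n)) Dʳ-null)) ,
       ⟶-neg (Null⇒⟶0 (Null-dominated (λ n → ∣∣≤⇒Im (D-dominated n)) Dʳ-null)))))
    where
    a = proj₁ (∣∣≤-exists z)
    b = proj₁ (∣∣≤-exists w)
    z≤a = proj₂ (∣∣≤-exists z)
    w≤b = proj₂ (∣∣≤-exists w)
    D : ℕ → ℂ
    D n = ℂC.conv (expTerm z) (λ j → psumᶜ (expTerm w) n +ᶜ -ᶜ psumᶜ (expTerm w) j) n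
    Dʳ : ℕ → ℝ
    Dʳ n = ℝC.conv (realTerm a) (λ j → psum (realTerm b) n - psum (realTerm b) j) n
    S = psum (realTerm (a + b))
    D-dominated : ∀ n → ∣ D n ∣≤ Dʳ n
    D-dominated n = conv-dominated (expTerm-dominated z≤a) n (tail-dominated (expTerm-dominated w≤b))
    difference : ∀ n → psumᶜ (expTerm z) (suc n) *ᶜ psumᶜ (expTerm w) n +ᶜ -ᶜ D n ≈ᶜ psumᶜ (expTerm (z +ᶜ w)) n
    difference n = ℂR.trans (ℂR.+-congʳ (ℂC.product-of-partial-sums (expTerm z) (expTerm w) n))
      (ℂR.trans (ℂI.x+y-x≈y (D n) _)
      (ℂC.psum-cong (λ k → ℂR.sym (expTerm-unique (ℂC.conv-exponential (expTerm-exponential z) (expTerm-exponential w)) k)) n))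
    Dʳ≈ : ∀ n → psum (realTerm a) (suc n) * psum (realTerm b) n ≈ Dʳ n + S n
    Dʳ≈ n = trans (ℝC.product-of-partial-sums (realTerm a) (realTerm b) n) (+-congˡ (ℝC.psum-cong conv≈ n))
      where
      conv≈ : ∀ k → ℝC.conv (realTerm a) (realTerm b) k ≈ realTerm (a + b) k
      conv≈ = ℝC.exponential-unique fromℕ-cancel
        (ℝC.conv-exponential (realTerm-exponential a) (realTerm-exponential b)) (realTerm-exponential (a + b))
    Dʳ≤ : ∀ n → Dʳ n ≤ S (suc n ℕ.+ n) - S n
    Dʳ≤ n = begin
      Dʳ n             ≈⟨ solve 2 (λ d s → d := d :+ s :- s) refl (Dʳ n) (S n) ⟩
      Dʳ n + S n - S n ≈⟨ +-congʳ (Dʳ≈ n) ⟨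
      psum (realTerm a) (suc n) * psum (realTerm b) n - S n
        ≤⟨ +-monoˡ-≤ (- S n) (product≤conv (realTerm-nonNeg (proj₁ z≤a)) (λ m → psum-mono (realTerm-nonNeg (proj₁ w≤b)) {0} {m} ℕ.z≤n) (psum-mono (realTerm-nonNeg (proj₁ w≤b))) (suc n) n) ⟩
      ℝC.conv (realTerm a) (psum (realTerm b)) (suc n ℕ.+ n) - S n
        ≈⟨ +-congʳ (ℝC.conv-psum (realTerm a) (realTerm b) (suc n ℕ.+ n)) ⟩
      psum (ℝC.conv (realTerm a) (realTerm b)) (suc n ℕ.+ n) - S n
        ≈⟨ +-congʳ (ℝC.psum-cong (ℝC.exponential-unique fromℕ-cancel
        (ℝC.conv-exponential (realTerm-exponential a) (realTerm-exponential b)) (realTerm-exponential (a + b))) (suc n ℕ.+ n)) ⟩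
      S (suc n ℕ.+ n) - S n ∎
    Dʳ-null : Null Dʳ
    Dʳ-null = Null-dominated
      -- Nonnegativity of `Dʳ n` is part of the modulus bound on `D n`.
      (λ n → ≤-trans (≤-≈-trans (neg-mono-≤ (S-increasing n)) (solve 0 (:- :0 := :0) refl)) (proj₁ (D-dominated n)) , Dʳ≤ n)
      (⟶0⇒Null (⟶-cong (λ _ → refl) (-‿inverseʳ l) (⟶-- (⟶-reindex (λ n → suc n ℕ.+ n) (λ n → ℕP.m≤n+m n (suc n)) S⟶l) S⟶l)))
      where
      0≤a+b = +-nonNeg (proj₁ z≤a) (proj₁ w≤b)
      l = proj₁ (realSeries-converges 0≤a+b)
      S⟶l = proj₂ (realSeries-converges 0≤a+b)
      S-increasing : ∀ n → 0# ≤ S (suc n ℕ.+ n) - S n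
      S-increasing n = ≤⇒0≤- (psum-mono (realTerm-nonNeg 0≤a+b) (ℕP.m≤n+m n (suc n)))

  -- The conjugated terms satisfy the recurrence for `conj z`, hence are its terms. This is what
  -- gives exp (iy) modulus 1.
  cexp-conj : ∀ z → cexp (conj z) ≈ᶜ conj (cexp z)
  cexp-conj z = ⟶ᶜ-unique (expSeries-converges (conj z))
    (⟶ᶜ-cong (λ n → ℂR.sym (ℂR.trans (ℂC.psum-cong term n) (psum-conj (expTerm z) n))) ℂR.refl
      (proj₁ (expSeries-converges z) , ⟶-neg (proj₂ (expSeries-converges z))))
    where
    psum-conj : ∀ f n → psumᶜ (λ k → conj (f k)) n ≈ᶜ conj (psumᶜ f n)
    psum-conj f zero    = refl , solve 0 (:0 := :- :0) refl
    psum-conj f (suc n) = ℂR.trans (ℂR.+-congʳ (psum-conj f n)) (ℂR.sym (conj-+ (psumᶜ f n) (f n)))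
    term : ∀ n → expTerm (conj z) n ≈ᶜ conj (expTerm z n)
    term = expTerm-unique
      ( ℂR.trans (conj-cong (proj₁ (expTerm-exponential z))) (refl , solve 0 (:- :0 := :0) refl)
      , λ n → ℂR.trans (fromℕᶜ-* (suc n) (conj (expTerm z (suc n)))) (ℂR.trans
          (refl , solve 2 (λ N e → N :* :- e := :- (N :* e)) refl (fromℕ (suc n)) (Im (expTerm z (suc n)))) (ℂR.trans
          (conj-cong (ℂR.trans (ℂR.sym (fromℕᶜ-* (suc n) (expTerm z (suc n)))) (proj₂ (expTerm-exponential z) n)))
          (conj-* z (expTerm z n)))))

  exp-converges : ∀ t → psum (realTerm t) ⟶ exp t
  exp-converges t = ⟶-cong (λ n → trans (Re-psum (expTerm (t +i 0#)) n) (ℝC.psum-cong (λ k → proj₁ (expTerm-ofReal t k)) n))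
    refl (proj₁ (expSeries-converges (t +i 0#)))

  cexp-ofReal : ∀ t → cexp (t +i 0#) ≈ᶜ (exp t +i 0#)
  cexp-ofReal t = refl , ⟶-unique (proj₂ (expSeries-converges (t +i 0#)))
    (⟶-cong (λ n → sym (trans (Im-psum (expTerm (t +i 0#)) n) (trans (ℝC.psum-cong (λ k → proj₂ (expTerm-ofReal t k)) n) (psum-0 n)))) refl (⟶-const 0#))
    where
    psum-0 : ∀ n → psum (λ _ → 0#) n ≈ 0#
    psum-0 zero    = refl
    psum-0 (suc n) = trans (+-identityʳ _) (psum-0 n)

  exp-cong : ∀ {s t} → s ≈ t → exp s ≈ exp t
  exp-cong s≈t = proj₁ (cexp-cong (ofReal-cong s≈t))

  exp-+ : ∀ s t → exp (s + t) ≈ exp s * exp t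
  exp-+ s t = begin-equality
    exp (s + t)
      ≈⟨ proj₁ (cexp-cong {s + t +i 0#} {(s +i 0#) +ᶜ (t +i 0#)} (refl , sym (+-identityʳ 0#))) ⟩
    Re (cexp ((s +i 0#) +ᶜ (t +i 0#)))
      ≈⟨ proj₁ (cexp-+ (s +i 0#) (t +i 0#)) ⟩
    Re (cexp (s +i 0#) *ᶜ cexp (t +i 0#))
      ≈⟨ proj₁ (ℂR.*-cong (cexp-ofReal s) (cexp-ofReal t)) ⟩
    exp s * exp t - 0# * 0#
      ≈⟨ solve 2 (λ s t → s :* t :- :0 :* :0 := s :* t) refl (exp s) (exp t) ⟩
    exp s * exp t ∎

-- Convexity of the exponential, logarithm, real powers and the absolute value.

module RealPowers (em : ExcludedMiddle 0ℓ) (R : CompleteOrderedField) where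

  open OrderedField em R
  open Limits em R
  open ComplexNumbers em R
  open ExponentialSeries em R
  open PosetReasoning ≤-poset

  private
    1+t≤exp-nonNeg : ∀ {t} → 0# ≤ t → 1# + t ≤ exp t
    1+t≤exp-nonNeg {t} 0≤t = ⟶-≤ bound (⟶-const (1# + t))
      (⟶-reindex (λ n → 2 ℕ.+ n) (λ n → ℕP.m≤n+m n 2) (exp-converges t))
      where
      linear : 1# + t ≈ ℝC.psum (realTerm t) 2
      linear = begin-equality
        1# + t                    ≈⟨ +-congˡ (*-identityʳ t) ⟨
        1# + t * 1#               ≈⟨ +-congˡ (proj₂ (realTerm-exponential t) 0) ⟨
        1# + fromℕ 1 * realTerm t 1
          ≈⟨ solve 1 (λ e → :1 :+ (:1 :+ :0) :* e := :0 :+ :1 :+ e) refl (realTerm t 1) ⟩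
        0# + 1# + realTerm t 1    ∎
      bound : ∀ n → 1# + t ≤ ℝC.psum (realTerm t) (2 ℕ.+ n)
      bound n = ≈-≤-trans linear (psum-mono (realTerm-nonNeg 0≤t) (ℕP.m≤m+n 2 n))

  exp-0 : exp 0# ≈ 1#
  exp-0 = *-cancelˡ-≈ (exp 0#) (>⇒≉ 0<exp0) (begin-equality
    exp 0# * exp 0#  ≈⟨ exp-+ 0# 0# ⟨
    exp (0# + 0#)    ≈⟨ exp-cong (+-identityʳ 0#) ⟩
    exp 0#           ≈⟨ *-identityʳ _ ⟨
    exp 0# * 1#      ∎)
    where
    0<exp0 : 0# < exp 0#
    0<exp0 = <-≤-trans 0<1 (≈-≤-trans (sym (+-identityʳ 1#)) (1+t≤exp-nonNeg ≤-refl))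

  exp-neg : ∀ t → exp t * exp (- t) ≈ 1#
  exp-neg t = begin-equality
    exp t * exp (- t) ≈⟨ exp-+ t (- t) ⟨
    exp (t - t)       ≈⟨ exp-cong (-‿inverseʳ t) ⟩
    exp 0#            ≈⟨ exp-0 ⟩
    1#                ∎

  -- A square, exp (t/2)², which cannot vanish because exp (t/2) has the inverse exp (-t/2).
  exp-pos : ∀ t → 0# < exp t
  exp-pos t = <-≈-trans (sq-nonNeg s , λ 0≈ss → 0≉1 (begin-equality
    0#                        ≈⟨ zeroˡ _ ⟨
    0# * (s⁻ * s⁻)            ≈⟨ *-congʳ 0≈ss ⟩
    s * s * (s⁻ * s⁻)         ≈⟨ solve 2 (λ s r → s :* s :* (r :* r) := s :* r :* (s :* r)) refl s s⁻ ⟩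
    s * s⁻ * (s * s⁻)         ≈⟨ *-cong (exp-neg (half t)) (exp-neg (half t)) ⟩
    1# * 1#                   ≈⟨ *-identityʳ 1# ⟩
    1#                        ∎)) (trans (sym (exp-+ (half t) (half t))) (exp-cong (half+half t)))
    where
    s = exp (half t)
    s⁻ = exp (- half t)

  private
    -- Comparison with the geometric series: the ratio of consecutive terms is at most t, which
    -- keeps (1 - t) S n + e n from growing. It supplies the tangent inequality at negative
    -- arguments.
    [1-t]exp≤1 : ∀ {t} → 0# ≤ t → t ≤ 1# → (1# - t) * exp t ≤ 1#
    [1-t]exp≤1 {t} 0≤t t≤1 = ⟶-≤ (λ n → ≤-trans (≤-by (e n) (realTerm-nonNeg 0≤t n) refl) (invariant n))
      (⟶-* (⟶-const (1# - t)) (exp-converges t)) (⟶-const 1#)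
      where
      e = realTerm t
      S = ℝC.psum e
      ratio : ∀ n → e (suc n) ≤ t * e n
      ratio n = begin
        e (suc n)                  ≤⟨ ≤-by (fromℕ n * e (suc n)) (*-nonNeg (fromℕ-nonNeg n) (realTerm-nonNeg 0≤t (suc n))) (solve 2 (λ N e → (:1 :+ N) :* e := e :+ N :* e) refl _ _) ⟩
        fromℕ (suc n) * e (suc n)  ≈⟨ proj₂ (realTerm-exponential t) n ⟩
        t * e n                    ∎
      invariant : ∀ n → (1# - t) * S n + e n ≤ 1#
      invariant zero    = ≤-reflexive (solve 1 (λ t → (:1 :- t) :* :0 :+ :1 := :1) refl t)
      invariant (suc n) = begin
        (1# - t) * (S n + e n) + e (suc n)  ≤⟨ +-monoʳ-≤ _ (ratio n) ⟩
        (1# - t) * (S n + e n) + t * e n    ≈⟨ solve 3 (λ t S e → (:1 :- t) :* (S :+ e) :+ t :* e := (:1 :- t) :* S :+ e) refl t (S n) (e n) ⟩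
        (1# - t) * S n + e n                ≤⟨ invariant n ⟩
        1#                                  ∎

  -- Between -1 and 0 the inequality is multiplied by exp (-t). Tangents, monotonicity, convexity
  -- and surjectivity of `exp` are all drawn from it by means of the functional equation.
  1+t≤exp : ∀ t → 1# + t ≤ exp t
  1+t≤exp t with ≤-total 0# t | ≤-total (1# + t) 0#
  ... | inj₁ 0≤t | _          = 1+t≤exp-nonNeg 0≤t
  ... | inj₂ _   | inj₁ 1+t≤0 = ≤-trans 1+t≤0 (proj₁ (exp-pos t))
  ... | inj₂ t≤0 | inj₂ 0≤1+t = *-cancelˡ-≤ (exp k) (exp-pos k) (begin
    exp k * (1# + t)  ≈⟨ solve 2 (λ E t → E :* (:1 :+ t) := (:1 :- (:- t)) :* E) refl (exp k) t ⟩
    (1# - k) * exp k  ≤⟨ [1-t]exp≤1 0≤k k≤1 ⟩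
    1#                ≈⟨ exp-neg t ⟨
    exp t * exp k     ≈⟨ *-comm _ _ ⟩
    exp k * exp t     ∎)
    where
    k = - t
    0≤k : 0# ≤ k
    0≤k = ≤-by (0# - t) (≤⇒0≤- t≤0) (solve 1 (λ t → :- t := :0 :+ (:0 :- t)) refl t)
    k≤1 : k ≤ 1#
    k≤1 = ≤-by (1# + t) 0≤1+t (solve 1 (λ t → :1 := :- t :+ (:1 :+ t)) refl t)

  exp-tangent : ∀ m t → exp m * (1# + (t - m)) ≤ exp t
  exp-tangent m t = begin
    exp m * (1# + (t - m))  ≤⟨ *-monoˡ-≤ (exp m) (proj₁ (exp-pos m)) (1+t≤exp (t - m)) ⟩
    exp m * exp (t - m)     ≈⟨ exp-+ m (t - m) ⟨
    exp (m + (t - m))       ≈⟨ exp-cong (solve 2 (λ m t → m :+ (t :- m) := t) refl m t) ⟩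
    exp t                   ∎

  exp-mono-≤ : ∀ {s t} → s ≤ t → exp s ≤ exp t
  exp-mono-≤ {s} {t} s≤t = ≤-trans
    (≤-by (exp s * (t - s)) (*-nonNeg (proj₁ (exp-pos s)) (≤⇒0≤- s≤t)) (solve 3 (λ E s t → E :* (:1 :+ (t :- s)) := E :+ E :* (t :- s)) refl (exp s) s t))
    (exp-tangent s t)

  exp-mono-< : ∀ {s t} → s < t → exp s < exp t
  exp-mono-< {s} {t} s<t = <-≤-trans
    (<-by (exp s * (t - s)) (*-pos (exp-pos s) (<⇒0<- s<t)) (solve 3 (λ E s t → E :* (:1 :+ (t :- s)) := E :+ E :* (t :- s)) refl (exp s) s t))
    (exp-tangent s t)

  exp-cancel-≤ : ∀ {s t} → exp s ≤ exp t → s ≤ t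
  exp-cancel-≤ es≤et = ≮⇒≥ λ t<s → <⇒≱ (exp-mono-< t<s) es≤et

  exp-cancel-< : ∀ {s t} → exp s < exp t → s < t
  exp-cancel-< es<et = exp-cancel-≤ (proj₁ es<et) , λ s≈t → proj₂ es<et (exp-cong s≈t)

  exp-injective : ∀ {s t} → exp s ≈ exp t → s ≈ t
  exp-injective es≈et = ≤-antisym (exp-cancel-≤ (≤-reflexive es≈et)) (exp-cancel-≤ (≤-reflexive (sym es≈et)))

  -- The tangent at the weighted mean m lies below the graph at s and at t; in the weighted sum of
  -- the two inequalities the linear terms cancel.
  exp-convex : ∀ {p} → 0# ≤ p → p ≤ 1# → ∀ s t → exp (p * s + (1# - p) * t) ≤ p * exp s + (1# - p) * exp t
  exp-convex {p} 0≤p p≤1 s t = begin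
    exp m
      ≈⟨ solve 4 (λ E p s t → E := p :* (E :* (:1 :+ (s :- (p :* s :+ (:1 :- p) :* t)))) :+ (:1 :- p) :* (E :* (:1 :+ (t :- (p :* s :+ (:1 :- p) :* t))))) refl (exp m) p s t ⟩
    p * (exp m * (1# + (s - m))) + (1# - p) * (exp m * (1# + (t - m)))
      ≤⟨ +-mono-≤ (*-monoˡ-≤ p 0≤p (exp-tangent m s)) (*-monoˡ-≤ (1# - p) (≤⇒0≤- p≤1) (exp-tangent m t)) ⟩
    p * exp s + (1# - p) * exp t ∎
    where m = p * s + (1# - p) * t

  -- The supremum of the y with exp y ≤ x. Instead of continuity, tangents provide an explicit step
  -- h that contradicts the supremum whenever exp s differs from x.
  exp-surjective : ∀ {x} → 0# < x → ∃ λ y → exp y ≈ x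
  exp-surjective {x} 0<x = s , ≤-antisym exp-s≤x x≤exp-s
    where
    Below : ℝ → Set
    Below y = exp y ≤ x
    -- The set is nonempty because exp (1/x) ≥ 1/x; it is bounded by x because y ≤ exp y.
    below : Below (- x ⁻¹)
    below = *-cancelˡ-≤ (exp (x ⁻¹)) (exp-pos _) (begin
      exp (x ⁻¹) * exp (- x ⁻¹)  ≈⟨ exp-neg (x ⁻¹) ⟩
      1#                         ≈⟨ ⁻¹-inverse 0<x ⟨
      x * x ⁻¹                   ≤⟨ *-monoˡ-≤ x (proj₁ 0<x) (≤-trans (≤-by 1# (proj₁ 0<1) (+-comm _ _)) (1+t≤exp (x ⁻¹))) ⟩
      x * exp (x ⁻¹)             ≈⟨ *-comm _ _ ⟩
      exp (x ⁻¹) * x             ∎)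
    sup = supremum Below (_ , below) (x , λ {y} ey≤x → ≤-trans (≤-by 1# (proj₁ 0<1) (+-comm 1# y)) (≤-trans (1+t≤exp y) ey≤x))
    s = proj₁ sup
    exp-s≤x : exp s ≤ x
    exp-s≤x = ≮⇒≥ λ x<es →
      let E  = exp s
          -- The Newton step from s: the tangent at s takes the value x at s - h, so exp (s - h) ≥ x
          -- and s - h is already an upper bound.
          h  = 1# - x * E ⁻¹
          0<h : 0# < h
          0<h = *-cancelˡ-< E (proj₁ (exp-pos s)) (begin-strict
            E * 0#               ≈⟨ zeroʳ E ⟩
            0#                   <⟨ <⇒0<- x<es ⟩
            E - x                ≈⟨ solve 2 (λ E x → E :- x := E :- x :* :1) refl E x ⟩
            E - x * 1#           ≈⟨ +-congˡ (-‿cong (*-congˡ (⁻¹-inverse (exp-pos s)))) ⟨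
            E - x * (E * E ⁻¹)   ≈⟨ solve 3 (λ E x i → E :- x :* (E :* i) := E :* (:1 :- x :* i)) refl E x (E ⁻¹) ⟩
            E * h                ∎)
          x≤exp : x ≤ exp (s - h)
          x≤exp = begin
            x                          ≈⟨ *-identityʳ x ⟨
            x * 1#                     ≈⟨ *-congˡ (⁻¹-inverse (exp-pos s)) ⟨
            x * (E * E ⁻¹)             ≈⟨ solve 4 (λ E x i s → x :* (E :* i) := E :* (:1 :+ ((s :- (:1 :- x :* i)) :- s))) refl E x (E ⁻¹) s ⟩
            E * (1# + ((s - h) - s))   ≤⟨ exp-tangent s (s - h) ⟩
            exp (s - h)                ∎
      in <⇒≱ (<-by h 0<h (solve 2 (λ s h → s := s :- h :+ h) refl s h)) (proj₂ (proj₂ sup) (λ ey≤x → exp-cancel-≤ (≤-trans ey≤x x≤exp)))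
    x≤exp-s : x ≤ exp s
    x≤exp-s = ≮⇒≥ λ es<x →
      let E  = exp s
          -- Chosen so that 1 - h = E/x: the tangent at s + h gives exp (s + h) (1 - h) ≤ E, hence
          -- exp (s + h) ≤ x.
          h  = 1# - E * x ⁻¹
          0<h : 0# < h
          0<h = *-cancelˡ-< x (proj₁ 0<x) (begin-strict
            x * 0#               ≈⟨ zeroʳ x ⟩
            0#                   <⟨ <⇒0<- es<x ⟩
            x - E                ≈⟨ solve 2 (λ x E → x :- E := x :- E :* :1) refl x E ⟩
            x - E * 1#           ≈⟨ +-congˡ (-‿cong (*-congˡ (⁻¹-inverse 0<x))) ⟨
            x - E * (x * x ⁻¹)   ≈⟨ solve 3 (λ x E i → x :- E :* (x :* i) := x :* (:1 :- E :* i)) refl x E (x ⁻¹) ⟩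
            x * h                ∎)
          exp≤x : exp (s + h) ≤ x
          exp≤x = *-cancelˡ-≤ E (exp-pos s) (begin
            E * exp (s + h)
              ≈⟨ *-congʳ (trans (sym (*-identityʳ E)) (trans (*-congˡ (sym (⁻¹-inverse 0<x))) (solve 4 (λ x E i s → E :* (x :* i) := x :* (:1 :+ (s :- (s :+ (:1 :- E :* i))))) refl x E (x ⁻¹) s))) ⟩
            x * (1# + (s - (s + h))) * exp (s + h)
              ≈⟨ solve 3 (λ x a b → x :* a :* b := b :* a :* x) refl x _ _ ⟩
            exp (s + h) * (1# + (s - (s + h))) * x
              ≤⟨ *-monoʳ-≤ x (proj₁ 0<x) (exp-tangent (s + h) s) ⟩
            E * x ∎)
      in <⇒≱ (<-by h 0<h refl) (proj₁ (proj₂ sup) exp≤x)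

  exp-log : ∀ {x} → 0# < x → exp (log x) ≈ x
  exp-log {x} 0<x = the-satisfies (λ y → exp y ≈ x) (exp-surjective 0<x)

  log-≤ : ∀ {x y} → 0# < x → x ≤ y → log x ≤ log y
  log-≤ 0<x x≤y = exp-cancel-≤ (≈-≤-trans (exp-log 0<x) (≤-≈-trans x≤y (sym (exp-log (<-≤-trans 0<x x≤y)))))

  log-< : ∀ {x y} → 0# < x → x < y → log x < log y
  log-< 0<x x<y = exp-cancel-< (≈-<-trans (exp-log 0<x) (<-≈-trans x<y (sym (exp-log (<-trans 0<x x<y)))))

  log-exp : ∀ y → log (exp y) ≈ y
  log-exp y = exp-injective (exp-log (exp-pos y))

  log-1 : log 1# ≈ 0#
  log-1 = exp-injective (trans (exp-log 0<1) (sym exp-0))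

  ^ʳ-exp : ∀ {x} s → 0# < x → x ^ʳ s ≈ exp (s * log x)
  ^ʳ-exp {x} s 0<x with em {0# < x}
  ... | yes _   = refl
  ... | no 0≮x = ⊥-elim (0≮x 0<x)

  √-exists : ∀ {x} → 0# ≤ x → ∃ λ y → (0# ≤ y) × (y * y ≈ x)
  √-exists {x} 0≤x with ≤-or-> x 0#
  ... | inj₁ x≤0 = 0# , ≤-refl , trans (zeroʳ 0#) (≤-antisym 0≤x x≤0)
  ... | inj₂ 0<x = exp (half (log x)) , proj₁ (exp-pos _) ,
    trans (sym (exp-+ _ _)) (trans (exp-cong (half+half (log x))) (exp-log 0<x))

  abs-spec : ∀ z → (0# ≤ abs z) × (abs z * abs z ≈ normSq z)
  abs-spec z = the-satisfies (λ y → (0# ≤ y) × (y * y ≈ normSq z)) (√-exists (normSq-nonNeg z))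

  -- The conjugate of exp (iy) is exp (-iy), and their product is exp 0.
  normSq-cexp : ∀ y → normSq (cexp (0# +i y)) ≈ 1#
  normSq-cexp y = proj₁
    (ℂR.trans (ℂR.sym (z*conj-z (cexp (0# +i y))))
    (ℂR.trans (ℂR.*-congˡ (ℂR.sym (cexp-conj (0# +i y))))
    (ℂR.trans (ℂR.sym (cexp-+ (0# +i y) (conj (0# +i y))))
    (ℂR.trans (cexp-cong (+-identityʳ 0# , -‿inverseʳ y))
    (ℂR.trans (cexp-ofReal 0#) (ofReal-cong exp-0))))))

-- Residues coprime to the modulus: inverses, lifting and the Chinese remainder theorem.

module Units where

  open import Data.Nat.Base using (_+_; _*_; _<_; _≤_; _^_; _∸_)

  coprime-*ˡ : ∀ {m n d} → Coprime m d → Coprime n d → Coprime (m * n) d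
  coprime-*ˡ m⊥d n⊥d {c} (c∣mn , c∣d) = n⊥d (coprime-divisor c⊥m c∣mn , c∣d)
    where
    c⊥m : Coprime c _
    c⊥m (e∣c , e∣m) = m⊥d (e∣m , ∣.∣-trans e∣c c∣d)

  coprime-% : ∀ {m d} .{{_ : NonZero d}} → Coprime m d → Coprime (m % d) d
  coprime-% m⊥d (c∣m%d , c∣d) = m⊥d (∣.∣n∣m%n⇒∣m c∣d c∣m%d , c∣d)

  coprime-∣ʳ : ∀ {m n d} → n ∣ d → Coprime m d → Coprime m n
  coprime-∣ʳ n∣d m⊥d (c∣m , c∣n) = m⊥d (c∣m , ∣.∣-trans c∣n n∣d)

  coprime-∣ˡ : ∀ {m n d} → m ∣ n → Coprime n d → Coprime m d
  coprime-∣ˡ m∣n n⊥d (c∣m , c∣d) = n⊥d (∣.∣-trans c∣m m∣n , c∣d)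

  coprime-+* : ∀ {m d} k → Coprime m d → Coprime (m + k * d) d
  coprime-+* {m} {d} k m⊥d {c} (c∣ , c∣d) =
    m⊥d (∣.∣m+n∣m⇒∣n (subst (c ∣_) (ℕP.+-comm m (k * d)) c∣) (∣.∣n⇒∣m*n k c∣d) , c∣d)

  *-cong-% : ∀ {a b a′ b′} d .{{_ : NonZero d}} → a % d ≡ a′ % d → b % d ≡ b′ % d → (a * b) % d ≡ (a′ * b′) % d
  *-cong-% {a} {b} {a′} {b′} d a≡a′ b≡b′ = begin
    (a * b) % d                ≡⟨ %-distribˡ-* a b d ⟩
    (a % d * (b % d)) % d      ≡⟨ ≡.cong₂ (λ x y → (x * y) % d) a≡a′ b≡b′ ⟩
    (a′ % d * (b′ % d)) % d    ≡⟨ %-distribˡ-* a′ b′ d ⟨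
    (a′ * b′) % d              ∎
    where open ≡-Reasoning

  -- If x a ≡ −1, then x a x is an inverse of a.
  inverse : ∀ {a d} .{{_ : NonZero d}} → Coprime a d → ∃ λ b → (b * a) % d ≡ 1 % d
  inverse {a} {d} a⊥d with coprime-Bézout a⊥d
  ... | Bézout.+- x y eq = x , ≡.trans (cong (_% d) (≡.sym eq)) ([m+kn]%n≡m%n 1 y d)
  ... | Bézout.-+ x y eq = X * x , (begin
    (X * x * a) % d           ≡⟨ cong (_% d) (ℕP.*-assoc X x a) ⟩
    (X * X) % d               ≡⟨ [m+kn]%n≡m%n (X * X) y d ⟨
    (X * X + y * d) % d       ≡⟨ cong (_% d) square ⟩
    (1 + X * y * d) % d       ≡⟨ [m+kn]%n≡m%n 1 (X * y) d ⟩
    1 % d                     ∎)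
    where
    open ≡-Reasoning
    X = x * a
    square : X * X + y * d ≡ 1 + X * y * d
    square = begin
      X * X + y * d      ≡⟨ cong (λ z → X * X + z) eq ⟨
      X * X + (1 + X)    ≡⟨ solve 1 (λ X → X :* X :+ (con 1 :+ X) := con 1 :+ X :* (con 1 :+ X)) ≡.refl X ⟩
      1 + X * (1 + X)    ≡⟨ cong (λ z → 1 + X * z) eq ⟩
      1 + X * (y * d)    ≡⟨ cong (λ z → 1 + z) (ℕP.*-assoc X y d) ⟨
      1 + X * y * d      ∎
      where open +-*-Solver

  %-remainder : ∀ {m d} n .{{_ : NonZero d}} → m ∣ d → ∃ λ k → n % d + k * m ≡ n
  %-remainder {m} {d} n (divides q d≡qm) = n / d * q , (begin
    n % d + n / d * q * m      ≡⟨ cong (λ z → n % d + z) (ℕP.*-assoc (n / d) q m) ⟩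
    n % d + n / d * (q * m)    ≡⟨ cong (λ z → n % d + n / d * z) d≡qm ⟨
    n % d + n / d * d          ≡⟨ m≡m%n+[m/n]*n n d ⟨
    n                          ∎)
    where open ≡-Reasoning

  -- Definitionally the list `units d`, restated so that the number theory does not depend on a
  -- field.
  residues : ℕ → List ℕ
  residues d = filter (λ u → coprime? u d) (upTo d)

  ∈-residues⁺ : ∀ {u d} → u < d → Coprime u d → u ∈ residues d
  ∈-residues⁺ {d = d} u<d u⊥d = ∈-filter⁺ (λ u → coprime? u d) (∈-upTo⁺ u<d) u⊥d

  ∈-residues⁻ : ∀ {u d} → u ∈ residues d → u < d × Coprime u d
  ∈-residues⁻ {d = d} u∈ with ∈-filter⁻ (λ u → coprime? u d) {xs = upTo d} u∈
  ... | u∈upTo , u⊥d = ∈-upTo⁻ u∈upTo , u⊥d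

  map-unique : ∀ {xs : List ℕ} {f : ℕ → ℕ} → (∀ {x y} → x ∈ xs → y ∈ xs → f x ≡ f y → x ≡ y) →
               Unique xs → Unique (map f xs)
  map-unique f-inj []           = []
  map-unique f-inj (x∉xs ∷ uxs) =
    AllP.map⁺ (All.tabulate λ y∈xs fx≡fy → All.lookup x∉xs y∈xs (f-inj (here ≡.refl) (there y∈xs) fx≡fy)) ∷
    map-unique (λ x∈ y∈ → f-inj (there x∈) (there y∈)) uxs

  -- Both lists are free of duplicates and have the same members; an inverse b of a gives
  -- injectivity and preimages.
  multiplication-permutes : ∀ {a d} .{{_ : NonZero d}} → Coprime a d →
    map (λ u → (a * u) % d) (residues d) ↭ residues d
  multiplication-permutes {a} {d} a⊥d = ∼bag⇒↭ (unique∧set⇒bag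
    (map-unique injective unique) unique (λ {u} → mk⇔ to from))
    where
    open ≡-Reasoning
    unique : Unique (residues d)
    unique = filter⁺ (λ u → coprime? u d) (upTo⁺ d)
    b = proj₁ (inverse a⊥d)
    ba≡1 = proj₂ (inverse a⊥d)
    cancel : ∀ u → (b * (a * u)) % d ≡ u % d
    cancel u = begin
      (b * (a * u)) % d  ≡⟨ cong (_% d) (ℕP.*-assoc b a u) ⟨
      (b * a * u) % d    ≡⟨ *-cong-% d ba≡1 ≡.refl ⟩
      (1 * u) % d        ≡⟨ cong (_% d) (ℕP.*-identityˡ u) ⟩
      u % d              ∎
    injective : ∀ {u v} → u ∈ residues d → v ∈ residues d → (a * u) % d ≡ (a * v) % d → u ≡ v
    injective {u} {v} u∈ v∈ au≡av = begin
      u                  ≡⟨ m<n⇒m%n≡m (proj₁ (∈-residues⁻ u∈)) ⟨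
      u % d              ≡⟨ cancel u ⟨
      (b * (a * u)) % d  ≡⟨ *-cong-% {b} d ≡.refl au≡av ⟩
      (b * (a * v)) % d  ≡⟨ cancel v ⟩
      v % d              ≡⟨ m<n⇒m%n≡m (proj₁ (∈-residues⁻ v∈)) ⟩
      v                  ∎
    to : ∀ {u} → u ∈ map (λ u → (a * u) % d) (residues d) → u ∈ residues d
    to u∈ with ∈-map⁻ (λ u → (a * u) % d) u∈
    ... | v , v∈ , ≡.refl = ∈-residues⁺ (m%n<n (a * v) d) (coprime-% (coprime-*ˡ a⊥d (proj₂ (∈-residues⁻ v∈))))
    b⊥d : Coprime b d
    b⊥d {c} (c∣b , c∣d) = ∣.∣1⇒≡1 (∣.∣n∣m%n⇒∣m c∣d (subst (c ∣_) ba≡1 (∣.%-presˡ-∣ (∣.∣m⇒∣m*n a c∣b) c∣d)))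
    from : ∀ {u} → u ∈ residues d → u ∈ map (λ u → (a * u) % d) (residues d)
    from {u} u∈ = subst (_∈ map (λ u → (a * u) % d) (residues d)) image
      (∈-map⁺ (λ u → (a * u) % d) (∈-residues⁺ (m%n<n (b * u) d) (coprime-% (coprime-*ˡ b⊥d (proj₂ (∈-residues⁻ u∈))))))
      where
      image : (a * ((b * u) % d)) % d ≡ u
      image = begin
        (a * ((b * u) % d)) % d  ≡⟨ *-cong-% {a} d ≡.refl (m%n%n≡m%n (b * u) d) ⟩
        (a * (b * u)) % d        ≡⟨ cong (_% d) (solve 3 (λ a b u → a :* (b :* u) := b :* (a :* u)) ≡.refl a b u) ⟩
        (b * (a * u)) % d        ≡⟨ cancel u ⟩
        u % d                    ≡⟨ m<n⇒m%n≡m (proj₁ (∈-residues⁻ u∈)) ⟩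
        u                        ∎
        where open +-*-Solver

  -- Not simply 1: for d = 1 the only residue in the list is 0.
  1%d∈residues : ∀ d .{{_ : NonZero d}} → 1 % d ∈ residues d
  1%d∈residues d = ∈-residues⁺ (m%n<n 1 d) (coprime-% (Coprimality.1-coprimeTo d))

  private
    -- Splits off the part t of M coprime to n without factoring into primes: gcd (M, n) is divided
    -- out repeatedly, each time at the cost of one factor n.
    coprime-part : ∀ n M → .{{_ : NonZero M}} → ∃₂ λ t k → Coprime t n × M ∣ t * n ^ k
    coprime-part n = <-rec (λ M → .{{_ : NonZero M}} → ∃₂ λ t k → Coprime t n × M ∣ t * n ^ k) step
      where
      step : ∀ M → (∀ {M′} → M′ < M → .{{_ : NonZero M′}} → ∃₂ λ t k → Coprime t n × M′ ∣ t * n ^ k) →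
             .{{_ : NonZero M}} → ∃₂ λ t k → Coprime t n × M ∣ t * n ^ k
      step M rec with coprime? M n
      ... | yes M⊥n = M , 0 , M⊥n , ∣.m∣m*n 1
      ... | no M⊥̸n = reduce (gcd[m,n]∣m M n)
        where
        h = gcd M n
        reduce : h ∣ M → ∃₂ λ t k → Coprime t n × M ∣ t * n ^ k
        reduce (divides q M≡qh) with rec q<M {{q≢0}}
          where
          q≢0 : NonZero q
          q≢0 = ℕ.≢-nonZero λ { ≡.refl → ℕ.≢-nonZero⁻¹ M M≡qh }
          h≢0 : h ≢ 0
          h≢0 h≡0 = ℕ.≢-nonZero⁻¹ M (≡.trans M≡qh (≡.trans (cong (q *_) h≡0) (ℕP.*-zeroʳ q)))
          h≢1 : h ≢ 1
          h≢1 h≡1 = M⊥̸n (Coprimality.gcd≡1⇒coprime h≡1)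
          1<h : 1 < h
          1<h = ℕP.≤∧≢⇒< (ℕP.n≢0⇒n>0 h≢0) (h≢1 ∘ ≡.sym)
          q<M : q < M
          q<M = subst (q <_) (≡.sym M≡qh) (ℕP.m<m*n q h {{q≢0}} 1<h)
        ... | t , k , t⊥n , q∣tnᵏ = t , suc k , t⊥n ,
          subst (_∣ t * n ^ suc k) (≡.sym M≡qh)
            (subst (q * h ∣_) (solve 3 (λ t p n → t :* p :* n := t :* (n :* p)) ≡.refl t (n ^ k) n) (∣.*-pres-∣ q∣tnᵏ (gcd[m,n]∣n M n)))
          where open +-*-Solver

  -- Units modulo g lift to numbers coprime to M. With t the part of M coprime to n, a common
  -- divisor c of n + t g and M is coprime to t, because n is, and coprime to n, because g and t
  -- are. As M divides t nᵏ, this leaves c = 1.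
  coprime-lift : ∀ {n g} M → .{{_ : NonZero M}} → Coprime n g → ∃ λ t → Coprime (n + t * g) M
  coprime-lift {n} {g} M n⊥g with coprime-part n M
  ... | t , k , t⊥n , M∣tnᵏ = t , λ {c} (c∣n+tg , c∣M) →
    let c⊥t : Coprime c t
        c⊥t = λ {e} (e∣c , e∣t) → t⊥n (e∣t , ∣.∣m+n∣m⇒∣n
          (subst (e ∣_) (ℕP.+-comm n (t * g)) (∣.∣-trans e∣c c∣n+tg)) (∣.∣m⇒∣m*n g e∣t))
        c⊥n : Coprime c n
        c⊥n = λ {f} (f∣c , f∣n) →
          let f⊥g : Coprime f g
              f⊥g = coprime-∣ˡ f∣n n⊥g
              f∣tg = ∣.∣m+n∣m⇒∣n (∣.∣-trans f∣c c∣n+tg) f∣n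
          in t⊥n (coprime-divisor f⊥g (subst (f ∣_) (ℕP.*-comm t g) f∣tg) , f∣n)
    in ∣.∣1⇒≡1 (∣power⇒∣1 c⊥n k (coprime-divisor c⊥t (∣.∣-trans c∣M M∣tnᵏ)))
    where
    ∣power⇒∣1 : ∀ {c} → Coprime c n → ∀ k → c ∣ n ^ k → c ∣ 1
    ∣power⇒∣1 c⊥n zero    c∣1  = c∣1
    ∣power⇒∣1 c⊥n (suc k) c∣nᵏ = ∣power⇒∣1 c⊥n k (coprime-divisor c⊥n c∣nᵏ)

  %-equal⇒+* : ∀ {a b} g .{{_ : NonZero g}} → a ≤ b → a % g ≡ b % g → ∃ λ q → b ≡ a + q * g
  %-equal⇒+* {a} {b} g a≤b a≡b = b / g ∸ a / g , (begin
    b                                           ≡⟨ m≡m%n+[m/n]*n b g ⟩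
    b % g + b / g * g                           ≡⟨ ≡.cong₂ (λ r q → r + q * g) (≡.sym a≡b) (≡.sym (ℕP.m∸n+n≡m (/-monoˡ-≤ g a≤b))) ⟩
    a % g + (b / g ∸ a / g + a / g) * g
      ≡⟨ solve 4 (λ r q s g → r :+ (q :+ s) :* g := r :+ s :* g :+ q :* g) ≡.refl (a % g) (b / g ∸ a / g) (a / g) g ⟩
    a % g + a / g * g + (b / g ∸ a / g) * g     ≡⟨ cong (_+ (b / g ∸ a / g) * g) (m≡m%n+[m/n]*n a g) ⟨
    a + (b / g ∸ a / g) * g                     ∎)
    where
    open ≡-Reasoning
    open +-*-Solver

  private
    crt-Bézout : ∀ {g m₁ m₂ a b} x y → .{{_ : NonZero g}} → .{{_ : NonZero m₂}} → g + y * m₂ ≡ x * m₁ →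
      g ∣ m₂ → a % g ≡ b % g → ∃₂ λ s t → a + s * m₁ ≡ b + t * m₂
    crt-Bézout {g} {m₁} {m₂} {a} {b} x y eq (divides k m₂≡kg) a≡b
      -- Adding a m₂ to b makes it at least a, so that the difference exists in ℕ. The congruence
      -- survives as g divides m₂, and the conclusion allows multiples of m₂.
      with %-equal⇒+* {a} {b + a * m₂} g (ℕP.≤-trans (ℕP.m≤m*n a m₂) (ℕP.m≤n+m (a * m₂) b))
        (≡.trans a≡b (≡.sym (≡.trans (cong (λ z → (b + z) % g) (≡.trans (cong (a *_) m₂≡kg) (≡.sym (ℕP.*-assoc a k g)))) ([m+kn]%n≡m%n b (a * k) g))))
    ... | q , b+am₂≡a+qg = q * x , a + q * y , (begin
      a + q * x * m₁                ≡⟨ cong (λ z → a + z) (ℕP.*-assoc q x m₁) ⟩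
      a + q * (x * m₁)              ≡⟨ cong (λ z → a + q * z) eq ⟨
      a + q * (g + y * m₂)          ≡⟨ solve 5 (λ a q g y m → a :+ q :* (g :+ y :* m) := a :+ q :* g :+ q :* y :* m) ≡.refl a q g y m₂ ⟩
      a + q * g + q * y * m₂        ≡⟨ cong (_+ q * y * m₂) b+am₂≡a+qg ⟨
      b + a * m₂ + q * y * m₂       ≡⟨ solve 5 (λ a b q y m → b :+ a :* m :+ q :* y :* m := b :+ (a :+ q :* y) :* m) ≡.refl a b q y m₂ ⟩
      b + (a + q * y) * m₂          ∎)
      where
      open ≡-Reasoning
      open +-*-Solver

  chinese-remainder : ∀ {m₁ m₂ a b} → .{{_ : NonZero (gcd m₁ m₂)}} → .{{_ : NonZero m₁}} → .{{_ : NonZero m₂}} →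
    a % gcd m₁ m₂ ≡ b % gcd m₁ m₂ → ∃₂ λ s t → a + s * m₁ ≡ b + t * m₂
  chinese-remainder {m₁} {m₂} a≡b with Bézout.identity (gcd-GCD m₁ m₂)
  ... | Bézout.+- x y eq = crt-Bézout x y eq (gcd[m,n]∣n m₁ m₂) a≡b
  ... | Bézout.-+ x y eq with crt-Bézout y x eq (gcd[m,n]∣m m₁ m₂) (≡.sym a≡b)
  ...   | s , t , eq′ = t , s , ≡.sym eq′

-- Finite sums over residues and over indices.

module FiniteSums (em : ExcludedMiddle 0ℓ) (R : CompleteOrderedField) where

  open OrderedField em R
  open PosetReasoning ≤-poset

  ∑-cong : ∀ us {f g} → (∀ {u} → u ∈ us → f u ≈ g u) → ∑[ us ] f ≈ ∑[ us ] g
  ∑-cong []       f≈g = refl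
  ∑-cong (u ∷ us) f≈g = +-cong (f≈g (here ≡.refl)) (∑-cong us (λ u∈ → f≈g (there u∈)))

  ∑-mono : ∀ us {f g} → (∀ {u} → u ∈ us → f u ≤ g u) → ∑[ us ] f ≤ ∑[ us ] g
  ∑-mono []       f≤g = ≤-refl
  ∑-mono (u ∷ us) f≤g = +-mono-≤ (f≤g (here ≡.refl)) (∑-mono us (λ u∈ → f≤g (there u∈)))

  ∑-+ : ∀ us f g → ∑[ us ] (λ u → f u + g u) ≈ ∑[ us ] f + ∑[ us ] g
  ∑-+ []       f g = sym (+-identityʳ 0#)
  ∑-+ (u ∷ us) f g = trans (+-congˡ (∑-+ us f g))
    (solve 4 (λ a b c d → a :+ b :+ (c :+ d) := a :+ c :+ (b :+ d)) refl (f u) (g u) _ _)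

  ∑-*ˡ : ∀ us c f → ∑[ us ] (λ u → c * f u) ≈ c * ∑[ us ] f
  ∑-*ˡ []       c f = sym (zeroʳ c)
  ∑-*ˡ (u ∷ us) c f = trans (+-congˡ (∑-*ˡ us c f)) (sym (distribˡ c _ _))

  ∑-- : ∀ us f g → ∑[ us ] (λ u → f u - g u) ≈ ∑[ us ] f - ∑[ us ] g
  ∑-- []       f g = sym (-‿inverseʳ 0#)
  ∑-- (u ∷ us) f g = trans (+-congˡ (∑-- us f g))
    (solve 4 (λ a b c d → a :- b :+ (c :- d) := a :+ c :- (b :+ d)) refl (f u) (g u) _ _)

  ∑-const : ∀ us c → ∑[ us ] (λ _ → c) ≈ fromℕ (length us) * c
  ∑-const []       c = sym (zeroˡ c)
  ∑-const (u ∷ us) c = trans (+-congˡ (∑-const us c)) (solve 2 (λ n c → c :+ n :* c := (:1 :+ n) :* c) refl _ c)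

  ∑-nonNeg : ∀ us {f} → (∀ {u} → u ∈ us → 0# ≤ f u) → 0# ≤ ∑[ us ] f
  ∑-nonNeg []       0≤f = ≤-refl
  ∑-nonNeg (u ∷ us) 0≤f = +-nonNeg (0≤f (here ≡.refl)) (∑-nonNeg us (λ u∈ → 0≤f (there u∈)))

  ∑-pos : ∀ {us f v} → v ∈ us → (∀ {u} → u ∈ us → 0# < f u) → 0# < ∑[ us ] f
  ∑-pos {u ∷ us} _ 0<f = +-pos (0<f (here ≡.refl)) (∑-nonNeg us (λ u∈ → proj₁ (0<f (there u∈))))

  ∑-↭ : ∀ {us vs} f → us ↭ vs → ∑[ us ] f ≈ ∑[ vs ] f
  ∑-↭ f ↭.refl           = refl
  ∑-↭ f (↭.prep u p)     = +-congˡ (∑-↭ f p)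
  ∑-↭ f (↭.swap u v p)   = trans (+-congˡ (+-congˡ (∑-↭ f p)))
    (solve 3 (λ a b c → a :+ (b :+ c) := b :+ (a :+ c)) refl (f u) (f v) _)
  ∑-↭ f (↭.trans p q)    = trans (∑-↭ f p) (∑-↭ f q)

  ∑-map : ∀ us (h : ℕ → ℕ) f → ∑[ map h us ] f ≡ ∑[ us ] (λ u → f (h u))
  ∑-map us h f = cong (foldr _+_ 0#) (≡.sym (map-∘ us))

  ∑-swap : ∀ us {n} (F : Fin n → ℕ → ℝ) → ∑[ us ] (λ u → ∑ (λ k → F k u)) ≈ ∑ (λ k → ∑[ us ] (F k))
  ∑-swap us {zero}  F = trans (∑-const us 0#) (zeroʳ _)
  ∑-swap us {suc n} F = trans (∑-+ us (F zero) (λ u → ∑ (λ k → F (suc k) u))) (+-congˡ (∑-swap us (λ k → F (suc k))))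

  ∑Fin-cong : ∀ {n} {f g : Fin n → ℝ} → (∀ k → f k ≈ g k) → ∑ f ≈ ∑ g
  ∑Fin-cong {zero}  f≈g = refl
  ∑Fin-cong {suc n} f≈g = +-cong (f≈g zero) (∑Fin-cong (λ k → f≈g (suc k)))

  ∑Fin-mono : ∀ {n} {f g : Fin n → ℝ} → (∀ k → f k ≤ g k) → ∑ f ≤ ∑ g
  ∑Fin-mono {zero}  f≤g = ≤-refl
  ∑Fin-mono {suc n} f≤g = +-mono-≤ (f≤g zero) (∑Fin-mono (λ k → f≤g (suc k)))

  ∑Fin-*ˡ : ∀ {n} c (f : Fin n → ℝ) → ∑ (λ k → c * f k) ≈ c * ∑ f
  ∑Fin-*ˡ {zero}  c f = sym (zeroʳ c)
  ∑Fin-*ˡ {suc n} c f = trans (+-congˡ (∑Fin-*ˡ c (λ k → f (suc k)))) (sym (distribˡ c _ _))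

  ∑Fin-+ : ∀ {n} (f g : Fin n → ℝ) → ∑ (λ k → f k + g k) ≈ ∑ f + ∑ g
  ∑Fin-+ {zero}  f g = sym (+-identityʳ 0#)
  ∑Fin-+ {suc n} f g = trans (+-congˡ (∑Fin-+ (λ k → f (suc k)) (λ k → g (suc k))))
    (solve 4 (λ a b c d → a :+ b :+ (c :+ d) := a :+ c :+ (b :+ d)) refl (f zero) (g zero) _ _)

  ∑Fin-const : ∀ n c → ∑ {n} (λ _ → c) ≈ fromℕ n * c
  ∑Fin-const zero    c = sym (zeroˡ c)
  ∑Fin-const (suc n) c = trans (+-congˡ (∑Fin-const n c)) (solve 2 (λ n c → c :+ n :* c := (:1 :+ n) :* c) refl _ c)

  ∑Fin-0 : ∀ {n} {f : Fin n → ℝ} → (∀ k → f k ≈ 0#) → ∑ f ≈ 0#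
  ∑Fin-0 {n} f≈0 = trans (∑Fin-cong f≈0) (trans (∑Fin-const n 0#) (zeroʳ _))

  ∑Fin-single : ∀ {n} {f : Fin n → ℝ} i → (∀ k → k ≢ i → f k ≈ 0#) → ∑ f ≈ f i
  ∑Fin-single zero    f≈0 = trans (+-congˡ (∑Fin-0 (λ k → f≈0 (suc k) λ ()))) (+-identityʳ _)
  ∑Fin-single (suc i) f≈0 = trans (+-cong (f≈0 zero λ ()) (∑Fin-single i (λ k k≢i → f≈0 (suc k) (λ eq → k≢i (FinP.suc-injective eq)))))
    (+-identityˡ _)

  ∑Fin-atMostOne : ∀ {n} {f : Fin n → ℝ} {b} → 0# ≤ b → (∀ k → f k ≤ b) →
    (∀ k l → k ≢ l → f k ≈ 0# ⊎ f l ≈ 0#) → ∑ f ≤ b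
  ∑Fin-atMostOne {zero}  0≤b f≤b one = 0≤b
  ∑Fin-atMostOne {suc n} {f} {b} 0≤b f≤b one with em {f zero ≈ 0#}
  ... | yes f0≈0 = ≈-≤-trans (trans (+-congʳ f0≈0) (+-identityˡ _))
    (∑Fin-atMostOne 0≤b (λ k → f≤b (suc k)) (λ k l k≢l → one (suc k) (suc l) (λ eq → k≢l (FinP.suc-injective eq))))
  ... | no f0≉0 = ≈-≤-trans (∑Fin-single zero rest) (f≤b zero)
    where
    rest : ∀ k → k ≢ zero → f k ≈ 0#
    rest k k≢0 with one k zero k≢0
    ... | inj₁ fk≈0 = fk≈0
    ... | inj₂ f0≈0 = ⊥-elim (f0≉0 f0≈0)

-- Characters on the units modulo d and their orthogonality.

module UnitCharacters (em : ExcludedMiddle 0ℓ) (R : CompleteOrderedField) where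

  open OrderedField em R
  open ComplexNumbers em R
  open FiniteSums em R
  open Units
  open PosetReasoning ≤-poset

  normSq≈0 : ∀ {z} → normSq z ≈ 0# → z ≈ᶜ 0ᶜ
  normSq≈0 {z} z≈0 = squeeze (∣∣≤⇒Re z≤0) , squeeze (∣∣≤⇒Im z≤0)
    where
    z≤0 : ∣ z ∣≤ 0#
    z≤0 = ≤-refl , ≤-reflexive (trans z≈0 (sym (zeroʳ 0#)))
    squeeze : ∀ {a} → (- 0# ≤ a) × (a ≤ 0#) → a ≈ 0#
    squeeze (0≤a , a≤0) = ≤-antisym a≤0 (≈-≤-trans (solve 0 (:0 := :- :0) refl) 0≤a)

  normSq-pos : ∀ {z} → ¬ (z ≈ᶜ 0ᶜ) → 0# < normSq z
  normSq-pos z≉0 = normSq-nonNeg _ , λ 0≈z → z≉0 (normSq≈0 (sym 0≈z))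

  normSq-conj : ∀ z → normSq (conj z) ≈ normSq z
  normSq-conj (a +i b) = solve 2 (λ a b → a :* a :+ (:- b) :* (:- b) := a :* a :+ b :* b) refl a b

  unimodular-inverse : ∀ {z} → normSq z ≈ 1# → z *ᶜ conj z ≈ᶜ 1ᶜ
  unimodular-inverse {z} z≈1 = ℂR.trans (z*conj-z z) (ofReal-cong z≈1)

  unimodular-* : ∀ {z w} → normSq z ≈ 1# → normSq w ≈ 1# → normSq (z *ᶜ w) ≈ 1#
  unimodular-* {z} {w} z≈1 w≈1 = trans (normSq-* z w) (trans (*-cong z≈1 w≈1) (*-identityʳ 1#))

  unimodular-conj : ∀ {z} → normSq z ≈ 1# → normSq (conj z) ≈ 1#
  unimodular-conj {z} z≈1 = trans (normSq-conj z) z≈1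

  ∑ᶜ[_]_ : List ℕ → (ℕ → ℂ) → ℂ
  ∑ᶜ[ us ] f = (∑[ us ] (λ u → Re (f u))) +i (∑[ us ] (λ u → Im (f u)))

  ∑ᶜ-*ˡ : ∀ us z f → ∑ᶜ[ us ] (λ u → z *ᶜ f u) ≈ᶜ z *ᶜ ∑ᶜ[ us ] f
  ∑ᶜ-*ˡ us z f =
    trans (∑-- us _ _) (+-cong (∑-*ˡ us (Re z) _) (-‿cong (∑-*ˡ us (Im z) _))) ,
    trans (∑-+ us _ _) (+-cong (∑-*ˡ us (Re z) _) (∑-*ˡ us (Im z) _))

  ∑ᶜ-cong : ∀ us {f g} → (∀ {u} → u ∈ us → f u ≈ᶜ g u) → ∑ᶜ[ us ] f ≈ᶜ ∑ᶜ[ us ] g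
  ∑ᶜ-cong us f≈g = ∑-cong us (λ u∈ → proj₁ (f≈g u∈)) , ∑-cong us (λ u∈ → proj₂ (f≈g u∈))

  periodic-* : ∀ χ n k → χ ⟨ n ℕ.+ k ℕ.* modulus χ ⟩ ≈ᶜ χ ⟨ n ⟩
  periodic-* χ n zero    = ℂR.reflexive (cong (χ ⟨_⟩) (ℕP.+-identityʳ n))
  periodic-* χ n (suc k) = ℂR.trans (ℂR.reflexive (cong (χ ⟨_⟩) rearrange))
    (ℂR.trans (DirichletCharacter.periodic χ (n ℕ.+ k ℕ.* modulus χ)) (periodic-* χ n k))
    where
    rearrange : n ℕ.+ (modulus χ ℕ.+ k ℕ.* modulus χ) ≡ n ℕ.+ k ℕ.* modulus χ ℕ.+ modulus χ
    rearrange = ≡.trans (cong (n ℕ.+_) (ℕP.+-comm (modulus χ) _)) (≡.sym (ℕP.+-assoc n _ _))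

  module _ (d : ℕ) {{_ : NonZero d}} where

    translation-invariance : ∀ {a} (f : ℕ → ℝ) → (∀ n → f (n % d) ≈ f n) → Coprime a d →
      ∑[ units d ] (λ u → f (a ℕ.* u)) ≈ ∑[ units d ] f
    translation-invariance {a} f f-periodic a⊥d = begin-equality
      ∑[ units d ] (λ u → f (a ℕ.* u))              ≈⟨ ∑-cong (units d) (λ {u} _ → f-periodic (a ℕ.* u)) ⟨
      ∑[ units d ] (λ u → f ((a ℕ.* u) % d))        ≡⟨ ∑-map (units d) (λ u → (a ℕ.* u) % d) f ⟨
      ∑[ map (λ u → (a ℕ.* u) % d) (units d) ] f    ≈⟨ ∑-↭ f (multiplication-permutes a⊥d) ⟩
      ∑[ units d ] f                                ∎

    -- Values off the units modulo d are left open apart from periodicity and multiplicativity, so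
    -- characters of different moduli can be multiplied and conjugated without choosing a new
    -- modulus.
    record UnitCharacter (f : ℕ → ℂ) : Set where
      field
        periodic-%     : ∀ n → f (n % d) ≈ᶜ f n
        multiplicative : ∀ m n → f (m ℕ.* n) ≈ᶜ f m *ᶜ f n
        unimodular     : ∀ {u} → Coprime u d → normSq (f u) ≈ 1#

    open UnitCharacter public

    TrivialOnUnits : (ℕ → ℂ) → Set
    TrivialOnUnits f = ∀ u → Coprime u d → f u ≈ᶜ 1ᶜ

    product-character : ∀ {f g} → UnitCharacter f → UnitCharacter g → UnitCharacter (λ u → f u *ᶜ g u)
    product-character {f} {g} F G = record
      { periodic-%     = λ n → ℂR.*-cong (periodic-% F n) (periodic-% G n)
      ; multiplicative = λ m n → ℂR.trans (ℂR.*-cong (multiplicative F m n) (multiplicative G m n)) (ℂI.*-interchange (f m) (f n) (g m) (g n))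
      ; unimodular     = λ u⊥d → unimodular-* (unimodular F u⊥d) (unimodular G u⊥d)
      }

    conj-character : ∀ {f} → UnitCharacter f → UnitCharacter (λ u → conj (f u))
    conj-character {f} F = record
      { periodic-%     = λ n → conj-cong (periodic-% F n)
      ; multiplicative = λ m n → ℂR.trans (conj-cong (multiplicative F m n)) (conj-* (f m) (f n))
      ; unimodular     = λ u⊥d → unimodular-conj (unimodular F u⊥d)
      }

    -- Translation by a unit a with f a ≠ 1 fixes the sum S and multiplies it by f a, so (f a - 1) S
    -- = 0. The squared modulus carries the cancellation over to ℝ.
    orthogonality : ∀ {f} → UnitCharacter f → ¬ TrivialOnUnits f → ∑ᶜ[ units d ] f ≈ᶜ 0ᶜ
    orthogonality {f} F nontrivial with em {∃ λ a → Coprime a d × ¬ (f a ≈ᶜ 1ᶜ)}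
    ... | no ∄ = ⊥-elim (nontrivial λ u u⊥d → em⇒ (λ fu≉1 → ∄ (u , u⊥d , fu≉1)))
      where
      em⇒ : ∀ {z w} → ¬ ¬ (z ≈ᶜ w) → z ≈ᶜ w
      em⇒ {z} {w} ¬¬z≈w with em {z ≈ᶜ w}
      ... | yes z≈w = z≈w
      ... | no z≉w  = ⊥-elim (¬¬z≈w z≉w)
    ... | yes (a , a⊥d , fa≉1) = normSq≈0 (x*y≈0⇒y≈0 (>⇒≉ (normSq-pos fa-1≉0)) (begin-equality
      normSq (f a +ᶜ -ᶜ 1ᶜ) * normSq S     ≈⟨ normSq-* _ S ⟨
      normSq ((f a +ᶜ -ᶜ 1ᶜ) *ᶜ S)         ≈⟨ normSq-cong (ℂI.[x-1]y≈xy-y (f a) S) ⟩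
      normSq (f a *ᶜ S +ᶜ -ᶜ S)            ≈⟨ normSq-cong (ℂR.+-congʳ invariant) ⟩
      normSq (S +ᶜ -ᶜ S)                   ≈⟨ normSq-cong (ℂR.-‿inverseʳ S) ⟩
      normSq 0ᶜ                            ≈⟨ solve 0 (:0 :* :0 :+ :0 :* :0 := :0) refl ⟩
      0#                                   ∎))
      where
      S = ∑ᶜ[ units d ] f
      fa-1≉0 : ¬ (f a +ᶜ -ᶜ 1ᶜ ≈ᶜ 0ᶜ)
      fa-1≉0 eq = fa≉1 (ℂR.trans (ℂI.x≈x-1+1 (f a)) (ℂR.trans (ℂR.+-congʳ eq) (ℂR.+-identityˡ 1ᶜ)))
      invariant : f a *ᶜ S ≈ᶜ S
      invariant = ℂR.trans (ℂR.sym (∑ᶜ-*ˡ (units d) (f a) f))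
        (ℂR.trans (∑ᶜ-cong (units d) (λ {u} _ → ℂR.sym (multiplicative F a u)))
        ( translation-invariance (λ n → Re (f n)) (λ n → proj₁ (periodic-% F n)) a⊥d
        , translation-invariance (λ n → Im (f n)) (λ n → proj₂ (periodic-% F n)) a⊥d))

    ∈-units⇒coprime : ∀ {u} → u ∈ units d → Coprime u d
    ∈-units⇒coprime u∈ = proj₂ (∈-residues⁻ u∈)

    module _ (χ : DirichletCharacter) (m∣d : modulus χ ∣ d) where

      dirichlet-periodic-% : ∀ n → χ ⟨ n % d ⟩ ≈ᶜ χ ⟨ n ⟩
      dirichlet-periodic-% n = ℂR.trans (ℂR.sym (periodic-* χ (n % d) (proj₁ (%-remainder n m∣d))))
        (ℂR.reflexive (cong (χ ⟨_⟩) (proj₂ (%-remainder n m∣d))))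

      -- No roots of unity are needed: translation by u multiplies the positive sum of |χ(v)|² over
      -- the units by |χ(u)|² and yet leaves it unchanged.
      dirichlet-unimodular : ∀ {u} → Coprime u d → normSq (χ ⟨ u ⟩) ≈ 1#
      dirichlet-unimodular {u} u⊥d = *-cancelˡ-≈ S (>⇒≉ 0<S) (begin-equality
        S * normSq (χ ⟨ u ⟩)                                    ≈⟨ *-comm S _ ⟩
        normSq (χ ⟨ u ⟩) * S                                    ≈⟨ ∑-*ˡ (units d) (normSq (χ ⟨ u ⟩)) (λ v → normSq (χ ⟨ v ⟩)) ⟨
        ∑[ units d ] (λ v → normSq (χ ⟨ u ⟩) * normSq (χ ⟨ v ⟩)) ≈⟨ ∑-cong (units d) (λ {v} _ → trans (normSq-cong (DirichletCharacter.multiplicative χ u v)) (normSq-* _ _)) ⟨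
        ∑[ units d ] (λ v → normSq (χ ⟨ u ℕ.* v ⟩))
          ≈⟨ translation-invariance (λ v → normSq (χ ⟨ v ⟩)) (λ n → normSq-cong (dirichlet-periodic-% n)) u⊥d ⟩
        S                                                       ≈⟨ *-identityʳ S ⟨
        S * 1#                                                  ∎)
        where
        S = ∑[ units d ] (λ v → normSq (χ ⟨ v ⟩))
        0<S : 0# < S
        0<S = ∑-pos (1%d∈residues d) (λ {v} v∈ → normSq-pos (λ χv≈0 →
          Equivalence.to (DirichletCharacter.vanishing χ v) χv≈0 (coprime-∣ʳ m∣d (∈-units⇒coprime v∈))))

      dirichlet-character : UnitCharacter (χ ⟨_⟩)
      dirichlet-character = record
        { periodic-%     = dirichlet-periodic-%
        ; multiplicative = DirichletCharacter.multiplicative χ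
        ; unimodular     = dirichlet-unimodular
        }

-- Characters that agree on the units modulo d are equivalent.

module EquivalentCharacters (em : ExcludedMiddle 0ℓ) (R : CompleteOrderedField) where

  open OrderedField em R
  open ComplexNumbers em R
  open UnitCharacters em R
  open Units

  private
    %-+* : ∀ n k {m g} .{{_ : NonZero g}} → g ∣ m → (n ℕ.+ k ℕ.* m) % g ≡ n % g
    %-+* n k {g = g} (divides q ≡.refl) =
      ≡.trans (cong (λ z → (n ℕ.+ z) % g) (≡.sym (ℕP.*-assoc k q g))) ([m+kn]%n≡m%n n (k ℕ.* q) g)

  -- The common inducing character has modulus g = gcd(m₁, m₂); g is kept abstract so that it never gets evaluated.
  module CommonCharacter (χ₁ χ₂ : DirichletCharacter) (d : ℕ) {{_ : NonZero d}}
    (m₁∣d : modulus χ₁ ∣ d) (m₂∣d : modulus χ₂ ∣ d)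
    (agree : ∀ u → Coprime u d → χ₁ ⟨ u ⟩ ≈ᶜ χ₂ ⟨ u ⟩)
    (g : ℕ) {{_ : NonZero g}} (g∣m₁ : g ∣ modulus χ₁) (g∣m₂ : g ∣ modulus χ₂)
    (crt : ∀ {a b} → a % g ≡ b % g → ∃₂ λ s t → a ℕ.+ s ℕ.* modulus χ₁ ≡ b ℕ.+ t ℕ.* modulus χ₂) where

    private
      m₁ = modulus χ₁
      m₂ = modulus χ₂

      -- The remainder theorem gives k congruent to a modulo m₁ and to b modulo m₂; moving k by a
      -- multiple of m₁ m₂ yields k′ coprime to d, where the characters agree. Then χ₁(a) = χ₁(k′) =
      -- χ₂(k′) = χ₂(b) = χ₁(b).
      same-residue : ∀ {a b} → Coprime a d → Coprime b d → a % g ≡ b % g → χ₁ ⟨ a ⟩ ≈ᶜ χ₁ ⟨ b ⟩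
      same-residue {a} {b} a⊥d b⊥d a≡b =
        let s , t , as≡bt = crt {a} {b} a≡b
            k = a ℕ.+ s ℕ.* m₁
            k⊥m₁ : Coprime k m₁
            k⊥m₁ = coprime-+* s (coprime-∣ʳ m₁∣d a⊥d)
            k⊥m₂ : Coprime k m₂
            k⊥m₂ = subst (λ z → Coprime z m₂) (≡.sym as≡bt) (coprime-+* t (coprime-∣ʳ m₂∣d b⊥d))
            k⊥m₁m₂ : Coprime k (m₁ ℕ.* m₂)
            k⊥m₁m₂ = Coprimality.sym (coprime-*ˡ {m₁} {m₂} {k} (Coprimality.sym k⊥m₁) (Coprimality.sym k⊥m₂))
            j , k′⊥d = coprime-lift d k⊥m₁m₂
            k′₁ : k ℕ.+ j ℕ.* (m₁ ℕ.* m₂) ≡ k ℕ.+ j ℕ.* m₂ ℕ.* m₁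
            k′₁ = cong (k ℕ.+_) (≡.trans (cong (j ℕ.*_) (ℕP.*-comm m₁ m₂)) (≡.sym (ℕP.*-assoc j m₂ m₁)))
            k′₂ : k ℕ.+ j ℕ.* (m₁ ℕ.* m₂) ≡ k ℕ.+ j ℕ.* m₁ ℕ.* m₂
            k′₂ = cong (k ℕ.+_) (≡.sym (ℕP.*-assoc j m₁ m₂))
        in ℂR.trans (ℂR.sym (periodic-* χ₁ a s))
          (ℂR.trans (ℂR.sym (periodic-* χ₁ k (j ℕ.* m₂)))
          (ℂR.trans (ℂR.reflexive (cong (χ₁ ⟨_⟩) (≡.sym k′₁)))
          (ℂR.trans (agree _ k′⊥d)
          (ℂR.trans (ℂR.reflexive (cong (χ₂ ⟨_⟩) k′₂))
          (ℂR.trans (periodic-* χ₂ k (j ℕ.* m₁))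
          (ℂR.trans (ℂR.reflexive (cong (χ₂ ⟨_⟩) as≡bt))
          (ℂR.trans (periodic-* χ₂ b t)
          (ℂR.sym (agree b b⊥d)))))))))

      -- The value of χ₁ at a lift of n to a unit modulo d; `same-residue` makes the choice of lift
      -- immaterial. The decision is an argument so that proofs can match on it.
      value : ∀ n → Dec (Coprime n g) → ℂ
      value n (yes n⊥g) = χ₁ ⟨ n ℕ.+ proj₁ (coprime-lift d n⊥g) ℕ.* g ⟩
      value n (no _)    = 0ᶜ

      value-coprime : ∀ {n b} → Coprime n g → Coprime b d → b % g ≡ n % g → ∀ n⊥g? → value n n⊥g? ≈ᶜ χ₁ ⟨ b ⟩
      value-coprime {n} _ b⊥d b≡n (yes n⊥g) = same-residue (proj₂ (coprime-lift d n⊥g)) b⊥d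
        (≡.trans ([m+kn]%n≡m%n n (proj₁ (coprime-lift d n⊥g)) g) (≡.sym b≡n))
      value-coprime n⊥g _ _ (no n⊥̸g) = ⊥-elim (n⊥̸g n⊥g)

      value-0 : ∀ {n} → ¬ Coprime n g → ∀ n⊥g? → value n n⊥g? ≈ᶜ 0ᶜ
      value-0 n⊥̸g (yes n⊥g) = ⊥-elim (n⊥̸g n⊥g)
      value-0 n⊥̸g (no _)    = ℂR.refl

      ψ⟨_⟩ : ℕ → ℂ
      ψ⟨ n ⟩ = value n (coprime? n g)

      lifted : ∀ {n m} → g ∣ m → Coprime n m → ∃ λ k → Coprime (n ℕ.+ k ℕ.* m) d × (n ℕ.+ k ℕ.* m) % g ≡ n % g
      lifted {n} g∣m n⊥m = proj₁ (coprime-lift d n⊥m) , proj₂ (coprime-lift d n⊥m) , %-+* n (proj₁ (coprime-lift d n⊥m)) g∣m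

      ψ-multiplicative : ∀ m n → Dec (Coprime m g) → Dec (Coprime n g) → ψ⟨ m ℕ.* n ⟩ ≈ᶜ ψ⟨ m ⟩ *ᶜ ψ⟨ n ⟩
      ψ-multiplicative m n (yes m⊥g) (yes n⊥g) =
        let j , a⊥d , a≡m = lifted ∣.∣-refl m⊥g
            k , b⊥d , b≡n = lifted ∣.∣-refl n⊥g
        in ℂR.trans (value-coprime (coprime-*ˡ {m} {n} {g} m⊥g n⊥g) (coprime-*ˡ {m ℕ.+ j ℕ.* g} {n ℕ.+ k ℕ.* g} {d} a⊥d b⊥d) (*-cong-% {m ℕ.+ j ℕ.* g} {n ℕ.+ k ℕ.* g} g a≡m b≡n) (coprime? (m ℕ.* n) g))
          (ℂR.trans (DirichletCharacter.multiplicative χ₁ _ _)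
          (ℂR.sym (ℂR.*-cong (value-coprime m⊥g a⊥d a≡m (coprime? m g)) (value-coprime n⊥g b⊥d b≡n (coprime? n g)))))
      ψ-multiplicative m n (no m⊥̸g) _ = ℂR.trans (value-0 (λ mn⊥g → m⊥̸g (coprime-∣ˡ (∣.m∣m*n n) mn⊥g)) (coprime? (m ℕ.* n) g))
        (ℂR.sym (ℂR.trans (ℂR.*-congʳ (value-0 m⊥̸g (coprime? m g))) (ℂR.zeroˡ ψ⟨ n ⟩)))
      ψ-multiplicative m n _ (no n⊥̸g) = ℂR.trans (value-0 (λ mn⊥g → n⊥̸g (coprime-∣ˡ (∣.n∣m*n m) mn⊥g)) (coprime? (m ℕ.* n) g))
        (ℂR.sym (ℂR.trans (ℂR.*-congˡ (value-0 n⊥̸g (coprime? n g))) (ℂR.zeroʳ ψ⟨ m ⟩)))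

      ψ-periodic : ∀ n → Dec (Coprime n g) → ψ⟨ n ℕ.+ g ⟩ ≈ᶜ ψ⟨ n ⟩
      ψ-periodic n (yes n⊥g) =
        let k , b⊥d , b≡n = lifted ∣.∣-refl n⊥g
            n+g⊥g = subst (λ z → Coprime (n ℕ.+ z) g) (ℕP.*-identityˡ g) (coprime-+* 1 n⊥g)
            n+g≡n = ≡.trans (cong (λ z → (n ℕ.+ z) % g) (≡.sym (ℕP.*-identityˡ g))) ([m+kn]%n≡m%n n 1 g)
        in ℂR.trans (value-coprime n+g⊥g b⊥d (≡.trans b≡n (≡.sym n+g≡n)) (coprime? (n ℕ.+ g) g))
          (ℂR.sym (value-coprime n⊥g b⊥d b≡n (coprime? n g)))
      ψ-periodic n (no n⊥̸g) = ℂR.trans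
        (value-0 (λ n+g⊥g → n⊥̸g (λ (c∣n , c∣g) → n+g⊥g (∣.∣m∣n⇒∣m+n c∣n c∣g , c∣g))) (coprime? (n ℕ.+ g) g))
        (ℂR.sym (value-0 n⊥̸g (coprime? n g)))

      ψ-vanishing : ∀ n → ψ⟨ n ⟩ ≈ᶜ 0ᶜ → ¬ Coprime n g
      ψ-vanishing n ψn≈0 n⊥g =
        let k , b⊥d , b≡n = lifted ∣.∣-refl n⊥g
        in Equivalence.to (DirichletCharacter.vanishing χ₁ _)
          (ℂR.trans (ℂR.sym (value-coprime n⊥g b⊥d b≡n (coprime? n g))) ψn≈0) (coprime-∣ʳ m₁∣d b⊥d)

    common : DirichletCharacter
    common = record
      { modulus        = g
      ; χ              = ψ⟨_⟩
      ; periodic       = λ n → ψ-periodic n (coprime? n g)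
      ; multiplicative = λ m n → ψ-multiplicative m n (coprime? m g) (coprime? n g)
      ; unital         = ℂR.trans
          (value-coprime (Coprimality.1-coprimeTo g) (Coprimality.1-coprimeTo d) ≡.refl (coprime? 1 g))
          (DirichletCharacter.unital χ₁)
      ; vanishing      = λ n → mk⇔ (ψ-vanishing n) (λ n⊥̸g → value-0 n⊥̸g (coprime? n g))
      }

    -- A lift of n by multiples of m₁ changes neither χ₁ nor, since g divides m₁, the residue modulo
    -- g.
    common-induces₁ : Induces common χ₁
    common-induces₁ = g∣m₁ , λ n n⊥m₁ →
      let k , b⊥d , b≡n = lifted g∣m₁ n⊥m₁
      in ℂR.trans (ℂR.sym (periodic-* χ₁ n k))
        (ℂR.sym (value-coprime (coprime-∣ʳ g∣m₁ n⊥m₁) b⊥d b≡n (coprime? n g)))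

    common-induces₂ : Induces common χ₂
    common-induces₂ = g∣m₂ , λ n n⊥m₂ →
      let k , b⊥d , b≡n = lifted g∣m₂ n⊥m₂
      in ℂR.trans (ℂR.sym (periodic-* χ₂ n k)) (ℂR.trans (ℂR.sym (agree _ b⊥d))
        (ℂR.sym (value-coprime (coprime-∣ʳ g∣m₂ n⊥m₂) b⊥d b≡n (coprime? n g))))

  Induces-trans : ∀ {ψ φ χ} → Induces ψ φ → Induces φ χ → Induces ψ χ
  Induces-trans (ψ∣φ , φ≈ψ) (φ∣χ , χ≈φ) = ∣.∣-trans ψ∣φ φ∣χ , λ n n⊥χ →
    ℂR.trans (χ≈φ n n⊥χ) (φ≈ψ n (coprime-∣ʳ φ∣χ n⊥χ))

  -- An inducing character of least modulus cannot itself be induced from a smaller modulus.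
  commonly-induced⇒equivalent : ∀ {χ₁ χ₂} ψ → Induces ψ χ₁ → Induces ψ χ₂ → Equivalent χ₁ χ₂
  commonly-induced⇒equivalent {χ₁} {χ₂} ψ ψ₁ ψ₂ = <-rec
    (λ m → ∀ ψ → modulus ψ ≡ m → Induces ψ χ₁ → Induces ψ χ₂ → Equivalent χ₁ χ₂) descend (modulus ψ) ψ ≡.refl ψ₁ ψ₂
    where
    descend : ∀ m → (∀ {k} → k ℕ.< m → ∀ ψ → modulus ψ ≡ k → Induces ψ χ₁ → Induces ψ χ₂ → Equivalent χ₁ χ₂) →
              ∀ ψ → modulus ψ ≡ m → Induces ψ χ₁ → Induces ψ χ₂ → Equivalent χ₁ χ₂
    descend m rec ψ ≡.refl ψ₁ ψ₂ with em {∃ λ ψ′ → Induces ψ′ ψ × modulus ψ′ ℕ.< modulus ψ}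
    ... | yes (ψ′ , ψ′ψ , ψ′<ψ) = rec ψ′<ψ ψ′ ≡.refl (Induces-trans {ψ′} {ψ} {χ₁} ψ′ψ ψ₁) (Induces-trans {ψ′} {ψ} {χ₂} ψ′ψ ψ₂)
    ... | no ∄ = ψ , ψ-primitive , ψ₁ , ψ₂
      where
      ψ-primitive : Primitive ψ
      ψ-primitive ψ′ ψ′ψ = ℕP.≤-antisym (∣.∣⇒≤ {{DirichletCharacter.nonZero ψ}} (proj₁ ψ′ψ))
        (ℕP.≮⇒≥ λ ψ′<ψ → ∄ (ψ′ , ψ′ψ , ψ′<ψ))

  agree-on-units⇒equivalent : ∀ {χ₁ χ₂} d {{_ : NonZero d}} → modulus χ₁ ∣ d → modulus χ₂ ∣ d →
    (∀ u → Coprime u d → χ₁ ⟨ u ⟩ ≈ᶜ χ₂ ⟨ u ⟩) → Equivalent χ₁ χ₂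
  agree-on-units⇒equivalent {χ₁} {χ₂} d m₁∣d m₂∣d agree =
    commonly-induced⇒equivalent {χ₁} {χ₂} common common-induces₁ common-induces₂
    where
    m₁ = modulus χ₁
    m₂ = modulus χ₂
    instance
      m₁≢0 : NonZero m₁
      m₁≢0 = DirichletCharacter.nonZero χ₁
      m₂≢0 : NonZero m₂
      m₂≢0 = DirichletCharacter.nonZero χ₂
      g≢0 : NonZero (gcd m₁ m₂)
      g≢0 = ℕ.≢-nonZero (gcd[m,n]≢0 m₁ m₂ (inj₁ (ℕ.≢-nonZero⁻¹ m₁)))
    open CommonCharacter χ₁ χ₂ d m₁∣d m₂∣d agree (gcd m₁ m₂) (gcd[m,n]∣m m₁ m₂) (gcd[m,n]∣n m₁ m₂)
      (λ {a} {b} → chinese-remainder {m₁} {m₂} {a} {b})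

-- Pointwise expansion of a negative power of the modulus.

module PointwiseEstimate (em : ExcludedMiddle 0ℓ) (R : CompleteOrderedField) where

  open OrderedField em R
  open ExponentialSeries em R
  open RealPowers em R
  open PosetReasoning ≤-poset

  Within : ℝ → ℝ → Set
  Within b a = (- b ≤ a) × (a ≤ b)

  within⇒0≤+ : ∀ {a b} → Within b a → 0# ≤ b + a
  within⇒0≤+ {a} {b} (-b≤a , _) = ≤-≈-trans (≤⇒0≤- -b≤a) (solve 2 (λ a b → a :- :- b := b :+ a) refl a b)

  within⇒0≤- : ∀ {a b} → Within b a → 0# ≤ b - a
  within⇒0≤- (_ , a≤b) = ≤⇒0≤- a≤b

  to-within : ∀ {a b} → 0# ≤ b + a → 0# ≤ b - a → Within b a
  to-within {a} {b} 0≤b+a 0≤b-a =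
    ≤-by _ 0≤b+a (solve 2 (λ a b → a := :- b :+ (b :+ a)) refl a b) ,
    ≤-by _ 0≤b-a (solve 2 (λ a b → b := a :+ (b :- a)) refl a b)

  within-≤ : ∀ {a b b′} → b ≤ b′ → Within b a → Within b′ a
  within-≤ b≤b′ (-b≤a , a≤b) = ≤-trans (neg-mono-≤ b≤b′) -b≤a , ≤-trans a≤b b≤b′

  within-+ : ∀ {a a′ b b′} → Within b a → Within b′ a′ → Within (b + b′) (a + a′)
  within-+ {a} {a′} {b} {b′} (-b≤a , a≤b) (-b′≤a′ , a′≤b′) =
    ≈-≤-trans (solve 2 (λ b c → :- (b :+ c) := :- b :+ :- c) refl b b′) (+-mono-≤ -b≤a -b′≤a′) , +-mono-≤ a≤b a′≤b′

  within-* : ∀ {a a′ b b′} → Within b a → Within b′ a′ → Within (b * b′) (a * a′)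
  within-* {a} {a′} {b} {b′} p q =
    *-cancelˡ-≤ 2# 0<2 (≤-by _ (+-nonNeg (*-nonNeg (within⇒0≤- p) (within⇒0≤- q)) (*-nonNeg (within⇒0≤+ p) (within⇒0≤+ q)))
      (solve 4 (λ a a′ b b′ → (:1 :+ :1) :* (a :* a′) := (:1 :+ :1) :* :- (b :* b′) :+ ((b :- a) :* (b′ :- a′) :+ (b :+ a) :* (b′ :+ a′))) refl a a′ b b′)) ,
    *-cancelˡ-≤ 2# 0<2 (≤-by _ (+-nonNeg (*-nonNeg (within⇒0≤- p) (within⇒0≤+ q)) (*-nonNeg (within⇒0≤+ p) (within⇒0≤- q)))
      (solve 4 (λ a a′ b b′ → (:1 :+ :1) :* (b :* b′) := (:1 :+ :1) :* (a :* a′) :+ ((b :- a) :* (b′ :+ a′) :+ (b :+ a) :* (b′ :- a′))) refl a a′ b b′))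

  -- This is (T/α)^c. With α^c factored out, the remaining weight is close to 1 and has an expansion
  -- in 1/α.
  weight : ℝ → ℝ → ℝ → ℝ
  weight c α T = exp (c * (log T - log α))

  weight-pos : ∀ c α T → 0# < weight c α T
  weight-pos c α T = exp-pos (c * (log T - log α))

  power≈weight : ∀ c α T → exp (c * log T) ≈ exp (c * log α) * weight c α T
  power≈weight c α T = trans (exp-cong (solve 3 (λ c t a → c :* t := c :* a :+ c :* (t :- a)) refl c (log T) (log α))) (exp-+ _ _)

  -- T is the modulus of (α + X) + iY, which is dominated by α.
  module _ {c N α X Y T : ℝ} (0<c+1 : 0# < c + 1#) (c<0 : c < 0#) (1≤N : 1# ≤ N) (2N≤α : 2# * N ≤ α)
    (X≤N : Within N X) (Y≤N : Within N Y) (0≤T : 0# ≤ T) (T² : T * T ≈ (α + X) * (α + X) + Y * Y) where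

    private
      w : ℝ
      w = weight c α T

      0≤-c : 0# ≤ - c
      0≤-c = ≤-≈-trans (≤⇒0≤- (proj₁ c<0)) (+-identityˡ (- c))

      0<N : 0# < N
      0<N = <-≤-trans 0<1 1≤N

      0≤N : 0# ≤ N
      0≤N = proj₁ 0<N

      0<α : 0# < α
      0<α = <-≤-trans (*-pos 0<2 0<N) 2N≤α

      0≤α : 0# ≤ α
      0≤α = proj₁ 0<α

    0<α+X : 0# < α + X
    0<α+X = <-≤-trans 0<N (≤-by _ (+-nonNeg (≤⇒0≤- 2N≤α) (within⇒0≤+ X≤N))
      (solve 3 (λ α X N → α :+ X := N :+ ((α :- (:1 :+ :1) :* N) :+ (N :+ X))) refl α X N))

    private
      α≤2[α+X] : α ≤ 2# * (α + X)
      α≤2[α+X] = ≤-by _ (+-nonNeg (≤⇒0≤- 2N≤α) (*-nonNeg (proj₁ 0<2) (within⇒0≤+ X≤N)))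
        (solve 3 (λ α X N → (:1 :+ :1) :* (α :+ X) := α :+ ((α :- (:1 :+ :1) :* N) :+ (:1 :+ :1) :* (N :+ X))) refl α X N)

      α+X≤T : α + X ≤ T
      α+X≤T = sq-cancel-≤ 0≤T (≤-by (Y * Y) (sq-nonNeg Y) T²)

      N²-X² : 0# ≤ N * N - X * X
      N²-X² = within⇒0≤- (within-* X≤N X≤N)

      N²-Y² : 0# ≤ N * N - Y * Y
      N²-Y² = within⇒0≤- (within-* Y≤N Y≤N)

    0<T : 0# < T
    0<T = <-≤-trans 0<α+X α+X≤T

    -- Weighted AM-GM for α + X and α, as T ≥ α + X.
    weight-upper : weight c α T * (α + X) ≤ α + (c + 1#) * X
    weight-upper = begin
      w * (α + X)
        ≤⟨ *-monoʳ-≤ (α + X) (proj₁ 0<α+X) (exp-mono-≤ exponent) ⟩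
      exp (c * (l - a)) * (α + X)
        ≈⟨ *-congˡ (exp-log 0<α+X) ⟨
      exp (c * (l - a)) * exp l
        ≈⟨ exp-+ _ _ ⟨
      exp (c * (l - a) + l)
        ≈⟨ exp-cong (solve 3 (λ c l a → c :* (l :- a) :+ l := (c :+ :1) :* l :+ (:1 :- (c :+ :1)) :* a) refl c l a) ⟩
      exp ((c + 1#) * l + (1# - (c + 1#)) * a)
        ≤⟨ exp-convex (proj₁ 0<c+1) c+1≤1 l a ⟩
      (c + 1#) * exp l + (1# - (c + 1#)) * exp a
        ≈⟨ +-cong (*-congˡ (exp-log 0<α+X)) (*-congˡ (exp-log 0<α)) ⟩
      (c + 1#) * (α + X) + (1# - (c + 1#)) * α
        ≈⟨ solve 3 (λ c α X → (c :+ :1) :* (α :+ X) :+ (:1 :- (c :+ :1)) :* α := α :+ (c :+ :1) :* X) refl c α X ⟩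
      α + (c + 1#) * X ∎
      where
      l = log (α + X)
      a = log α
      c+1≤1 : c + 1# ≤ 1#
      c+1≤1 = ≤-by (- c) 0≤-c (solve 1 (λ c → :1 := c :+ :1 :+ :- c) refl c)
      exponent : c * (log T - a) ≤ c * (l - a)
      exponent = ≤-by (- c * (log T - l)) (*-nonNeg 0≤-c (≤⇒0≤- (log-≤ 0<α+X α+X≤T)))
        (solve 4 (λ c t l a → c :* (l :- a) := c :* (t :- a) :+ (:- c) :* (t :- l)) refl c (log T) l a)

    private
      -- Bernoulli's inequality for the exponent c < 0. With h = log (T/α), the bounds exp (c h) ≥ 1
      -- + c h and 1 + h ≤ T/α combine because c reverses the second.
      weight-lower : α + c * (T - α) ≤ α * w
      weight-lower = begin
        α + c * (T - α)      ≤⟨ ≤-by (- c * (T - α * (1# + h))) (*-nonNeg 0≤-c (≤⇒0≤- tangent))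
                                  (solve 4 (λ α c T h → α :* (:1 :+ c :* h) := α :+ c :* (T :- α) :+ (:- c) :* (T :- α :* (:1 :+ h))) refl α c T h) ⟩
        α * (1# + c * h)     ≤⟨ *-monoˡ-≤ α 0≤α (1+t≤exp (c * h)) ⟩
        α * w           ∎
        where
        h = log T - log α
        tangent : α * (1# + h) ≤ T
        tangent = begin
          α * (1# + h)              ≈⟨ *-congʳ (exp-log 0<α) ⟨
          exp (log α) * (1# + h)    ≤⟨ exp-tangent (log α) (log T) ⟩
          exp (log T)               ≈⟨ exp-log 0<T ⟩
          T                         ∎

      -- This is T ≤ α + X + N²/α without the division. After squaring, the cross term 2α (α + X) N²
      -- absorbs α² Y², since α ≤ 2 (α + X).
      αT-upper : α * T ≤ α * (α + X) + N * N
      αT-upper = sq-cancel-≤ (+-nonNeg (*-nonNeg 0≤α (proj₁ 0<α+X)) (sq-nonNeg N)) (begin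
        α * T * (α * T)                                 ≈⟨ solve 2 (λ α T → α :* T :* (α :* T) := α :* α :* (T :* T)) refl α T ⟩
        α * α * (T * T)                                 ≈⟨ *-congˡ T² ⟩
        α * α * ((α + X) * (α + X) + Y * Y)
          ≤⟨ ≤-by _ (+-nonNeg (+-nonNeg (*-nonNeg (sq-nonNeg α) N²-Y²) (*-nonNeg (*-nonNeg 0≤α (sq-nonNeg N)) (≤⇒0≤- α≤2[α+X]))) (sq-nonNeg (N * N)))
              (solve 4 (λ α X Y N → (α :* (α :+ X) :+ N :* N) :* (α :* (α :+ X) :+ N :* N) :=
                α :* α :* ((α :+ X) :* (α :+ X) :+ Y :* Y) :+ (α :* α :* (N :* N :- Y :* Y) :+ α :* (N :* N) :* ((:1 :+ :1) :* (α :+ X) :- α) :+ N :* N :* (N :* N))) refl α X Y N) ⟩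
        (α * (α + X) + N * N) * (α * (α + X) + N * N)   ∎)

      -- α² times the error of the approximation 1 + c X/α to the weight, hence of bounded size.
      remainder : ℝ
      remainder = α * α * w - (α * α + c * α * X)

      -- From below, `weight-lower` and `αT-upper` give at least c N². From above, `weight-upper`
      -- gives (α + X) · remainder ≤ -c α X², and α ≤ 2 (α + X).
      remainder-within : Within (2# * (N * N)) remainder
      remainder-within = to-within
        (≤-≈-trans (+-nonNeg (+-nonNeg (+-nonNeg (*-nonNeg 0≤α (≤⇒0≤- weight-lower)) (*-nonNeg 0≤-c (≤⇒0≤- αT-upper))) (*-nonNeg (proj₁ 0<c+1) (sq-nonNeg N))) (sq-nonNeg N))
          (solve 6 (λ α w c T X N →
            α :* (α :* w :- (α :+ c :* (T :- α))) :+ (:- c) :* (α :* (α :+ X) :+ N :* N :- α :* T) :+ (c :+ :1) :* (N :* N) :+ N :* N :=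
            (:1 :+ :1) :* (N :* N) :+ (α :* α :* w :- (α :* α :+ c :* α :* X))) refl α w c T X N))
        (*-cancelˡ-≤ (α + X) 0<α+X (begin
          (α + X) * 0#   ≈⟨ zeroʳ _ ⟩
          0#             ≤⟨ +-nonNeg (+-nonNeg (+-nonNeg (*-nonNeg (sq-nonNeg α) (≤⇒0≤- weight-upper)) (*-nonNeg (sq-nonNeg N) (≤⇒0≤- α≤2[α+X]))) (*-nonNeg 0≤α N²-X²)) (*-nonNeg (*-nonNeg (proj₁ 0<c+1) 0≤α) (sq-nonNeg X)) ⟩
          α * α * (α + (c + 1#) * X - w * (α + X)) + N * N * (2# * (α + X) - α) + α * (N * N - X * X) + (c + 1#) * α * (X * X)
            ≈⟨ solve 5 (λ α w c X N →
                 α :* α :* (α :+ (c :+ :1) :* X :- w :* (α :+ X)) :+ N :* N :* ((:1 :+ :1) :* (α :+ X) :- α) :+ α :* (N :* N :- X :* X) :+ (c :+ :1) :* α :* (X :* X) :=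
                 (α :+ X) :* ((:1 :+ :1) :* (N :* N) :- (α :* α :* w :- (α :* α :+ c :* α :* X)))) refl α w c X N ⟩
          (α + X) * (2# * (N * N) - remainder) ∎))

    module _ {x y : ℝ} (x≤1 : Within 1# x) (y≤1 : Within 1# y) where

      private
        h : ℝ
        h = x * X + y * Y

        h≤2N : Within (2# * N) h
        h≤2N = within-≤ (≤-reflexive (solve 1 (λ N → :1 :* N :+ :1 :* N := (:1 :+ :1) :* N) refl N))
          (within-+ (within-* x≤1 X≤N) (within-* y≤1 Y≤N))

        0≤c+1 = proj₁ 0<c+1

        c≤1 : Within 1# c
        c≤1 = to-within (≤-≈-trans 0≤c+1 (+-comm c 1#)) (+-nonNeg (proj₁ 0<1) 0≤-c)

        α≤α : Within α α
        α≤α = to-within (+-nonNeg 0≤α 0≤α) (≤-reflexive (sym (-‿inverseʳ α)))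

      -- The error is c α X h + remainder · (α x + h). As |c| ≤ 1, |X| ≤ N and |h| ≤ 2N, it is at
      -- most 2N²α + 2N²α + 4N³, and 2N ≤ α turns this into the constant 6.
      second-order-error : Within (fromℕ 6 * (N * N) * α)
        (α * α * (weight c α T * (α * x + (x * X + y * Y))) - (α * α * α * x + α * α * ((x * X + y * Y) + c * (X * x))))
      second-order-error = within-≈ (within-≤ bound (within-+ (within-* (within-* (within-* c≤1 α≤α) X≤N) h≤2N)
        (within-* remainder-within (within-+ (within-* α≤α x≤1) h≤2N))))
        where
        within-≈ : Within (fromℕ 6 * (N * N) * α) (c * α * X * h + remainder * (α * x + h)) →
                   Within (fromℕ 6 * (N * N) * α) (α * α * (w * (α * x + h)) - (α * α * α * x + α * α * (h + c * (X * x))))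
        within-≈ (l , u) = ≤-≈-trans l same , ≈-≤-trans (sym same) u
          where
          same = solve 6 (λ c α X h w x →
            c :* α :* X :* h :+ (α :* α :* w :- (α :* α :+ c :* α :* X)) :* (α :* x :+ h) :=
            α :* α :* (w :* (α :* x :+ h)) :- (α :* α :* α :* x :+ α :* α :* (h :+ c :* (X :* x)))) refl c α X h w x
        bound : 1# * α * N * (2# * N) + 2# * (N * N) * (α * 1# + 2# * N) ≤ fromℕ 6 * (N * N) * α
        bound = ≤-by (2# * (N * N) * (α - 2# * N)) (*-nonNeg (*-nonNeg (proj₁ 0<2) (sq-nonNeg N)) (≤⇒0≤- 2N≤α))
          (solve 2 (λ α N → (:1 :+ (:1 :+ (:1 :+ (:1 :+ (:1 :+ (:1 :+ :0)))))) :* (N :* N) :* α :=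
            :1 :* α :* N :* ((:1 :+ :1) :* N) :+ (:1 :+ :1) :* (N :* N) :* (α :* :1 :+ (:1 :+ :1) :* N) :+ (:1 :+ :1) :* (N :* N) :* (α :- (:1 :+ :1) :* N)) refl α N)

      cXx-upper : c * (X * x) ≤ N
      cXx-upper = ≤-trans (proj₂ (within-* c≤1 (within-* X≤N x≤1)))
        (≤-reflexive (solve 1 (λ N → :1 :* (N :* :1) := N) refl N))

-- Means over an abstract orthonormal system, without reference to characters.

module OrthonormalSystems (em : ExcludedMiddle 0ℓ) (R : CompleteOrderedField) where

  open OrderedField em R
  open ComplexNumbers em R
  open FiniteSums em R
  open PointwiseEstimate em R
  open PosetReasoning ≤-poset

  module Functions (us : List ℕ) {n : ℕ} (η : Fin n → ℕ → ℂ) where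

    x y : Fin n → ℕ → ℝ
    x k u = Re (η k u)
    y k u = Im (η k u)

    X Y : ℕ → ℝ
    X u = ∑ (λ k → x k u)
    Y u = ∑ (λ k → y k u)

    -- The field correlation says that E Re (ηₖ (η₁ + … + ηₙ)) ≤ 1.
    record IsOrthonormal : Set where
      field
        nonempty    : ∃ (_∈ us)
        unimodular  : ∀ k {u} → u ∈ us → normSq (η k u) ≈ 1#
        mean-zero   : ∀ k → ∑[ us ] (x k) ≈ 0#
        orthogonal  : ∀ k l → k ≢ l → ∑[ us ] (λ u → x k u * x l u + y k u * y l u) ≈ 0#
        correlation : ∀ k → ∑[ us ] (λ u → x k u * X u - y k u * Y u) ≤ fromℕ (length us)

  module Orthonormal {us : List ℕ} {n : ℕ} {η : Fin n → ℕ → ℂ} (orthonormal : Functions.IsOrthonormal us η) where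

    open Functions us η
    open IsOrthonormal orthonormal

    D : ℝ
    D = fromℕ (length us)

    D-const : ∀ a → ∑[ us ] (λ _ → a) ≈ D * a
    D-const = ∑-const us

    D-pos : 0# < D
    D-pos = <-≈-trans (∑-pos (proj₂ nonempty) (λ _ → 0<1)) (trans (D-const 1#) (*-identityʳ D))

    private
      ≤-1 : ∀ k {u} → u ∈ us → ∣ η k u ∣≤ 1#
      ≤-1 k u∈ = proj₁ 0<1 , ≤-reflexive (trans (unimodular k u∈) (sym (*-identityʳ 1#)))

      x≤1 : ∀ k {u} → u ∈ us → Within 1# (x k u)
      x≤1 k u∈ = ∣∣≤⇒Re (≤-1 k u∈)

      y≤1 : ∀ k {u} → u ∈ us → Within 1# (y k u)
      y≤1 k u∈ = ∣∣≤⇒Im (≤-1 k u∈)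

      sum-within : ∀ {m} {f : Fin m → ℝ} → (∀ k → Within 1# (f k)) → Within (fromℕ m) (∑ f)
      sum-within {m} f≤1 =
        ≈-≤-trans (trans (solve 1 (λ m → :- m := m :* (:- :1)) refl (fromℕ m)) (sym (∑Fin-const m (- 1#)))) (∑Fin-mono (λ k → proj₁ (f≤1 k))) ,
        ≤-≈-trans (∑Fin-mono (λ k → proj₂ (f≤1 k))) (trans (∑Fin-const m 1#) (*-identityʳ _))

    X≤n : ∀ {u} → u ∈ us → Within (fromℕ n) (X u)
    X≤n u∈ = sum-within (λ k → x≤1 k u∈)

    Y≤n : ∀ {u} → u ∈ us → Within (fromℕ n) (Y u)
    Y≤n u∈ = sum-within (λ k → y≤1 k u∈)

    sum-X : ∑[ us ] X ≈ 0#
    sum-X = trans (∑-swap us x) (∑Fin-0 mean-zero)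

    private
      h : Fin n → ℕ → ℝ
      h k u = x k u * X u + y k u * Y u

      -- h k is the real part of ηₖ times the conjugate of η₁ + ... + ηₙ; orthogonality leaves the
      -- term |ηₖ|² = 1.
      sum-h : ∀ k → ∑[ us ] (h k) ≈ D
      sum-h k = begin-equality
        ∑[ us ] (h k)
          ≈⟨ ∑-cong us (λ {u} _ → trans (+-cong (sym (∑Fin-*ˡ (x k u) (λ l → x l u))) (sym (∑Fin-*ˡ (y k u) (λ l → y l u))))
            (sym (∑Fin-+ (λ l → x k u * x l u) (λ l → y k u * y l u)))) ⟩
        ∑[ us ] (λ u → ∑ (λ l → x k u * x l u + y k u * y l u))
          ≈⟨ ∑-swap us (λ l u → x k u * x l u + y k u * y l u) ⟩
        ∑ (λ l → ∑[ us ] (λ u → x k u * x l u + y k u * y l u))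
          ≈⟨ ∑Fin-single k (λ l l≢k → orthogonal k l (λ k≡l → l≢k (≡.sym k≡l))) ⟩
        ∑[ us ] (λ u → normSq (η k u))
          ≈⟨ ∑-cong us (unimodular k) ⟩
        ∑[ us ] (λ _ → 1#)
          ≈⟨ trans (D-const 1#) (*-identityʳ D) ⟩
        D ∎

      -- 2 x X = Re (ηₖ conj S) + Re (ηₖ S), where S = X + iY.
      sum-Xx : ∀ k → ∑[ us ] (λ u → X u * x k u) ≤ D
      sum-Xx k = *-cancelˡ-≤ 2# 0<2 (begin
        2# * ∑[ us ] (λ u → X u * x k u)
          ≈⟨ ∑-*ˡ us 2# _ ⟨
        ∑[ us ] (λ u → 2# * (X u * x k u))
          ≈⟨ ∑-cong us (λ {u} _ → solve 4 (λ X Y x y → (:1 :+ :1) :* (X :* x) := (x :* X :+ y :* Y) :+ (x :* X :- y :* Y)) refl (X u) (Y u) (x k u) (y k u)) ⟩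
        ∑[ us ] (λ u → h k u + (x k u * X u - y k u * Y u))
          ≈⟨ ∑-+ us (h k) _ ⟩
        ∑[ us ] (h k) + ∑[ us ] (λ u → x k u * X u - y k u * Y u)
          ≤⟨ +-mono-≤ (≤-reflexive (sum-h k)) (correlation k) ⟩
        D + D
          ≈⟨ solve 1 (λ D → D :+ D := (:1 :+ :1) :* D) refl D ⟩
        2# * D ∎)

    module Means {c α : ℝ} {T : ℕ → ℝ} (0<c+1 : 0# < c + 1#) (c<0 : c < 0#)
      (1≤n : 1# ≤ fromℕ n) (2n≤α : 2# * fromℕ n ≤ α)
      (0≤T : ∀ {u} → u ∈ us → 0# ≤ T u)
      (T² : ∀ {u} → u ∈ us → T u * T u ≈ (α + X u) * (α + X u) + Y u * Y u) where

      N C : ℝ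
      N = fromℕ n
      C = fromℕ 6 * (N * N)

      W : ℕ → ℝ
      W u = weight c α (T u)

      -- `G₀` and `G k` stand for the real parts of the conjugate of ωⱼ times Z, for the head and
      -- for the tail. So `J₀` and `J k` will be the Ξⱼ up to the factor α^c/φ(d).
      G₀ : ℕ → ℝ
      G₀ u = α + X u

      G : Fin n → ℕ → ℝ
      G k u = α * x k u + h k u

      J₀ : ℝ
      J₀ = ∑[ us ] (λ u → W u * G₀ u)

      J : Fin n → ℝ
      J k = ∑[ us ] (λ u → W u * G k u)

      T-pos : ∀ {u} → u ∈ us → 0# < T u
      T-pos u∈ = 0<T 0<c+1 c<0 1≤n 2n≤α (X≤n u∈) (Y≤n u∈) (0≤T u∈) (T² u∈)

      J₀-pos : 0# < J₀
      J₀-pos = ∑-pos (proj₂ nonempty) (λ {u} u∈ → *-pos (weight-pos c α (T u))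
        (0<α+X 0<c+1 c<0 1≤n 2n≤α (X≤n u∈) (Y≤n u∈) (0≤T u∈) (T² u∈)))

      J₀-upper : J₀ ≤ D * α
      J₀-upper = begin
        J₀
          ≤⟨ ∑-mono us (λ u∈ → weight-upper 0<c+1 c<0 1≤n 2n≤α (X≤n u∈) (Y≤n u∈) (0≤T u∈) (T² u∈)) ⟩
        ∑[ us ] (λ u → α + (c + 1#) * X u)
          ≈⟨ ∑-+ us _ _ ⟩
        ∑[ us ] (λ _ → α) + ∑[ us ] (λ u → (c + 1#) * X u)
          ≈⟨ +-cong (D-const α) (trans (∑-*ˡ us _ X) (*-congˡ sum-X)) ⟩
        D * α + (c + 1#) * 0#
          ≈⟨ solve 2 (λ a c → a :+ c :* :0 := a) refl (D * α) (c + 1#) ⟩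
        D * α ∎

      private
        0<α : 0# < α
        0<α = <-≤-trans (*-pos 0<2 (<-≤-trans 0<1 1≤n)) 2n≤α

        0≤-c : 0# ≤ - c
        0≤-c = ≤-≈-trans (≤⇒0≤- (proj₁ c<0)) (+-identityˡ (- c))

        0≤C : 0# ≤ C
        0≤C = *-nonNeg (fromℕ-nonNeg 6) (sq-nonNeg N)

        M : Fin n → ℝ
        M k = ∑[ us ] (λ u → X u * x k u)

        error : Fin n → ℕ → ℝ
        error k u = α * α * (W u * G k u) - (α * α * α * x k u + α * α * (h k u + c * (X u * x k u)))

        error-bound : ∀ k {u} → u ∈ us → Within (C * α) (error k u)
        error-bound k u∈ = second-order-error 0<c+1 c<0 1≤n 2n≤α (X≤n u∈) (Y≤n u∈) (0≤T u∈) (T² u∈) (x≤1 k u∈) (y≤1 k u∈)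

        -- In the mean, the leading term α³ x vanishes and h contributes D.
        expansion : ∀ k → α * α * J k ≈ ∑[ us ] (error k) + α * α * (D + c * M k)
        expansion k = begin-equality
          α * α * J k
            ≈⟨ solve 2 (λ a b → a := a :- b :+ b) refl (α * α * J k) second ⟩
          α * α * J k - second + second
            ≈⟨ +-cong (+-cong (sym (∑-*ˡ us _ _)) (-‿cong (sym second≈))) refl ⟩
          ∑[ us ] (λ u → α * α * (W u * G k u)) - ∑[ us ] (λ u → α * α * α * x k u + α * α * (h k u + c * (X u * x k u))) + second
            ≈⟨ +-congʳ (∑-- us _ _) ⟨
          ∑[ us ] (error k) + second ∎
          where
          second = α * α * (D + c * M k)
          second≈ : ∑[ us ] (λ u → α * α * α * x k u + α * α * (h k u + c * (X u * x k u))) ≈ second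
          second≈ = begin-equality
            ∑[ us ] (λ u → α * α * α * x k u + α * α * (h k u + c * (X u * x k u)))
              ≈⟨ trans (∑-+ us _ _) (+-cong (∑-*ˡ us _ _) (∑-*ˡ us _ _)) ⟩
            α * α * α * ∑[ us ] (x k) + α * α * ∑[ us ] (λ u → h k u + c * (X u * x k u))
              ≈⟨ +-cong (*-congˡ (mean-zero k)) (*-congˡ (trans (∑-+ us _ _) (+-cong (sum-h k) (∑-*ˡ us c _)))) ⟩
            α * α * α * 0# + second
              ≈⟨ solve 2 (λ a s → a :* :0 :+ s := s) refl (α * α * α) second ⟩
            second ∎

      -- As c < 0 and `M k` ≤ D, the main term D + c M is at least D (1 + c); the error costs at
      -- most D C α, and α (c + 1) > C outweighs it after multiplication by α².
      J-pos : C < α * (c + 1#) → ∀ k → 0# < J k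
      J-pos C<α[c+1] k = *-cancelˡ-< (α * α) (sq-nonNeg α) (begin-strict
        α * α * 0#
          ≈⟨ zeroʳ _ ⟩
        0#
          <⟨ +-pos (*-pos (*-pos D-pos 0<α) (<⇒0<- C<α[c+1])) (*-nonNeg (*-nonNeg (sq-nonNeg α) 0≤-c) (≤⇒0≤- (sum-Xx k))) ⟩
        D * α * (α * (c + 1#) - C) + α * α * (- c) * (D - M k)
          ≈⟨ solve 5 (λ D α c C M → D :* α :* (α :* (c :+ :1) :- C) :+ α :* α :* (:- c) :* (D :- M) := D :* (:- (C :* α)) :+ α :* α :* (D :+ c :* M)) refl D α c C (M k) ⟩
        D * (- (C * α)) + α * α * (D + c * M k)
          ≤⟨ +-monoˡ-≤ _ (≈-≤-trans (sym (D-const _)) (∑-mono us (λ u∈ → proj₁ (error-bound k u∈)))) ⟩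
        ∑[ us ] (error k) + α * α * (D + c * M k)
          ≈⟨ expansion k ⟨
        α * α * J k ∎)

      -- `M k` may be negative, so here c M is bounded crudely by D N; only a bound independent of α
      -- is wanted, since α^c supplies the decay.
      J-upper : 1# ≤ α → ∀ k → J k ≤ D * (1# + N + C)
      J-upper 1≤α k = *-cancelˡ-≤ (α * α) (*-pos 0<α 0<α) (begin
        α * α * J k
          ≈⟨ expansion k ⟩
        ∑[ us ] (error k) + α * α * (D + c * M k)
          ≤⟨ +-mono-≤ (≤-≈-trans (∑-mono us (λ u∈ → proj₂ (error-bound k u∈))) (D-const _)) (*-monoˡ-≤ _ (sq-nonNeg α) (+-monoʳ-≤ D cM≤DN)) ⟩
        D * (C * α) + α * α * (D + D * N)
          ≤⟨ ≤-by (D * C * α * (α - 1#)) (*-nonNeg (*-nonNeg (*-nonNeg (proj₁ D-pos) 0≤C) (proj₁ 0<α)) (≤⇒0≤- 1≤α))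
               (solve 4 (λ D C α N → α :* α :* (D :* (:1 :+ N :+ C)) := D :* (C :* α) :+ α :* α :* (D :+ D :* N) :+ D :* C :* α :* (α :- :1)) refl D C α N) ⟩
        α * α * (D * (1# + N + C)) ∎)
        where
        cM≤DN : c * M k ≤ D * N
        cM≤DN = begin
          c * M k                                  ≈⟨ ∑-*ˡ us c _ ⟨
          ∑[ us ] (λ u → c * (X u * x k u))        ≤⟨ ∑-mono us (λ u∈ → cXx-upper 0<c+1 c<0 1≤n 2n≤α (X≤n u∈) (Y≤n u∈) (0≤T u∈) (T² u∈) (x≤1 k u∈) (y≤1 k u∈)) ⟩
          ∑[ us ] (λ _ → N)                        ≈⟨ D-const N ⟩
          D * N                                    ∎

      -- Expanding one factor of Z times its conjugate writes |Z|² as the sum of αⱼ times the real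
      -- part belonging to ωⱼ.
      T²-decomposition : ∀ {u} → u ∈ us → T u * T u ≈ α * G₀ u + ∑ (λ k → G k u)
      T²-decomposition {u} u∈ = begin-equality
        T u * T u
          ≈⟨ T² u∈ ⟩
        (α + X u) * (α + X u) + Y u * Y u
          ≈⟨ solve 3 (λ α X Y → (α :+ X) :* (α :+ X) :+ Y :* Y := α :* (α :+ X) :+ (α :* X :+ (X :* X :+ Y :* Y))) refl α (X u) (Y u) ⟩
        α * G₀ u + (α * X u + (X u * X u + Y u * Y u))
          ≈⟨ +-congˡ (+-cong (∑Fin-*ˡ α (λ k → x k u)) (+-cong (∑Fin-*ˡ (X u) (λ k → x k u)) (∑Fin-*ˡ (Y u) (λ k → y k u)))) ⟨
        α * G₀ u + (∑ (λ k → α * x k u) + (∑ (λ k → X u * x k u) + ∑ (λ k → Y u * y k u)))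
          ≈⟨ +-congˡ (trans (+-congˡ (sym (∑Fin-+ (λ k → X u * x k u) (λ k → Y u * y k u))))
               (sym (∑Fin-+ (λ k → α * x k u) (λ k → X u * x k u + Y u * y k u)))) ⟩
        α * G₀ u + ∑ (λ k → α * x k u + (X u * x k u + Y u * y k u))
          ≈⟨ +-congˡ (∑Fin-cong (λ k → +-congˡ (+-cong (*-comm (X u) (x k u)) (*-comm (Y u) (y k u))))) ⟩
        α * G₀ u + ∑ (λ k → G k u) ∎

      weighted-T² : ∑[ us ] (λ u → W u * (T u * T u)) ≈ α * J₀ + ∑ J
      weighted-T² = begin-equality
        ∑[ us ] (λ u → W u * (T u * T u))
          ≈⟨ ∑-cong us (λ {u} u∈ → trans (*-congˡ (T²-decomposition u∈)) (distribute (W u) (G₀ u) (∑ (λ k → G k u)))) ⟩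
        ∑[ us ] (λ u → α * (W u * G₀ u) + W u * ∑ (λ k → G k u))
          ≈⟨ trans (∑-+ us _ _) (+-cong (∑-*ˡ us α _) (∑-cong us (λ {u} _ → sym (∑Fin-*ˡ (W u) (λ k → G k u))))) ⟩
        α * J₀ + ∑[ us ] (λ u → ∑ (λ k → W u * G k u))
          ≈⟨ +-congˡ (∑-swap us (λ k u → W u * G k u)) ⟩
        α * J₀ + ∑ J ∎
        where
        distribute : ∀ w g s → w * (α * g + s) ≈ α * (w * g) + w * s
        distribute w g s = solve 4 (λ α w g s → w :* (α :* g :+ s) := α :* (w :* g) :+ w :* s) refl α w g s

-- Quotients of the twisted characters form an orthonormal system.

module Twists (em : ExcludedMiddle 0ℓ) (R : CompleteOrderedField) where

  open OrderedField em R
  open ComplexNumbers em R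
  open RealPowers em R
  open FiniteSums em R
  open UnitCharacters em R
  open EquivalentCharacters em R
  open OrthonormalSystems em R
  open Units
  open PosetReasoning ≤-poset

  modulus∣lcm : ∀ {r} (χ : Fin r → DirichletCharacter) j → modulus (χ j) ∣ lcmModuli χ
  modulus∣lcm {suc r} χ zero    = m∣lcm[m,n] (modulus (χ zero)) _
  modulus∣lcm {suc r} χ (suc j) = ∣.∣-trans (modulus∣lcm (λ i → χ (suc i)) j) (n∣lcm[m,n] (modulus (χ zero)) _)

  lcm-nonZero : ∀ {r} (χ : Fin r → DirichletCharacter) → NonZero (lcmModuli χ)
  lcm-nonZero {zero}  χ = _
  lcm-nonZero {suc r} χ = ℕ.≢-nonZero λ lcm≡0 →
    ℕ.≢-nonZero⁻¹ (m ℕ.* l) {{ℕP.m*n≢0 m l {{DirichletCharacter.nonZero (χ zero)}} {{lcm-nonZero (λ i → χ (suc i))}}}}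
      (≡.trans (≡.sym (gcd*lcm m l)) (≡.trans (cong (gcd m l ℕ.*_) lcm≡0) (ℕP.*-zeroʳ (gcd m l))))
    where
    m = modulus (χ zero)
    l = lcmModuli (λ i → χ (suc i))

  unimodular-cancel : ∀ {z w v} → normSq v ≈ 1# → z *ᶜ v ≈ᶜ w *ᶜ v → z ≈ᶜ w
  unimodular-cancel {z} {w} {v} v≈1 zv≈wv = ℂR.trans (ℂR.sym (undo z)) (ℂR.trans (ℂR.*-congʳ zv≈wv) (undo w))
    where
    undo : ∀ z → z *ᶜ v *ᶜ conj v ≈ᶜ z
    undo z = ℂR.trans (ℂR.*-assoc z v (conj v)) (ℂR.trans (ℂR.*-congˡ (unimodular-inverse v≈1)) (ℂR.*-identityʳ z))

  quotient-1⇒≈ : ∀ {z w} → normSq w ≈ 1# → z *ᶜ conj w ≈ᶜ 1ᶜ → z ≈ᶜ w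
  quotient-1⇒≈ {z} {w} w≈1 zw̄≈1 = unimodular-cancel (unimodular-conj w≈1) (ℂR.trans zw̄≈1 (ℂR.sym (unimodular-inverse w≈1)))

  Re≤1 : ∀ {z} → normSq z ≈ 1# → Re z ≤ 1#
  Re≤1 {z} z≈1 = proj₂ (∣∣≤⇒Re {z} (proj₁ 0<1 , ≤-reflexive (trans z≈1 (sym (*-identityʳ 1#)))))

  conj-involutive : ∀ z → conj (conj z) ≈ᶜ z
  conj-involutive z = refl , solve 1 (λ b → :- (:- b) := b) refl (Im z)

  module _ {n : ℕ} (χ : Fin (suc n) → DirichletCharacter) (θ : Fin (suc n) → ℝ)
    (inequivalent : ∀ i j → i ≢ j → ¬ Equivalent (χ i) (χ j)) where

    d : ℕ
    d = lcmModuli χ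

    instance
      d-nonZero : NonZero d
      d-nonZero = lcm-nonZero χ

    ω : Fin (suc n) → ℕ → ℂ
    ω = twist χ θ

    η : Fin n → ℕ → ℂ
    η k u = ω (suc k) u *ᶜ conj (ω zero u)

    private
      ε : Fin (suc n) → ℂ
      ε j = cexp (0# +i (- θ j))

      χ-character : ∀ j → UnitCharacter d (χ j ⟨_⟩)
      χ-character j = dirichlet-character d (χ j) (modulus∣lcm χ j)

      f : Fin n → ℕ → ℂ
      f k u = χ (suc k) ⟨ u ⟩ *ᶜ conj (χ zero ⟨ u ⟩)

      f-character : ∀ k → UnitCharacter d (f k)
      f-character k = product-character d (χ-character (suc k)) (conj-character d (χ-character zero))

      E : Fin n → ℂ
      E k = ε (suc k) *ᶜ conj (ε zero)

      -- The phases do not depend on u, so every orthogonality relation reduces to one for the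
      -- untwisted characters f k.
      η≈Ef : ∀ k u → η k u ≈ᶜ E k *ᶜ f k u
      η≈Ef k u = ℂR.trans (ℂR.*-congˡ (conj-* (ε zero) (χ zero ⟨ u ⟩)))
        (ℂI.*-interchange (ε (suc k)) (χ (suc k) ⟨ u ⟩) (conj (ε zero)) (conj (χ zero ⟨ u ⟩)))

      distinct : ∀ i j → i ≢ j → ¬ (∀ u → Coprime u d → χ i ⟨ u ⟩ ≈ᶜ χ j ⟨ u ⟩)
      distinct i j i≢j agree = inequivalent i j i≢j
        (agree-on-units⇒equivalent {χ i} {χ j} d (modulus∣lcm χ i) (modulus∣lcm χ j) agree)

      f-nontrivial : ∀ k → ¬ TrivialOnUnits d (f k)
      f-nontrivial k trivial = distinct (suc k) zero (λ ())
        (λ u u⊥d → quotient-1⇒≈ (unimodular (χ-character zero) u⊥d) (trivial u u⊥d))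

      f-distinct : ∀ k l → k ≢ l → ¬ (∀ u → Coprime u d → f k u ≈ᶜ f l u)
      f-distinct k l k≢l agree = distinct (suc k) (suc l) (λ eq → k≢l (FinP.suc-injective eq))
        (λ u u⊥d → unimodular-cancel (unimodular-conj (unimodular (χ-character zero) u⊥d)) (agree u u⊥d))

      scaled-orthogonality : ∀ {g h : ℕ → ℂ} {a} → UnitCharacter d g → ¬ TrivialOnUnits d g →
        (∀ u → h u ≈ᶜ a *ᶜ g u) → ∑ᶜ[ units d ] h ≈ᶜ 0ᶜ
      scaled-orthogonality {g} {h} {a} G nontrivial h≈ag =
        ℂR.trans (∑ᶜ-cong (units d) (λ {u} _ → h≈ag u))
        (ℂR.trans (∑ᶜ-*ˡ (units d) a g)
        (ℂR.trans (ℂR.*-congˡ (orthogonality d G nontrivial)) (ℂR.zeroʳ a)))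

    ω-unimodular : ∀ j {u} → u ∈ units d → normSq (ω j u) ≈ 1#
    ω-unimodular j u∈ = unimodular-* (normSq-cexp (- θ j)) (unimodular (χ-character j) (∈-units⇒coprime d u∈))

    open Functions (units d) η using (X; Y)

    private
      η-orthogonal : ∀ k l → k ≢ l → ∑ᶜ[ units d ] (λ u → η k u *ᶜ conj (η l u)) ≈ᶜ 0ᶜ
      η-orthogonal k l k≢l = scaled-orthogonality {a = E k *ᶜ conj (E l)} (product-character d (f-character k) (conj-character d (f-character l)))
        (λ trivial → f-distinct k l k≢l (λ u u⊥d → quotient-1⇒≈ (unimodular (f-character l) u⊥d) (trivial u u⊥d)))
        (λ u → ℂR.trans (ℂR.*-cong (η≈Ef k u) (ℂR.trans (conj-cong (η≈Ef l u)) (conj-* (E l) (f l u))))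
          (ℂI.*-interchange (E k) (f k u) (conj (E l)) (conj (f l u))))

      -- The correlation without a conjugate. It need not vanish when f l is the conjugate of f k on
      -- the units, possibly with k = l.
      a : Fin n → Fin n → ℝ
      a k l = ∑[ units d ] (λ u → Re (η k u *ᶜ η l u))

      a-0 : ∀ k l → ¬ TrivialOnUnits d (λ u → f k u *ᶜ f l u) → a k l ≈ 0#
      a-0 k l nontrivial = proj₁ (scaled-orthogonality {h = λ u → η k u *ᶜ η l u} {a = E k *ᶜ E l}
        (product-character d (f-character k) (f-character l)) nontrivial
        (λ u → ℂR.trans (ℂR.*-cong (η≈Ef k u) (η≈Ef l u)) (ℂI.*-interchange (E k) (f k u) (E l) (f l u))))

      η-unimodular : ∀ k {u} → u ∈ units d → normSq (η k u) ≈ 1#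
      η-unimodular k u∈ = unimodular-* (ω-unimodular (suc k) u∈) (unimodular-conj (ω-unimodular zero u∈))

      D : ℝ
      D = fromℕ (length (units d))

      a≤D : ∀ k l → a k l ≤ D
      a≤D k l = ≤-≈-trans (∑-mono (units d) (λ {u} u∈ → Re≤1 {η k u *ᶜ η l u} (unimodular-* (η-unimodular k u∈) (η-unimodular l u∈))))
        (trans (∑-const (units d) 1#) (*-identityʳ D))

      -- fₖ fₗ is trivial for at most one l, as it determines fₗ.
      a-atMostOne : ∀ k l m → l ≢ m → a k l ≈ 0# ⊎ a k m ≈ 0#
      a-atMostOne k l m l≢m with em {TrivialOnUnits d (λ u → f k u *ᶜ f l u)}
      ... | no nontrivial = inj₁ (a-0 k l nontrivial)
      ... | yes trivial   = inj₂ (a-0 k m λ trivial′ → f-distinct l m l≢m λ u u⊥d →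
        unimodular-cancel (unimodular (f-character k) u⊥d)
          (ℂR.trans (ℂR.*-comm (f l u) (f k u)) (ℂR.trans (trivial u u⊥d)
          (ℂR.sym (ℂR.trans (ℂR.*-comm (f m u) (f k u)) (trivial′ u u⊥d))))))

      η-correlation : ∀ k → ∑[ units d ] (λ u → Re (η k u) * X u - Im (η k u) * Y u) ≤ D
      η-correlation k = begin
        ∑[ units d ] (λ u → Re (η k u) * X u - Im (η k u) * Y u)
          ≈⟨ ∑-cong (units d) (λ {u} _ → expand u) ⟩
        ∑[ units d ] (λ u → ∑ (λ l → Re (η k u *ᶜ η l u)))
          ≈⟨ ∑-swap (units d) (λ l u → Re (η k u *ᶜ η l u)) ⟩
        ∑ (a k)
          ≤⟨ ∑Fin-atMostOne (fromℕ-nonNeg (length (units d))) (a≤D k) (a-atMostOne k) ⟩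
        D ∎
        where
        expand : ∀ u → Re (η k u) * X u - Im (η k u) * Y u ≈ ∑ (λ l → Re (η k u *ᶜ η l u))
        expand u = begin-equality
          Re (η k u) * X u - Im (η k u) * Y u
            ≈⟨ +-congˡ (solve 2 (λ a b → :- (a :* b) := (:- a) :* b) refl (Im (η k u)) (Y u)) ⟩
          Re (η k u) * X u + - Im (η k u) * Y u
            ≈⟨ +-cong (∑Fin-*ˡ (Re (η k u)) (λ l → Re (η l u))) (∑Fin-*ˡ (- Im (η k u)) (λ l → Im (η l u))) ⟨
          ∑ (λ l → Re (η k u) * Re (η l u)) + ∑ (λ l → - Im (η k u) * Im (η l u))
            ≈⟨ ∑Fin-+ (λ l → Re (η k u) * Re (η l u)) (λ l → - Im (η k u) * Im (η l u)) ⟨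
          ∑ (λ l → Re (η k u) * Re (η l u) + - Im (η k u) * Im (η l u))
            ≈⟨ ∑Fin-cong (λ l → +-congˡ (solve 2 (λ a b → (:- a) :* b := :- (a :* b)) refl (Im (η k u)) (Im (η l u)))) ⟩
          ∑ (λ l → Re (η k u *ᶜ η l u)) ∎

    η-orthonormal : Functions.IsOrthonormal (units d) η
    η-orthonormal = record
      { nonempty    = 1 % d , 1%d∈residues d
      ; unimodular  = η-unimodular
      ; mean-zero   = λ k → proj₁ (scaled-orthogonality {h = η k} {a = E k} (f-character k) (f-nontrivial k) (η≈Ef k))
      ; orthogonal  = λ k l k≢l → trans
          (∑-cong (units d) (λ {u} _ → solve 4 (λ a b c d → a :* c :+ b :* d := a :* c :- b :* (:- d)) refl (Re (η k u)) (Im (η k u)) (Re (η l u)) (Im (η l u))))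
          (proj₁ (η-orthogonal k l k≢l))
      ; correlation = η-correlation
      }

    module _ (α : ℝ) where

      -- Multiplication by the conjugate of ω₁ keeps the modulus and turns the dominant term of Z
      -- into the real number α.
      Z V : ℕ → ℂ
      Z = combination χ θ (headThenOnes α)
      V u = Z u *ᶜ conj (ω zero u)

      private
        sum-* : ∀ {m} (z : Fin m → ℂ) w →
          (∑ᶜ λ k → 1# • z k) *ᶜ w ≈ᶜ ((∑ λ k → Re (z k *ᶜ w)) +i (∑ λ k → Im (z k *ᶜ w)))
        sum-* {zero}  z w = ℂR.zeroˡ w
        sum-* {suc m} z w = ℂR.trans (ℂR.distribʳ w (1# • z zero) (∑ᶜ λ k → 1# • z (suc k)))
          (ℂR.+-cong (ℂR.*-congʳ (*-identityˡ _ , *-identityˡ _)) (sum-* (λ k → z (suc k)) w))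

        scaled-unit : ∀ z → normSq z ≈ 1# → (α • z) *ᶜ conj z ≈ᶜ (α +i 0#)
        scaled-unit (a +i b) z≈1 =
          trans (solve 3 (λ α a b → α :* a :* a :- α :* b :* (:- b) := α :* (a :* a :+ b :* b)) refl α a b) (trans (*-congˡ z≈1) (*-identityʳ α)) ,
          solve 3 (λ α a b → α :* a :* (:- b) :+ α :* b :* a := :0) refl α a b

      V≈ : ∀ {u} → u ∈ units d → V u ≈ᶜ ((α + X u) +i Y u)
      V≈ {u} u∈ = ℂR.trans (ℂR.distribʳ (conj (ω zero u)) (α • ω zero u) (∑ᶜ λ k → 1# • ω (suc k) u))
        (ℂR.trans (ℂR.+-cong (scaled-unit (ω zero u) (ω-unimodular zero u∈)) (sum-* (λ k → ω (suc k) u) (conj (ω zero u))))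
        (refl , +-identityˡ (Y u)))

      normSq-Z : ∀ {u} → u ∈ units d → normSq (Z u) ≈ (α + X u) * (α + X u) + Y u * Y u
      normSq-Z {u} u∈ = begin-equality
        normSq (Z u)                                ≈⟨ *-identityʳ _ ⟨
        normSq (Z u) * 1#                           ≈⟨ *-congˡ (unimodular-conj (ω-unimodular zero u∈)) ⟨
        normSq (Z u) * normSq (conj (ω zero u))     ≈⟨ normSq-* (Z u) (conj (ω zero u)) ⟨
        normSq (V u)                                ≈⟨ normSq-cong (V≈ u∈) ⟩
        (α + X u) * (α + X u) + Y u * Y u           ∎

      Re-head : ∀ {u} → u ∈ units d → Re (conj (ω zero u) *ᶜ Z u) ≈ α + X u
      Re-head {u} u∈ = trans (proj₁ (ℂR.*-comm (conj (ω zero u)) (Z u))) (proj₁ (V≈ u∈))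

      -- Inserting ω₁ times its conjugate, which is 1, replaces ωₖ and Z by ηₖ and V.
      Re-tail : ∀ k {u} → u ∈ units d →
        Re (conj (ω (suc k) u) *ᶜ Z u) ≈ α * Re (η k u) + (Re (η k u) * X u + Im (η k u) * Y u)
      Re-tail k {u} u∈ = begin-equality
        Re (conj (ω (suc k) u) *ᶜ Z u)
          ≈⟨ proj₁ (ℂR.trans (ℂR.*-congˡ (unimodular-inverse (ω-unimodular zero u∈))) (ℂR.*-identityʳ (conj (ω (suc k) u) *ᶜ Z u))) ⟨
        Re ((conj (ω (suc k) u) *ᶜ Z u) *ᶜ (ω zero u *ᶜ conj (ω zero u)))
          ≈⟨ proj₁ (ℂI.*-transfer (conj (ω (suc k) u)) (Z u) (ω zero u) (conj (ω zero u))) ⟩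
        Re ((conj (ω (suc k) u) *ᶜ ω zero u) *ᶜ V u)
          ≈⟨ proj₁ (ℂR.*-cong conj-η (ℂR.sym (V≈ u∈))) ⟨
        Re (conj (η k u) *ᶜ ((α + X u) +i Y u))
          ≈⟨ solve 5 (λ x y α X Y → x :* (α :+ X) :- (:- y) :* Y := α :* x :+ (x :* X :+ y :* Y)) refl (Re (η k u)) (Im (η k u)) α (X u) (Y u) ⟩
        α * Re (η k u) + (Re (η k u) * X u + Im (η k u) * Y u) ∎
        where
        conj-η : conj (η k u) ≈ᶜ conj (ω (suc k) u) *ᶜ ω zero u
        conj-η = ℂR.trans (conj-* (ω (suc k) u) (conj (ω zero u))) (ℂR.*-congˡ (conj-involutive (ω zero u)))

-- The threshold and the final comparison.

module LargeHead (em : ExcludedMiddle 0ℓ) (R : CompleteOrderedField) where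

  open OrderedField em R
  open ComplexNumbers em R
  open ExponentialSeries em R
  open RealPowers em R
  open FiniteSums em R
  open PointwiseEstimate em R
  open OrthonormalSystems em R
  open Twists em R using (η; η-orthonormal; normSq-Z; Re-head; Re-tail)
  open PosetReasoning ≤-poset

  ∑Fin-mono-< : ∀ {n} {f g : Fin (suc n) → ℝ} → (∀ k → f k < g k) → ∑ f < ∑ g
  ∑Fin-mono-< f<g = +-mono-<-≤ (f<g zero) (∑Fin-mono (λ k → proj₁ (f<g (suc k))))

  module _ (σ : ℝ) (½<σ : 2# ⁻¹ < σ) (σ<1 : σ < 1#) where

    c : ℝ
    c = σ ⁻¹ - 2#

    private
      0<σ : 0# < σ
      0<σ = <-trans (⁻¹-pos 0<2) ½<σ

      0<1-σ : 0# < 1# - σ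
      0<1-σ = <⇒0<- σ<1

      σ⁻¹<2 : σ ⁻¹ < 2#
      σ⁻¹<2 = *-cancelˡ-< σ (proj₁ 0<σ) (begin-strict
        σ * σ ⁻¹   ≈⟨ ⁻¹-inverse 0<σ ⟩
        1#         ≈⟨ ⁻¹-inverse 0<2 ⟨
        2# * 2# ⁻¹ <⟨ *-monoˡ-< 2# 0<2 ½<σ ⟩
        2# * σ     ≈⟨ *-comm 2# σ ⟩
        σ * 2#     ∎)

      1<σ⁻¹ : 1# < σ ⁻¹
      1<σ⁻¹ = *-cancelˡ-< σ (proj₁ 0<σ) (begin-strict
        σ * 1#    ≈⟨ *-identityʳ σ ⟩
        σ         <⟨ σ<1 ⟩
        1#        ≈⟨ ⁻¹-inverse 0<σ ⟨
        σ * σ ⁻¹  ∎)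

    c<0 : c < 0#
    c<0 = <-by (2# - σ ⁻¹) (<⇒0<- σ⁻¹<2) (solve 1 (λ i → :0 := (i :- (:1 :+ :1)) :+ ((:1 :+ :1) :- i)) refl (σ ⁻¹))

    0<c+1 : 0# < c + 1#
    0<c+1 = <-≈-trans (<⇒0<- 1<σ⁻¹) (solve 1 (λ i → i :- :1 := i :- (:1 :+ :1) :+ :1) refl (σ ⁻¹))

    1<q : 1# < (1# - σ) ⁻¹
    1<q = *-cancelˡ-< (1# - σ) (proj₁ 0<1-σ) (begin-strict
      (1# - σ) * 1#  ≈⟨ *-identityʳ _ ⟩
      1# - σ         <⟨ <-by σ 0<σ (solve 1 (λ σ → :1 := :1 :- σ :+ σ) refl σ) ⟩
      1#             ≈⟨ ⁻¹-inverse 0<1-σ ⟨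
      (1# - σ) * (1# - σ) ⁻¹   ∎)

    -- q = 1/(1 − σ) and c + 2 = 1/σ are Hölder conjugate.
    [q-1][c+1]≈1 : ((1# - σ) ⁻¹ - 1#) * (c + 1#) ≈ 1#
    [q-1][c+1]≈1 = *-cancelˡ-≈ ((1# - σ) * σ) (>⇒≉ (*-pos 0<1-σ 0<σ)) (begin-equality
      (1# - σ) * σ * (((1# - σ) ⁻¹ - 1#) * (c + 1#))
        ≈⟨ solve 3 (λ σ q i → (:1 :- σ) :* σ :* ((q :- :1) :* (i :- (:1 :+ :1) :+ :1)) := ((:1 :- σ) :* q :- (:1 :- σ)) :* (σ :* i :- σ)) refl σ ((1# - σ) ⁻¹) (σ ⁻¹) ⟩
      ((1# - σ) * (1# - σ) ⁻¹ - (1# - σ)) * (σ * σ ⁻¹ - σ)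
        ≈⟨ *-cong (+-congʳ (⁻¹-inverse 0<1-σ)) (+-congʳ (⁻¹-inverse 0<σ)) ⟩
      (1# - (1# - σ)) * (1# - σ)
        ≈⟨ solve 1 (λ σ → (:1 :- (:1 :- σ)) :* (:1 :- σ) := (:1 :- σ) :* σ :* :1) refl σ ⟩
      (1# - σ) * σ * 1# ∎)

    private
      0≤q-1 : 0# ≤ (1# - σ) ⁻¹ - 1#
      0≤q-1 = ≤⇒0≤- (proj₁ 1<q)

    -- In logarithms the claim is (q - 1) log t ≤ log α; this is the bound log t ≤ (c + 1) log α
    -- multiplied by q - 1, as (q - 1)(c + 1) = 1.
    head-power : ∀ {α t} → 0# < α → 0# < t → t ≤ exp ((c + 1#) * log α) → t ^ʳ (1# - σ) ⁻¹ ≤ α * t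
    head-power {α} {t} 0<α 0<t t≤ = begin
      t ^ʳ (1# - σ) ⁻¹
        ≈⟨ ^ʳ-exp ((1# - σ) ⁻¹) 0<t ⟩
      exp ((1# - σ) ⁻¹ * l)
        ≤⟨ exp-mono-≤ (≤-by _ (*-nonNeg 0≤q-1 (≤⇒0≤- l≤)) (trans
             (solve 2 (λ a l → a :+ l := :1 :* a :+ l) refl (log α) l)
             (trans (+-congʳ (*-congʳ (sym [q-1][c+1]≈1)))
             (solve 4 (λ q c a l → (q :- :1) :* (c :+ :1) :* a :+ l := q :* l :+ (q :- :1) :* ((c :+ :1) :* a :- l)) refl ((1# - σ) ⁻¹) c (log α) l)))) ⟩
      exp (log α + l)
        ≈⟨ trans (exp-+ (log α) l) (*-cong (exp-log 0<α) (exp-log 0<t)) ⟩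
      α * t ∎
      where
      l = log t
      l≤ : l ≤ (c + 1#) * log α
      l≤ = ≤-≈-trans (log-≤ 0<t t≤) (log-exp _)

    tail-power : ∀ {t} → 0# < t → t < 1# → t ^ʳ (1# - σ) ⁻¹ < t
    tail-power {t} 0<t t<1 = begin-strict
      t ^ʳ (1# - σ) ⁻¹        ≈⟨ ^ʳ-exp ((1# - σ) ⁻¹) 0<t ⟩
      exp ((1# - σ) ⁻¹ * l)   <⟨ exp-mono-< (<-by (((1# - σ) ⁻¹ - 1#) * (0# - l)) (*-pos (<⇒0<- 1<q) (<⇒0<- l<0))
                         (solve 2 (λ q l → l := q :* l :+ (q :- :1) :* (:0 :- l)) refl ((1# - σ) ⁻¹) l)) ⟩
      exp l         ≈⟨ exp-log 0<t ⟩
      t             ∎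
      where
      l = log t
      l<0 : l < 0#
      l<0 = <-≈-trans (log-< 0<t t<1) log-1

    module _ (n : ℕ) where

      private
        N C B : ℝ
        N = fromℕ (suc n)
        C = fromℕ 6 * (N * N)
        B = 1# + N + C

        0≤N : 0# ≤ N
        0≤N = fromℕ-nonNeg (suc n)

        0≤C : 0# ≤ C
        0≤C = *-nonNeg (fromℕ-nonNeg 6) (sq-nonNeg N)

        0<B : 0# < B
        0<B = +-pos (+-pos 0<1 0≤N) 0≤C

        -- Here N = r - 1. Beyond `s₁` the head dominates the tail, with margin for the expansion.
        -- Beyond `s₂`, α (c + 1) exceeds C strictly, owing to the added 1. Beyond `s₃`, which is
        -- B^(-1/c), the product α^c B drops below 1.
        s₁ s₂ s₃ : ℝ
        s₁ = 2# * N
        s₂ = (C + 1#) * (c + 1#) ⁻¹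
        s₃ = exp (log B * (- c) ⁻¹)

        0≤s₁ : 0# ≤ s₁
        0≤s₁ = *-nonNeg (proj₁ 0<2) 0≤N

        0≤s₂ : 0# ≤ s₂
        0≤s₂ = *-nonNeg (+-nonNeg 0≤C (proj₁ 0<1)) (proj₁ (⁻¹-pos 0<c+1))

        0≤s₃ : 0# ≤ s₃
        0≤s₃ = proj₁ (exp-pos _)

        0<-c : 0# < - c
        0<-c = <-≈-trans (<⇒0<- c<0) (+-identityˡ (- c))

      -- The sum of nonnegative terms serves as a maximum. The summand 1 ensures 1 ≤ α and makes
      -- `s₃` < α strict.
      α₀ : ℝ
      α₀ = 1# + s₁ + s₂ + s₃

      module _ (θ : Fin (suc (suc n)) → ℝ) (χ : Fin (suc (suc n)) → DirichletCharacter)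
        (inequivalent : ∀ i j → i ≢ j → ¬ Equivalent (χ i) (χ j))
        (α : ℝ) (0<α : 0# < α) (α₀≤α : α₀ ≤ α) where

        private
          1≤N : 1# ≤ N
          1≤N = ≤-by (fromℕ n) (fromℕ-nonNeg n) refl

          1≤α : 1# ≤ α
          1≤α = ≤-trans (≤-by (s₁ + s₂ + s₃) (+-nonNeg (+-nonNeg 0≤s₁ 0≤s₂) 0≤s₃) (solve 3 (λ a b c → :1 :+ a :+ b :+ c := :1 :+ (a :+ b :+ c)) refl s₁ s₂ s₃)) α₀≤α

          s₁≤α : s₁ ≤ α
          s₁≤α = ≤-trans (≤-by (1# + s₂ + s₃) (+-nonNeg (+-nonNeg (proj₁ 0<1) 0≤s₂) 0≤s₃) (solve 3 (λ a b c → :1 :+ a :+ b :+ c := a :+ (:1 :+ b :+ c)) refl s₁ s₂ s₃)) α₀≤α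

          s₂≤α : s₂ ≤ α
          s₂≤α = ≤-trans (≤-by (1# + s₁ + s₃) (+-nonNeg (+-nonNeg (proj₁ 0<1) 0≤s₁) 0≤s₃) (solve 3 (λ a b c → :1 :+ a :+ b :+ c := b :+ (:1 :+ a :+ c)) refl s₁ s₂ s₃)) α₀≤α

          s₃<α : s₃ < α
          s₃<α = <-≤-trans (<-by (1# + s₁ + s₂) (+-pos (+-pos 0<1 0≤s₁) 0≤s₂) (solve 3 (λ a b c → :1 :+ a :+ b :+ c := c :+ (:1 :+ a :+ b)) refl s₁ s₂ s₃)) α₀≤α

          C<α[c+1] : C < α * (c + 1#)
          C<α[c+1] = begin-strict
            C                                    <⟨ <-by 1# 0<1 refl ⟩
            C + 1#                               ≈⟨ *-identityʳ _ ⟨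
            (C + 1#) * 1#                        ≈⟨ *-congˡ (⁻¹-inverse 0<c+1) ⟨
            (C + 1#) * ((c + 1#) * (c + 1#) ⁻¹)  ≈⟨ solve 3 (λ a b i → a :* (b :* i) := a :* i :* b) refl (C + 1#) (c + 1#) ((c + 1#) ⁻¹) ⟩
            s₂ * (c + 1#)                        ≤⟨ *-monoʳ-≤ (c + 1#) (proj₁ 0<c+1) s₂≤α ⟩
            α * (c + 1#)                         ∎

          P : ℝ
          P = exp (c * log α)

          PB<1 : P * B < 1#
          PB<1 = begin-strict
            P * B                      ≈⟨ *-congˡ (exp-log 0<B) ⟨
            P * exp (log B)            ≈⟨ exp-+ (c * log α) (log B) ⟨
            exp (c * log α + log B)    <⟨ exp-mono-< (<-by (- c * (log α - log B * (- c) ⁻¹)) (*-pos 0<-c (<⇒0<- logB<))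
                                            (trans (solve 1 (λ b → :0 := b :- b :* :1) refl (log B))
                                            (trans (+-congˡ (-‿cong (*-congˡ (sym (⁻¹-inverse 0<-c)))))
                                            (solve 4 (λ a b c i → b :- b :* ((:- c) :* i) := c :* a :+ b :+ (:- c) :* (a :- b :* i)) refl (log α) (log B) c ((- c) ⁻¹))))) ⟩
            exp 0#                     ≈⟨ exp-0 ⟩
            1#                         ∎
            where
            logB< : log B * (- c) ⁻¹ < log α
            logB< = ≈-<-trans (sym (log-exp _)) (log-< (exp-pos _) s₃<α)

          T : ℕ → ℝ
          T u = abs (combination χ θ (headThenOnes α) u)

          orthonormal : Functions.IsOrthonormal (units (lcmModuli χ)) (η χ θ inequivalent)
          orthonormal = η-orthonormal χ θ inequivalent

          open Functions (units (lcmModuli χ)) (η χ θ inequivalent) using (X; Y)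

          T² : ∀ {u} → u ∈ units (lcmModuli χ) → T u * T u ≈ (α + X u) * (α + X u) + Y u * Y u
          T² {u} u∈ = trans (proj₂ (abs-spec (combination χ θ (headThenOnes α) u))) (normSq-Z χ θ inequivalent α u∈)

        open Orthonormal orthonormal using (D; D-pos; module Means)
        open Means {c} {α} {T} 0<c+1 c<0 1≤N s₁≤α (λ {u} _ → proj₁ (abs-spec (combination χ θ (headThenOnes α) u))) T²
          using (W; J₀; J; T-pos; J₀-pos; J₀-upper; J-pos; J-upper; weighted-T²)

        private
          -- The constant factor α^c/φ(d) of every mean, left after the powers of |Z| have been
          -- replaced by weights.
          scale : ℝ
          scale = D ⁻¹ * P

          scale-pos : 0# < scale
          scale-pos = *-pos (⁻¹-pos D-pos) (exp-pos _)

          scale-D : ∀ a → scale * (D * a) ≈ P * a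
          scale-D a = begin-equality
            D ⁻¹ * P * (D * a)    ≈⟨ solve 4 (λ i P D a → i :* P :* (D :* a) := D :* i :* (P :* a)) refl (D ⁻¹) P D a ⟩
            D * D ⁻¹ * (P * a)    ≈⟨ *-congʳ (⁻¹-inverse D-pos) ⟩
            1# * (P * a)          ≈⟨ *-identityˡ _ ⟩
            P * a                 ∎

          nonvanishing : ∀ {u} → u ∈ units (lcmModuli χ) → ¬ (combination χ θ (headThenOnes α) u ≈ᶜ 0ᶜ)
          nonvanishing {u} u∈ Z≈0 = >⇒≉ (*-pos (T-pos u∈) (T-pos u∈))
            (trans (proj₂ (abs-spec (combination χ θ (headThenOnes α) u))) (trans (normSq-cong Z≈0) (solve 0 (:0 :* :0 :+ :0 :* :0 := :0) refl)))

          -- As |Z| ≥ α + X > 0 at every unit, the starred sum omits nothing.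
          all-nonvanishing : nonvanishingUnits χ θ (headThenOnes α) ≡ units (lcmModuli χ)
          all-nonvanishing = filter-all (λ u → em {¬ (combination χ θ (headThenOnes α) u ≈ᶜ 0ᶜ)}) (All.tabulate nonvanishing)

          mean-Ξ : ∀ j {g : ℕ → ℝ} → (∀ {u} → u ∈ units (lcmModuli χ) → Re (conj (twist χ θ j u) *ᶜ combination χ θ (headThenOnes α) u) ≈ g u) →
                   Ξ σ χ θ (headThenOnes α) j ≈ scale * ∑[ units (lcmModuli χ) ] (λ u → W u * g u)
          mean-Ξ j {g} Re≈g = trans
            (*-congˡ (trans (reflexive (cong (λ us → ∑[ us ] F) all-nonvanishing))
              (trans (∑-cong (units (lcmModuli χ)) summand) (∑-*ˡ (units (lcmModuli χ)) P (λ u → W u * g u)))))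
            (sym (*-assoc (D ⁻¹) P _))
            where
            F : ℕ → ℝ
            F u = T u ^ʳ c * Re (conj (twist χ θ j u) *ᶜ combination χ θ (headThenOnes α) u)
            summand : ∀ {u} → u ∈ units (lcmModuli χ) → F u ≈ P * (W u * g u)
            summand {u} u∈ = trans (*-cong (trans (^ʳ-exp c (T-pos u∈)) (power≈weight c α (T u))) (Re≈g u∈)) (*-assoc P (W u) (g u))

          Ξ-head : Ξ σ χ θ (headThenOnes α) zero ≈ scale * J₀
          Ξ-head = mean-Ξ zero (Re-head χ θ inequivalent α)

          Ξ-tail : ∀ k → Ξ σ χ θ (headThenOnes α) (suc k) ≈ scale * J k
          Ξ-tail k = mean-Ξ (suc k) (Re-tail χ θ inequivalent α k)

          ξ-decomposition : ξ σ χ θ (headThenOnes α) ≈ α * Ξ σ χ θ (headThenOnes α) zero + ∑ (λ k → Ξ σ χ θ (headThenOnes α) (suc k))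
          ξ-decomposition = begin-equality
            D ⁻¹ * ∑[ units (lcmModuli χ) ] (λ u → T u ^ʳ (σ ⁻¹))
              ≈⟨ *-congˡ (trans (∑-cong (units (lcmModuli χ)) summand) (∑-*ˡ (units (lcmModuli χ)) P (λ u → W u * (T u * T u)))) ⟩
            D ⁻¹ * (P * ∑[ units (lcmModuli χ) ] (λ u → W u * (T u * T u)))
              ≈⟨ *-assoc (D ⁻¹) P _ ⟨
            scale * ∑[ units (lcmModuli χ) ] (λ u → W u * (T u * T u))
              ≈⟨ *-congˡ weighted-T² ⟩
            scale * (α * J₀ + ∑ J)
              ≈⟨ solve 4 (λ s α j k → s :* (α :* j :+ k) := α :* (s :* j) :+ s :* k) refl scale α J₀ (∑ J) ⟩
            α * (scale * J₀) + scale * ∑ J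
              ≈⟨ +-cong (*-congˡ Ξ-head) (trans (∑Fin-cong Ξ-tail) (∑Fin-*ˡ scale J)) ⟨
            α * Ξ σ χ θ (headThenOnes α) zero + ∑ (λ k → Ξ σ χ θ (headThenOnes α) (suc k)) ∎
            where
            summand : ∀ {u} → u ∈ units (lcmModuli χ) → T u ^ʳ (σ ⁻¹) ≈ P * (W u * (T u * T u))
            summand {u} u∈ = begin-equality
              T u ^ʳ (σ ⁻¹)
                ≈⟨ ^ʳ-exp (σ ⁻¹) (T-pos u∈) ⟩
              exp (σ ⁻¹ * t)
                ≈⟨ exp-cong (solve 2 (λ i t → i :* t := (i :- (:1 :+ :1)) :* t :+ (t :+ t)) refl (σ ⁻¹) t) ⟩
              exp (c * t + (t + t))
                ≈⟨ trans (exp-+ (c * t) (t + t)) (*-cong (power≈weight c α (T u)) (trans (exp-+ t t) (*-cong (exp-log (T-pos u∈)) (exp-log (T-pos u∈))))) ⟩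
              P * W u * (T u * T u)
                ≈⟨ *-assoc P (W u) _ ⟩
              P * (W u * (T u * T u)) ∎
              where t = log (T u)

        Ξ-pos : ∀ j → 0# < Ξ σ χ θ (headThenOnes α) j
        Ξ-pos zero    = <-≈-trans (*-pos scale-pos J₀-pos) (sym Ξ-head)
        Ξ-pos (suc k) = <-≈-trans (*-pos scale-pos (J-pos C<α[c+1] k)) (sym (Ξ-tail k))

        private
          Ξ-head-upper : Ξ σ χ θ (headThenOnes α) zero ≤ exp ((c + 1#) * log α)
          Ξ-head-upper = begin
            Ξ σ χ θ (headThenOnes α) zero              ≈⟨ Ξ-head ⟩
            scale * J₀                   ≤⟨ *-monoˡ-≤ scale (proj₁ scale-pos) J₀-upper ⟩
            scale * (D * α)              ≈⟨ scale-D α ⟩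
            P * α                        ≈⟨ *-congˡ (exp-log 0<α) ⟨
            P * exp (log α)              ≈⟨ exp-+ (c * log α) (log α) ⟨
            exp (c * log α + log α)      ≈⟨ exp-cong (solve 2 (λ c l → c :* l :+ l := (c :+ :1) :* l) refl c (log α)) ⟩
            exp ((c + 1#) * log α)       ∎

          Ξ-tail<1 : ∀ k → Ξ σ χ θ (headThenOnes α) (suc k) < 1#
          Ξ-tail<1 k = begin-strict
            Ξ σ χ θ (headThenOnes α) (suc k)    ≈⟨ Ξ-tail k ⟩
            scale * J k           ≤⟨ *-monoˡ-≤ scale (proj₁ scale-pos) (J-upper 1≤α k) ⟩
            scale * (D * B)       ≈⟨ scale-D B ⟩
            P * B                 <⟨ PB<1 ⟩
            1#                    ∎

        -- The head only gives a weak inequality; strictness comes from the tail, which is nonempty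
        -- because r ≥ 2.
        ∑Ξ<ξ : ∑ (λ j → Ξ σ χ θ (headThenOnes α) j ^ʳ ((1# - σ) ⁻¹)) < ξ σ χ θ (headThenOnes α)
        ∑Ξ<ξ = begin-strict
          ∑ (λ j → Ξ σ χ θ (headThenOnes α) j ^ʳ ((1# - σ) ⁻¹))
            <⟨ +-mono-≤-< (head-power 0<α (Ξ-pos zero) Ξ-head-upper) (∑Fin-mono-< (λ k → tail-power (Ξ-pos (suc k)) (Ξ-tail<1 k))) ⟩
          α * Ξ σ χ θ (headThenOnes α) zero + ∑ (λ k → Ξ σ χ θ (headThenOnes α) (suc k))
            ≈⟨ ξ-decomposition ⟨
          ξ σ χ θ (headThenOnes α) ∎

  positivity-and-dominance : (σ : ℝ) → 2# ⁻¹ < σ → σ < 1# → (r : ℕ) → 2 ℕ.≤ r →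
    Σ ℝ λ α₀ →
    (θ : Fin r → ℝ) (χ : Fin r → DirichletCharacter) →
    (∀ i j → i ≢ j → ¬ Equivalent (χ i) (χ j)) →
    (α : ℝ) → 0# < α → α₀ ≤ α →
    (∀ j → 0# < Ξ σ χ θ (headThenOnes α) j) ×
    (∑ (λ j → Ξ σ χ θ (headThenOnes α) j ^ʳ ((1# - σ) ⁻¹)) < ξ σ χ θ (headThenOnes α))
  positivity-and-dominance σ ½<σ σ<1 (suc (suc n)) (ℕ.s≤s (ℕ.s≤s ℕ.z≤n)) =
    α₀ σ ½<σ σ<1 n , λ θ χ inequivalent α 0<α α₀≤α →
      Ξ-pos σ ½<σ σ<1 n θ χ inequivalent α 0<α α₀≤α , ∑Ξ<ξ σ ½<σ σ<1 n θ χ inequivalent α 0<α α₀≤α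

theorem5 : (em : ExcludedMiddle 0ℓ) (R : CompleteOrderedField) →
    let open Analysis em R in
    (σ : ℝ) → (1# + 1#) ⁻¹ < σ → σ < 1# →
    (r : ℕ) → 2 ℕ.≤ r →
    Σ ℝ λ α₀ →
    (θ : Fin r → ℝ) (χ : Fin r → DirichletCharacter) →
    (∀ i j → i ≢ j → ¬ Equivalent (χ i) (χ j)) →
    (α : ℝ) → 0# < α → α₀ ≤ α →
    (∀ j → 0# < Ξ σ χ θ (headThenOnes α) j) ×
    (∑ (λ j → Ξ σ χ θ (headThenOnes α) j ^ʳ ((1# - σ) ⁻¹)) < ξ σ χ θ (headThenOnes α))
-- Not eta-expanded in em: the comparison of types is then syntactic, hence fast.
theorem5 = LargeHead.positivity-and-dominance
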